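{- Let $m = m_n \ge 1$ and let $f = f_n$ be a probability distribution on $\{1,\dots,n\}$ such that $m f(x)$ is an integer with $m f(x) \le \binom{n}{x}$ for every $x = 1,\dots,n$, and let $H_{nmf}$ be the random hypergraph defined in the context. Assume that $\sum_{x=1}^n \binom{n}{x}^{ -1} f(x)^2 \ll m^{ -2}$ and $(f)_2 \lesssim (f)_0$. Then, as $n\to\infty$, \[ \mathbb{P}(H_{nmf} \text{ is connected}) \to \begin{cases} 0 & \text{if } \log n - \frac{m}{n}(f)_1 \to +\infty,\\ 1 & \text{if } \log n - \frac{m}{n}(f)_1 \to -\infty.\end{cases} \]
   Context: A hypergraph $h=(V_h,E_h)$ consists of a finite node set $V_h$ and a collection $E_h$ of nonempty subsets of $V_h$ (hyperedges). It is connected if for every partition of $V_h$ into nonempty sets $V_1,V_2$ there is a hyperedge $e\in E_h$ with $e\cap V_1\neq\emptyset$ and $e\cap V_2\ne\emptyset$. The empirical hyperedge size distribution of $h$ is $f(x) = |E_h|^{ -1}\sum_{e\in E_h} 1(|e| = x)$. $\mathcal{H}_{nmf}$ denotes the set of hypergraphs on node set $\{1,\dots,n\}$ with exactly $m$ (distinct) hyperedges and empirical hyperedge size distribution $f$; $H_{nmf}$ is a uniformly random element of $\mathcal{H}_{nmf}$. Moments: $(f)_r = \sum_{x=2}^n x^r f(x)$. Asymptotic notation: $a_n \ll b_n$ means $a_n/|b_n|\to 0$; $a_n\lesssim b_n$ means $\limsup a_n/|b_n| <\infty$. -}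

module Defs where

open import Data.Bool.Properties using () renaming (_≟_ to _≟ᵇ_)
open import Data.Fin using (Fin; zero; suc; toℕ)
open import Data.Fin.Properties using () renaming (all? to allFin?)
open import Data.Fin.Subset
  using (Subset; Nonempty; Empty; inside; outside; ⊤; ∣_∣; _∩_; _∪_)
open import Data.Fin.Subset.Properties using (nonempty?; anySubset?)
import Data.Integer as ℤ
import Data.Integer.Properties as ℤₚ
open import Data.List using (List; []; _∷_; _++_; map; filter; length)
open import Data.List.Membership.Propositional using (_∈_)
open import Data.List.Membership.Propositional.Properties
  using (∈-map⁺; ∈-map⁻; ∈-++⁺ˡ; ∈-++⁺ʳ; ∈-filter⁺)
open import Data.List.Relation.Binary.Sublist.Propositional
  using (_⊆_; []; _∷_; _∷ʳ_)
open import Data.List.Relation.Unary.All using ([]; _∷_)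
open import Data.List.Relation.Unary.AllPairs using ([]; _∷_)
open import Data.List.Relation.Unary.Any using (Any; any?; here)
open import Data.List.Relation.Unary.Unique.Propositional using (Unique)
import Data.List.Relation.Unary.Unique.Propositional.Properties as Uniqueₚ
open import Data.Nat using (ℕ; zero; suc; z≤n; s≤s)
import Data.Nat as ℕ
import Data.Nat.Properties as ℕₚ
open import Data.Product using (∃-syntax; _×_; _,_)
open import Data.Rational
  using (ℚ; 0ℚ; 1ℚ; _/_; _+_; _*_; _-_; -_; _≤_; _<_)
  renaming (∣_∣ to abs)
import Data.Rational.Properties as ℚₚ
open import Data.Rational.Unnormalised using (mkℚᵘ; *≤*; *≡*)
import Data.Rational.Unnormalised.Properties as ℚᵘₚ
open import Data.Vec using ([]; _∷_)
open import Data.Vec.Properties using (≡-dec)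
open import Function using (_∘_)
open import Relation.Binary.PropositionalEquality
  using (_≡_; refl; sym; trans; cong; subst; subst₂; module ≡-Reasoning)
open import Relation.Nullary using (Dec; ¬_)
open import Relation.Nullary.Decidable
  using (¬?; _×-dec_; _→-dec_; map′; decidable-stable)
open import Relation.Unary using (Decidable)

open import Algebra.Properties.Group ℚₚ.+-0-group using (⁻¹-involutive)
open import Algebra.Properties.Monoid.Sum ℚₚ.+-0-monoid public
  using (sum; sum-syntax)

fromℕ : ℕ → ℚ
fromℕ a = ℤ.+ a / 1

-- Total quotient, with the convention a ÷ 0 = 0.

infixl 7 _÷_

_÷_ : ℕ → ℕ → ℚ
a ÷ zero  = 0ℚ
a ÷ suc b = ℤ.+ a / suc b

Eventually : (ℕ → Set) → Set
Eventually Q = ∃[ N ] (∀ n → N ℕ.≤ n → Q n)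

infix 4 _⟶_ _≪_ _≲_

_⟶_ : (ℕ → ℚ) → ℚ → Set
a ⟶ l = ∀ ε → 0ℚ < ε → Eventually λ n → abs (a n - l) < ε

-- a n / |b n| → 0 and limsup a n / |b n| < ∞, with the denominators cleared.

_≪_ : (ℕ → ℚ) → (ℕ → ℚ) → Set
a ≪ b = ∀ ε → 0ℚ < ε → Eventually λ n → abs (a n) ≤ ε * abs (b n)

_≲_ : (ℕ → ℚ) → (ℕ → ℚ) → Set
a ≲ b = ∃[ C ] Eventually λ n → a n ≤ C * abs (b n)

-- Real numbers as regular sequences of rationals (Bishop):
-- `approx k` is within 1/(k+1) of the real represented.

record ℝ : Set where
  field
    approx  : ℕ → ℚ
    regular : ∀ j k → abs (approx j - approx k) ≤ 1 ÷ suc j + 1 ÷ suc k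

open ℝ public

infixl 6 _-ℚ_

_-ℚ_ : ℝ → ℚ → ℝ
approx  (x -ℚ q) k = approx x k - q
regular (x -ℚ q) j k =
  subst (λ d → abs d ≤ 1 ÷ suc j + 1 ÷ suc k)
        (sym (shift (approx x j) (approx x k))) (regular x j k)
  where
  open ≡-Reasoning
  shift : ∀ a b → (a - q) - (b - q) ≡ a - b
  shift a b = begin
    (a - q) - (b - q)         ≡⟨ cong ((a - q) +_) (ℚₚ.neg-distrib-+ b (- q)) ⟩
    (a - q) + (- b + - (- q)) ≡⟨ cong ((a - q) +_) (ℚₚ.+-comm (- b) (- (- q))) ⟩
    (a - q) + (- (- q) - b)   ≡⟨ ℚₚ.+-assoc a (- q) _ ⟩
    a + (- q + (- (- q) - b)) ≡⟨ cong (a +_) (sym (ℚₚ.+-assoc (- q) (- (- q)) (- b))) ⟩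
    a + ((- q + - (- q)) - b) ≡⟨ cong (λ z → a + (z - b)) (ℚₚ.+-inverseʳ (- q)) ⟩
    a + (0ℚ - b)              ≡⟨ cong (a +_) (ℚₚ.+-identityˡ (- b)) ⟩
    a - b                     ∎

infix 4 _≤ℝ_ _ℝ≤_

_≤ℝ_ : ℚ → ℝ → Set
q ≤ℝ x = ∀ k → q ≤ approx x k + 1 ÷ suc k

_ℝ≤_ : ℝ → ℚ → Set
x ℝ≤ q = ∀ k → approx x k - 1 ÷ suc k ≤ q

_⟶+∞ : (ℕ → ℝ) → Set
x ⟶+∞ = ∀ K → Eventually λ n → K ≤ℝ x n

_⟶-∞ : (ℕ → ℝ) → Set
x ⟶-∞ = ∀ K → Eventually λ n → x n ℝ≤ K

-- Natural logarithm of a positive integer, log n = ∫₁ⁿ dt/t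

-- recipSum c k = 1/(k+1) + 1/(k+2) + … + 1/(k+c)

recipSum : ℕ → ℕ → ℚ
recipSum zero    k = 0ℚ
recipSum (suc c) k = 1 ÷ suc k + recipSum c (suc k)

-- The lower Riemann sum of 1/t on [1,n] with mesh 1/k:
-- Σ_{i=1}^{k(n-1)} (1/k) · 1/(1 + i/k) = Σ_{i=1}^{k(n-1)} 1/(k+i).
-- It differs from the integral by at most 1/k.

lowerSum : ℕ → ℕ → ℚ
lowerSum n k = recipSum (k ℕ.* (n ℕ.∸ 1)) k

private

  ÷-mono : ∀ {a b c d} → a ℕ.* suc d ℕ.≤ c ℕ.* suc b → a ÷ suc b ≤ c ÷ suc d
  ÷-mono {a} {b} {c} {d} le = ℚₚ.toℚᵘ-cancel-≤
    (ℚᵘₚ.≤-respˡ-≃ (ℚᵘₚ.≃-sym (ℚₚ.toℚᵘ-fromℚᵘ (mkℚᵘ (ℤ.+ a) b)))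
    (ℚᵘₚ.≤-respʳ-≃ (ℚᵘₚ.≃-sym (ℚₚ.toℚᵘ-fromℚᵘ (mkℚᵘ (ℤ.+ c) d)))
    (*≤* (subst₂ ℤ._≤_ (ℤₚ.pos-* a (suc d)) (ℤₚ.pos-* c (suc b)) (ℤ.+≤+ le)))))

  ÷-suc : ∀ a d → suc a ÷ suc d ≡ 1 ÷ suc d + a ÷ suc d
  ÷-suc a d = ℚₚ.toℚᵘ-injective (begin-equality
    toℚᵘ (suc a ÷ suc d)                      ≃⟨ ℚₚ.toℚᵘ-fromℚᵘ (mkℚᵘ (ℤ.+ suc a) d) ⟩
    mkℚᵘ (ℤ.+ suc a) d                        ≃⟨ *≡* lem ⟩
    mkℚᵘ (ℤ.+ 1) d ℚᵘ.+ mkℚᵘ (ℤ.+ a) d        ≃⟨ ℚᵘₚ.+-cong (ℚₚ.toℚᵘ-fromℚᵘ (mkℚᵘ (ℤ.+ 1) d))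
                                                            (ℚₚ.toℚᵘ-fromℚᵘ (mkℚᵘ (ℤ.+ a) d)) ⟨
    toℚᵘ (1 ÷ suc d) ℚᵘ.+ toℚᵘ (a ÷ suc d)    ≃⟨ ℚₚ.toℚᵘ-homo-+ (1 ÷ suc d) (a ÷ suc d) ⟨
    toℚᵘ (1 ÷ suc d + a ÷ suc d)              ∎)
    where
    open import Data.Rational using (toℚᵘ)
    import Data.Rational.Unnormalised as ℚᵘ
    open ℚᵘₚ.≤-Reasoning
    D = ℤ.+ suc d
    lem : ℤ.+ suc a ℤ.* (D ℤ.* D) ≡ (ℤ.+ 1 ℤ.* D ℤ.+ ℤ.+ a ℤ.* D) ℤ.* D
    lem = trans (sym (ℤₚ.*-assoc (ℤ.+ suc a) D D))
                (cong (ℤ._* D) (ℤₚ.*-distribʳ-+ D (ℤ.+ 1) (ℤ.+ a)))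

  recipSum-≥0 : ∀ c k → 0ℚ ≤ recipSum c k
  recipSum-≥0 zero    k = ℚₚ.≤-refl
  recipSum-≥0 (suc c) k =
    ℚₚ.≤-trans (ℚₚ.≤-reflexive (sym (ℚₚ.+-identityˡ 0ℚ)))
      (ℚₚ.+-mono-≤ (÷-mono {0} {0} {1} {k} z≤n) (recipSum-≥0 c (suc k)))

  recipSum-++ : ∀ a b k → recipSum (a ℕ.+ b) k ≡ recipSum a k + recipSum b (a ℕ.+ k)
  recipSum-++ zero    b k = sym (ℚₚ.+-identityˡ _)
  recipSum-++ (suc a) b k =
    trans (cong (1 ÷ suc k +_) (trans (recipSum-++ a b (suc k))
                              (cong (λ z → recipSum a (suc k) + recipSum b z) (ℕₚ.+-suc a k))))
          (sym (ℚₚ.+-assoc (1 ÷ suc k) (recipSum a (suc k)) (recipSum b (suc (a ℕ.+ k)))))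

  recipSum-lower : ∀ c k d → c ℕ.+ k ℕ.≤ suc d → c ÷ suc d ≤ recipSum c k
  recipSum-lower zero    k d le = ÷-mono {0} {d} {0} {0} z≤n
  recipSum-lower (suc c) k d le =
    ℚₚ.≤-trans (ℚₚ.≤-reflexive (÷-suc c d))
      (ℚₚ.+-mono-≤
        (÷-mono {1} {d} {1} {k}
          (ℕₚ.*-monoʳ-≤ 1 (s≤s (ℕₚ.≤-trans (ℕₚ.m≤n+m k c) (ℕ.s≤s⁻¹ le)))))
        (recipSum-lower c (suc k) d (subst (ℕ._≤ suc d) (sym (ℕₚ.+-suc c k)) le)))

  recipSum-upper : ∀ c k d → d ℕ.≤ k → recipSum c k ≤ c ÷ suc d
  recipSum-upper zero    k d le = ÷-mono {0} {0} {0} {d} z≤n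
  recipSum-upper (suc c) k d le =
    ℚₚ.≤-trans
      (ℚₚ.+-mono-≤ (÷-mono {1} {k} {1} {d} (ℕₚ.*-monoʳ-≤ 1 (s≤s le)))
                   (recipSum-upper c (suc k) d (ℕₚ.m≤n⇒m≤1+n le)))
      (ℚₚ.≤-reflexive (sym (÷-suc c d)))

  -- Refining the mesh by a factor l+1 does not decrease the lower sum …
  refine-lower : ∀ c k l → recipSum c k ≤ recipSum (c ℕ.* suc l) (k ℕ.* suc l)
  refine-lower zero    k l = ℚₚ.≤-refl
  refine-lower (suc c) k l =
    ℚₚ.≤-trans
      (ℚₚ.+-mono-≤
        (ℚₚ.≤-trans
          (÷-mono {1} {k} {suc l} {l ℕ.+ k ℕ.* suc l}
            (ℕₚ.≤-reflexive (trans (ℕₚ.*-identityˡ _) (ℕₚ.*-comm (suc k) (suc l)))))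
          (recipSum-lower (suc l) (k ℕ.* suc l) (l ℕ.+ k ℕ.* suc l) ℕₚ.≤-refl))
        (refine-lower c (suc k) l))
      (ℚₚ.≤-reflexive (sym (recipSum-++ (suc l) (c ℕ.* suc l) (k ℕ.* suc l))))

  -- … but not beyond the coarser upper sum.
  refine-upper : ∀ c p l → recipSum (c ℕ.* suc l) (suc p ℕ.* suc l) ≤ recipSum c p
  refine-upper zero    p l = ℚₚ.≤-refl
  refine-upper (suc c) p l =
    ℚₚ.≤-trans
      (ℚₚ.≤-reflexive (recipSum-++ (suc l) (c ℕ.* suc l) (suc p ℕ.* suc l)))
      (ℚₚ.+-mono-≤
        (ℚₚ.≤-trans
          (recipSum-upper (suc l) (suc p ℕ.* suc l) (l ℕ.+ p ℕ.* suc l) (ℕₚ.n≤1+n _))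
          (÷-mono {suc l} {l ℕ.+ p ℕ.* suc l} {1} {p}
            (ℕₚ.≤-reflexive (trans (ℕₚ.*-comm (suc l) (suc p)) (sym (ℕₚ.*-identityˡ _))))))
        (refine-upper c (suc p) l))

  recipSum-shift : ∀ c p → recipSum c p ≤ 1 ÷ suc p + recipSum c (suc p)
  recipSum-shift c p =
    subst (recipSum c p ≤_)
      (trans (sym (recipSum-++ c 1 p)) (cong (λ z → recipSum z p) (ℕₚ.+-comm c 1)))
      (ℚₚ.≤-trans (ℚₚ.≤-reflexive (sym (ℚₚ.+-identityʳ _)))
                  (ℚₚ.+-monoʳ-≤ (recipSum c p) (recipSum-≥0 1 (c ℕ.+ p))))

  rotate : ∀ k d l → k ℕ.* d ℕ.* l ≡ k ℕ.* l ℕ.* d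
  rotate k d l = trans (ℕₚ.*-assoc k d l)
    (trans (cong (k ℕ.*_) (ℕₚ.*-comm d l)) (sym (ℕₚ.*-assoc k l d)))

  lowerSum-mono : ∀ n p l → lowerSum n (suc p) ≤ lowerSum n (suc p ℕ.* suc l)
  lowerSum-mono n p l =
    subst (λ c → lowerSum n (suc p) ≤ recipSum c (suc p ℕ.* suc l))
      (rotate (suc p) (n ℕ.∸ 1) (suc l)) (refine-lower (suc p ℕ.* (n ℕ.∸ 1)) (suc p) l)

  lowerSum-bound : ∀ n p l →
    lowerSum n (suc p ℕ.* suc l) ≤ 1 ÷ suc p + lowerSum n (suc p)
  lowerSum-bound n p l =
    subst (λ c → recipSum c (suc p ℕ.* suc l) ≤ 1 ÷ suc p + lowerSum n (suc p))
      (rotate (suc p) (n ℕ.∸ 1) (suc l))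
      (ℚₚ.≤-trans (refine-upper (suc p ℕ.* (n ℕ.∸ 1)) p l)
                  (recipSum-shift (suc p ℕ.* (n ℕ.∸ 1)) p))

  cancel : ∀ a b → (a + b) - b ≡ a
  cancel a b = trans (ℚₚ.+-assoc a b (- b))
    (trans (cong (a +_) (ℚₚ.+-inverseʳ b)) (ℚₚ.+-identityʳ a))

  abs-near : ∀ {r x δ} → x ≤ r → r ≤ δ + x → abs (r - x) ≤ δ
  abs-near {r} {x} {δ} x≤r r≤δ+x =
    subst (_≤ δ) (sym (ℚₚ.0≤p⇒∣p∣≡p
        (subst (_≤ r - x) (ℚₚ.+-inverseʳ x) (ℚₚ.+-monoˡ-≤ (- x) x≤r))))
      (subst (r - x ≤_) (cancel δ x) (ℚₚ.+-monoˡ-≤ (- x) r≤δ+x))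

  abs-triangle : ∀ r x y → abs (x - y) ≤ abs (r - x) + abs (r - y)
  abs-triangle r x y =
    ℚₚ.≤-trans (ℚₚ.≤-reflexive (cong abs (sym eq)))
      (ℚₚ.≤-trans (ℚₚ.∣p-q∣≤∣p∣+∣q∣ (r - y) (r - x))
        (ℚₚ.≤-reflexive (ℚₚ.+-comm (abs (r - y)) (abs (r - x)))))
    where
    open ≡-Reasoning
    eq : (r - y) - (r - x) ≡ x - y
    eq = begin
      (r - y) - (r - x)         ≡⟨ cong ((r - y) +_) (ℚₚ.neg-distrib-+ r (- x)) ⟩
      (r - y) + (- r + - (- x)) ≡⟨ cong (λ z → (r - y) + (- r + z)) (⁻¹-involutive x) ⟩
      (r - y) + (- r + x)       ≡⟨ cong (_+ (- r + x)) (ℚₚ.+-comm r (- y)) ⟩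
      (- y + r) + (- r + x)     ≡⟨ ℚₚ.+-assoc (- y) r _ ⟩
      - y + (r + (- r + x))     ≡⟨ cong (- y +_) (sym (ℚₚ.+-assoc r (- r) x)) ⟩
      - y + ((r - r) + x)       ≡⟨ cong (λ z → - y + (z + x)) (ℚₚ.+-inverseʳ r) ⟩
      - y + (0ℚ + x)            ≡⟨ cong (- y +_) (ℚₚ.+-identityˡ x) ⟩
      - y + x                   ≡⟨ ℚₚ.+-comm (- y) x ⟩
      x - y                     ∎

log : ℕ → ℝ
approx  (log n) k   = lowerSum n (suc k)
regular (log n) j k =
  ℚₚ.≤-trans (abs-triangle r (lowerSum n (suc j)) (lowerSum n (suc k)))
    (ℚₚ.+-mono-≤ {abs (r - lowerSum n (suc j))} {1 ÷ suc j}
                 {abs (r - lowerSum n (suc k))} {1 ÷ suc k}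
      (abs-near (lowerSum-mono n j k) (lowerSum-bound n j k))
      (abs-near
        (subst (lowerSum n (suc k) ≤_) comm (lowerSum-mono n k j))
        (subst (_≤ 1 ÷ suc k + lowerSum n (suc k)) comm (lowerSum-bound n k j))))
  where
  r    = lowerSum n (suc j ℕ.* suc k)
  comm : lowerSum n (suc k ℕ.* suc j) ≡ r
  comm = cong (lowerSum n) (ℕₚ.*-comm (suc k) (suc j))

-- Distributions on {1,…,n}.  The point x of {1,…,n} is the index i : Fin n
-- with size i = x.

size : ∀ {n} → Fin n → ℕ
size i = suc (toℕ i)

record IsDistribution {n : ℕ} (f : Fin n → ℚ) : Set where
  field
    nonNegative : ∀ x → 0ℚ ≤ f x
    total       : sum f ≡ 1ℚ

-- (f)_r = Σ_{x=2}^n x^r f(x): the sum starts at 2, so f zero is left out.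

moment : ∀ {n} → ℕ → (Fin n → ℚ) → ℚ
moment {zero}  r f = 0ℚ
moment {suc n} r f = ∑[ i < n ] (fromℕ (size (suc i) ℕ.^ r) * f (suc i))

subsets : ∀ n → List (Subset n)
subsets zero    = [] ∷ []
subsets (suc n) = map (outside ∷_) (subsets n) ++ map (inside ∷_) (subsets n)

nonemptySubsets : ∀ n → List (Subset n)
nonemptySubsets n = filter nonempty? (subsets n)

module _ {A : Set} {x : A} {xs : List A} where

  skip : (∃[ ys ] ys ⊆ xs) → ∃[ ys ] ys ⊆ x ∷ xs
  skip (ys , s) = ys , x ∷ʳ s

  keep : (∃[ ys ] ys ⊆ xs) → ∃[ ys ] ys ⊆ x ∷ xs
  keep (ys , s) = x ∷ ys , refl ∷ s

sublists : ∀ {A : Set} (xs : List A) → List (∃[ ys ] ys ⊆ xs)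
sublists []       = ([] , []) ∷ []
sublists (x ∷ xs) = map skip (sublists xs) ++ map keep (sublists xs)

∈-subsets : ∀ {n} (p : Subset n) → p ∈ subsets n
∈-subsets []            = here refl
∈-subsets (outside ∷ p) = ∈-++⁺ˡ (∈-map⁺ (outside ∷_) (∈-subsets p))
∈-subsets (inside  ∷ p) =
  ∈-++⁺ʳ (map (outside ∷_) (subsets _)) (∈-map⁺ (inside ∷_) (∈-subsets p))

∈-nonemptySubsets : ∀ {n} {p : Subset n} → Nonempty p → p ∈ nonemptySubsets n
∈-nonemptySubsets {p = p} ne = ∈-filter⁺ nonempty? (∈-subsets p) ne

subsets-unique : ∀ n → Unique (subsets n)
subsets-unique zero    = [] ∷ []
subsets-unique (suc n) = Uniqueₚ.++⁺
  (Uniqueₚ.map⁺ (λ { refl → refl }) (subsets-unique n))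
  (Uniqueₚ.map⁺ (λ { refl → refl }) (subsets-unique n))
  (λ (p , q) → disjoint (∈-map⁻ (outside ∷_) p) (∈-map⁻ (inside ∷_) q))
  where
  disjoint : ∀ {v} → ∃[ p ] (p ∈ subsets n × v ≡ outside ∷ p) →
             ¬ (∃[ q ] (q ∈ subsets n × v ≡ inside ∷ q))
  disjoint (_ , _ , refl) (_ , _ , ())

nonemptySubsets-unique : ∀ n → Unique (nonemptySubsets n)
nonemptySubsets-unique n = Uniqueₚ.filter⁺ nonempty? (subsets-unique n)

∈-sublists : ∀ {A : Set} {xs ys : List A} (s : ys ⊆ xs) → (ys , s) ∈ sublists xs
∈-sublists []                       = here refl
∈-sublists (x ∷ʳ s)                 = ∈-++⁺ˡ (∈-map⁺ skip (∈-sublists s))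
∈-sublists {xs = x ∷ xs} (refl ∷ s) =
  ∈-++⁺ʳ (map skip (sublists xs)) (∈-map⁺ keep (∈-sublists s))

sublists-unique : ∀ {A : Set} (xs : List A) → Unique (sublists xs)
sublists-unique []       = [] ∷ []
sublists-unique (x ∷ xs) = Uniqueₚ.++⁺
  (Uniqueₚ.map⁺ (λ { refl → refl }) (sublists-unique xs))
  (Uniqueₚ.map⁺ (λ { refl → refl }) (sublists-unique xs))
  (λ (p , q) → disjoint (∈-map⁻ skip p) (∈-map⁻ keep q))
  where
  disjoint : ∀ {v} → ∃[ t ] (t ∈ sublists xs × v ≡ skip t) →
             ¬ (∃[ t ] (t ∈ sublists xs × v ≡ keep t))
  disjoint (_ , _ , refl) (_ , _ , ())

-- A hypergraph on the node set Fin n.  The set E_h of hyperedges is represented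
-- by the list of its members in the order of `nonemptySubsets n`.  That list
-- contains every nonempty subset exactly once, so hyperedges are distinct and
-- nonempty and each set of hyperedges has exactly one representation.

record Hypergraph (n : ℕ) : Set where
  constructor hypergraph
  field
    edges     : List (Subset n)
    edges⊆all : edges ⊆ nonemptySubsets n

open Hypergraph public

hypergraphs : ∀ n → List (Hypergraph n)
hypergraphs n = map (λ (es , s) → hypergraph es s) (sublists (nonemptySubsets n))

∈-hypergraphs : ∀ {n} (h : Hypergraph n) → h ∈ hypergraphs n
∈-hypergraphs (hypergraph es s) = ∈-map⁺ (λ (es , s) → hypergraph es s) (∈-sublists s)

hypergraphs-unique : ∀ n → Unique (hypergraphs n)
hypergraphs-unique n =
  Uniqueₚ.map⁺ (λ { refl → refl }) (sublists-unique (nonemptySubsets n))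

-- |E_h|⁻¹ Σ_{e ∈ E_h} 1(|e| = x)

empirical : ∀ {n} → Hypergraph n → ℕ → ℚ
empirical h x = length (filter (λ e → ∣ e ∣ ℕ.≟ x) (edges h)) ÷ length (edges h)

Connected : ∀ {n} → Hypergraph n → Set
Connected {n} h = (V₁ V₂ : Subset n) →
  Nonempty V₁ × Nonempty V₂ × Empty (V₁ ∩ V₂) × V₁ ∪ V₂ ≡ ⊤ →
  Any (λ e → Nonempty (e ∩ V₁) × Nonempty (e ∩ V₂)) (edges h)

allSubsets? : ∀ {n} {Q : Subset n → Set} → Decidable Q → Dec (∀ p → Q p)
allSubsets? Q? = map′
  (λ ¬∃¬ p → decidable-stable (Q? p) (λ ¬q → ¬∃¬ (p , ¬q)))
  (λ ∀q (p , ¬q) → ¬q (∀q p))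
  (¬? (anySubset? (¬? ∘ Q?)))

connected? : ∀ {n} → Decidable (Connected {n})
connected? h = allSubsets? λ V₁ → allSubsets? λ V₂ →
  (nonempty? V₁ ×-dec nonempty? V₂ ×-dec ¬? (nonempty? (V₁ ∩ V₂))
    ×-dec ≡-dec _≟ᵇ_ (V₁ ∪ V₂) ⊤)
  →-dec any? (λ e → nonempty? (e ∩ V₁) ×-dec nonempty? (e ∩ V₂)) (edges h)

HasParameters : ∀ {n} → ℕ → (Fin n → ℚ) → Hypergraph n → Set
HasParameters m f h = length (edges h) ≡ m × (∀ x → empirical h (size x) ≡ f x)

hasParameters? : ∀ {n} m (f : Fin n → ℚ) → Decidable (HasParameters m f)
hasParameters? m f h =
  (length (edges h) ℕ.≟ m) ×-dec allFin? (λ x → empirical h (size x) ℚₚ.≟ f x)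

𝓗 : ∀ n → ℕ → (Fin n → ℚ) → List (Hypergraph n)
𝓗 n m f = filter (hasParameters? m f) (hypergraphs n)

-- Probability that a uniformly random member of a duplicate-free list satisfies Q.

ℙ : ∀ {A : Set} {Q : A → Set} → List A → Decidable Q → ℚ
ℙ xs Q? = length (filter Q? xs) ÷ length xs

module Submission where

-- Let μ x = m f(x) be the number of edges of size x, s = (1/n) Σ_{x≥2} x μ x and
-- h = 1/2 + ⋯ + 1/n, which is within 1 of log n.
--
-- Above the threshold, take the union bound over the smaller side V of a cut.  For |V| = k ≤ n/2
-- and t = k/n, an edge of size x ≥ 2 does not cross the cut with probability at most
-- t^x + (1-t)^x ≤ (t² + (1-t)²)^{x/2} ≤ exp(-t(1-t)x), so no edge crosses it with probability
-- at most exp(-k(1-k/n)s).  Since k ≤ n/2, n^{k/n} is at most a constant times (k!)^{1/k}, and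
-- C(n,k) times that probability is at most (1+κ)^{-k} once s - h is large compared with κ.
--
-- Below the threshold, apply Chebyshev's inequality to the number of nodes lying in no edge of
-- size ≥ 2.  By log-concavity of binomial coefficients two nodes have this property with
-- probability at most the product of the individual ones, so the probability that there is no
-- such node is at most the inverse of their expected number, which is at least exp(h - s - 3).
--
-- Instead of a real exponential function, a ≤ b e^q is witnessed by finitely many rationals
-- u ≥ -1 with Σ u ≤ q and a ≤ b ∏ (1 + u).

open import Defs
import Algebra.Properties.CommutativeMonoid.Sum as CommutativeMonoidSum
open import Algebra.Properties.CommutativeSemigroup using (interchange)
import Algebra.Properties.Semiring.Sum as SemiringSum
open import Algebra.Bundles using (CommutativeRing)
open import Data.Bool using (true; false; if_then_else_)
open import Data.Empty using (⊥; ⊥-elim)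
open import Data.Fin using (Fin; zero; suc; toℕ; fromℕ<)
import Data.Fin.Properties as Finₚ
open import Data.Fin.Subset
  using (Subset; Nonempty; Empty; inside; outside; ∣_∣; ⊤; ⁅_⁆; ∁; _∩_)
  renaming (_-_ to _∖_; _⊆_ to _⊆ₛ_; _∈_ to _∈ₛ_; _∉_ to _∉ₛ_)
import Data.Fin.Subset.Properties as Subₚ
import Data.Integer as ℤ
import Data.Integer.Properties as ℤₚ
open import Data.List using (List; []; _∷_; _++_; map; filter; length)
open import Data.List.Membership.Propositional using (lose)
open import Data.List.Relation.Binary.Sublist.Propositional using (_⊆_)
import Data.List.Relation.Binary.Sublist.Propositional.Properties as Sublistₚ
open import Data.List.Relation.Unary.All using (All; []; _∷_; all?)
import Data.List.Relation.Unary.All as All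
import Data.List.Relation.Unary.All.Properties as Allₚ
open import Data.List.Relation.Unary.Any using (Any; here; there; any?)
import Data.List.Relation.Unary.Any as Any
open import Data.Nat using (ℕ; zero; suc; pred; z≤n; s≤s; _^_; _!; _⊔_)
  renaming (_≤_ to _≤ℕ_; _<_ to _<ℕ_)
import Data.Nat as ℕ
import Data.Nat.Combinatorics as Combinatorics
open import Data.Nat.Combinatorics using (_C_)
import Data.Nat.Properties as ℕₚ
open import Data.Nat.Tactic.RingSolver using (solve-∀)
open import Data.Product using (∃-syntax; _×_; _,_; proj₁; proj₂)
open import Data.Sum using (_⊎_; inj₁; inj₂; [_,_]′)
open import Data.Vec using ([]; _∷_; here; there)
open import Data.Vec.Functional using (updateAt)
open import Data.Vec.Functional.Properties using (updateAt-updates; updateAt-minimal)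
open import Function using (_∘_)
open import Relation.Binary.PropositionalEquality
open import Relation.Nullary using (Dec; does; yes; no; ¬_; contradiction)
open import Relation.Nullary.Decidable using (dec-true; dec-false; ¬?; _×-dec_; _⊎-dec_)
open import Relation.Unary using (Decidable)

-- Prescribing `m` and `f` amounts to prescribing the number of edges of each size. So the number of
-- hypergraphs whose edges all satisfy a given condition is a product over sizes of binomials of
-- binomials, and both halves of the proof compare such products in ℕ. Half-integral exponents are
-- removed by squaring.
--
-- Exponential bounds are never evaluated. They are chained until the exponent is visibly `≤ 0`;
-- then ∏ (1 + u) ≤ 1 is a form of AM-GM.
--
-- With l = n - k, the power n^k splits into n^(k²/n) n^(kl/n). The factor exp(-kls/n) defeats the
-- second part once s exceeds log n. The first part has to be paid by the k! in C(n,k) ≤ n^k / k!,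
-- which is why n^(k/n) is compared with (k!)^(1/k).
--
-- Below the threshold the probability that a node is isolated must equal exp(-s) up to a constant
-- factor, so the first-order term has to be exact. The corrections are of order Σ x² μ x / n² and Σ
-- (μ x)² / C(n,x); the hypotheses on (f)_2 and on Σ f(x)² / C(n,x) control them.

module Binomials where

  open import Data.Nat
  open import Data.Nat.Properties

  infixl 6.5 _choose_

  -- Sealed, because unfolding _C_ at successors makes conversion checking blow up.
  opaque
    _choose_ : ℕ → ℕ → ℕ
    n choose k = n C k

    choose≡C : ∀ n k → n choose k ≡ n C k
    choose≡C n k = refl

    pascal : ∀ n k → suc n choose suc k ≡ n choose suc k + n choose k
    pascal n k = trans (sym (Combinatorics.nCk+nC[k+1]≡[n+1]C[k+1] n k)) (+-comm (n C k) _)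

    nC0≡1 : ∀ n → n choose 0 ≡ 1
    nC0≡1 n = refl

    k>n⇒nCk≡0 : ∀ {n k} → n < k → n choose k ≡ 0
    k>n⇒nCk≡0 = Combinatorics.k>n⇒nCk≡0

  -- Identities and inequalities for binomial coefficients.

  absorption : ∀ n k → suc k * (suc n choose suc k) ≡ suc n * (n choose k)
  absorption zero    zero    = cong (1 *_) (trans (pascal 0 0) (cong (_+ (0 choose 0)) (k>n⇒nCk≡0 {0} {1} (s≤s z≤n))))
  absorption zero    (suc k) = trans (cong (suc (suc k) *_) (k>n⇒nCk≡0 {1} {suc (suc k)} (s≤s (s≤s z≤n)))) (trans (*-zeroʳ (suc (suc k))) (sym (cong (1 *_) (k>n⇒nCk≡0 {0} {suc k} (s≤s z≤n)))))
  absorption (suc n) zero    = begin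
    1 * (suc (suc n) choose 1)            ≡⟨ cong (1 *_) (pascal (suc n) 0) ⟩
    1 * (suc n choose 1 + suc n choose 0)      ≡⟨ cong (λ z → 1 * (suc n choose 1 + z)) (nC0≡1 (suc n)) ⟩
    1 * (suc n choose 1 + 1)              ≡⟨ lem (suc n choose 1) ⟩
    1 * (suc n choose 1) + 1              ≡⟨ cong (_+ 1) (absorption n 0) ⟩
    suc n * (n choose 0) + 1              ≡⟨ cong (λ z → suc n * z + 1) (nC0≡1 n) ⟩
    suc n * 1 + 1                    ≡⟨ lem′ n ⟩
    suc (suc n) * 1                  ≡⟨ cong (suc (suc n) *_) (nC0≡1 (suc n)) ⟨
    suc (suc n) * (suc n choose 0)        ∎
    where
    open ≡-Reasoning
    lem : ∀ a → 1 * (a + 1) ≡ 1 * a + 1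
    lem = solve-∀
    lem′ : ∀ n → suc n * 1 + 1 ≡ suc (suc n) * 1
    lem′ = solve-∀
  absorption (suc n) (suc k) = begin
    suc (suc k) * (suc (suc n) choose suc (suc k))
      ≡⟨ cong (suc (suc k) *_) (pascal (suc n) (suc k)) ⟩
    suc (suc k) * (a + b)
      ≡⟨ lem (suc k) a b ⟩
    suc (suc k) * a + suc k * b + b
      ≡⟨ cong₂ (λ u v → u + v + b) (absorption n (suc k)) (absorption n k) ⟩
    suc n * (n choose suc k) + suc n * (n choose k) + b
      ≡⟨ cong (_+ b) (*-distribˡ-+ (suc n) (n choose suc k) (n choose k)) ⟨
    suc n * (n choose suc k + n choose k) + b
      ≡⟨ cong (λ z → suc n * z + b) (pascal n k) ⟨
    suc n * b + b
      ≡⟨ +-comm (suc n * b) b ⟩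
    suc (suc n) * b ∎
    where
    open ≡-Reasoning
    a = suc n choose suc (suc k)
    b = suc n choose suc k
    lem : ∀ k a b → suc k * (a + b) ≡ suc k * a + k * b + b
    lem = solve-∀

  nCk-suc : ∀ n k → suc k * (n choose suc k) ≡ (n ∸ k) * (n choose k)
  nCk-suc n k = begin
    suc k * (n choose suc k)                                          ≡⟨ m+n∸n≡m _ (suc k * (n choose k)) ⟨
    suc k * (n choose suc k) + suc k * (n choose k) ∸ suc k * (n choose k)      ≡⟨ cong (_∸ suc k * (n choose k)) (*-distribˡ-+ (suc k) (n choose suc k) (n choose k)) ⟨
    suc k * (n choose suc k + n choose k) ∸ suc k * (n choose k)                ≡⟨ cong (λ z → suc k * z ∸ suc k * (n choose k)) (pascal n k) ⟨
    suc k * (suc n choose suc k) ∸ suc k * (n choose k)                    ≡⟨ cong (_∸ suc k * (n choose k)) (absorption n k) ⟩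
    suc n * (n choose k) ∸ suc k * (n choose k)                            ≡⟨ *-distribʳ-∸ (n choose k) (suc n) (suc k) ⟨
    (n ∸ k) * (n choose k)                                            ∎
    where open ≡-Reasoning

  co-absorption : ∀ n k → (suc n ∸ k) * (suc n choose k) ≡ suc n * (n choose k)
  co-absorption n k = trans (sym (nCk-suc (suc n) k)) (absorption n k)

  -- Truncated subtraction makes this vanish for k > n, as the binomial coefficient does, so the
  -- factorwise comparisons `C-monoˡ` and `C-ratio` cover that range without a separate case.
  falling : ℕ → ℕ → ℕ
  falling n zero    = 1
  falling n (suc k) = falling n k * (n ∸ k)

  nCk*k!≡falling : ∀ n k → (n choose k) * k ! ≡ falling n k
  nCk*k!≡falling n zero    = cong (_* 1) (nC0≡1 n)
  nCk*k!≡falling n (suc k) = begin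
    (n choose suc k) * (suc k * k !)     ≡⟨ lem (n choose suc k) (suc k) (k !) ⟩
    suc k * (n choose suc k) * k !       ≡⟨ cong (_* k !) (nCk-suc n k) ⟩
    (n ∸ k) * (n choose k) * k !         ≡⟨ lem′ (n ∸ k) (n choose k) (k !) ⟩
    (n choose k) * k ! * (n ∸ k)         ≡⟨ cong (_* (n ∸ k)) (nCk*k!≡falling n k) ⟩
    falling n k * (n ∸ k)           ∎
    where
    open ≡-Reasoning
    lem : ∀ a b c → a * (b * c) ≡ b * a * c
    lem = solve-∀
    lem′ : ∀ a b c → a * b * c ≡ b * c * a
    lem′ = solve-∀

  1≤k! : ∀ k → 1 ≤ k !
  1≤k! zero    = ≤-refl
  1≤k! (suc k) = *-mono-≤ {1} {suc k} (s≤s z≤n) (1≤k! k)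

  *-cancelʳ-≤′ : ∀ {a b} c → 1 ≤ c → a * c ≤ b * c → a ≤ b
  *-cancelʳ-≤′ {a} {b} (suc c) _ = *-cancelʳ-≤ a b (suc c)

  C-monoˡ : ∀ {a b} k → a ≤ b → a choose k ≤ b choose k
  C-monoˡ {a} {b} k a≤b = *-cancelʳ-≤′ (k !) (1≤k! k)
    (subst₂ _≤_ (sym (nCk*k!≡falling a k)) (sym (nCk*k!≡falling b k)) (falling-mono k))
    where
    falling-mono : ∀ k → falling a k ≤ falling b k
    falling-mono zero    = ≤-refl
    falling-mono (suc k) = *-mono-≤ (falling-mono k) (∸-monoˡ-≤ k a≤b)

  falling≤^ : ∀ n k → falling n k ≤ n ^ k
  falling≤^ n zero    = ≤-refl
  falling≤^ n (suc k) = ≤-trans (*-mono-≤ (falling≤^ n k) (m∸n≤m n k)) (≤-reflexive (*-comm (n ^ k) n))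

  -- Factor by factor, (b - j)/(n - j) ≤ b/n when b ≤ n. Probabilistically: k draws without
  -- replacement all land among b of n items with probability at most (b/n)^k.
  C-ratio : ∀ {b n} k → b ≤ n → (b choose k) * n ^ k ≤ (n choose k) * b ^ k
  C-ratio {b} {n} k b≤n = *-cancelʳ-≤′ (k !) (1≤k! k) (begin
    (b choose k) * n ^ k * k !     ≡⟨ lem (b choose k) (n ^ k) (k !) ⟩
    (b choose k) * k ! * n ^ k     ≡⟨ cong (_* n ^ k) (nCk*k!≡falling b k) ⟩
    falling b k * n ^ k       ≤⟨ go k ⟩
    falling n k * b ^ k       ≡⟨ cong (_* b ^ k) (nCk*k!≡falling n k) ⟨
    (n choose k) * k ! * b ^ k     ≡⟨ lem (n choose k) (b ^ k) (k !) ⟨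
    (n choose k) * b ^ k * k !     ∎)
    where
    open ≤-Reasoning
    lem : ∀ a b c → a * b * c ≡ a * c * b
    lem = solve-∀
    lem₂ : ∀ a b c d → a * b * (c * d) ≡ (a * d) * (b * c)
    lem₂ = solve-∀
    lem₃ : ∀ a b c d → (a * d) * (b * c) ≡ a * b * (c * d)
    lem₃ = solve-∀
    factor : ∀ k → (b ∸ k) * n ≤ (n ∸ k) * b
    factor k = begin
      (b ∸ k) * n    ≡⟨ *-distribʳ-∸ n b k ⟩
      b * n ∸ k * n  ≤⟨ ∸-mono (≤-reflexive (*-comm b n)) (*-monoʳ-≤ k b≤n) ⟩
      n * b ∸ k * b  ≡⟨ *-distribʳ-∸ b n k ⟨
      (n ∸ k) * b    ∎
    go : ∀ k → falling b k * n ^ k ≤ falling n k * b ^ k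
    go zero    = ≤-refl
    go (suc k) = begin
      falling b k * (b ∸ k) * (n * n ^ k)      ≡⟨ lem₂ (falling b k) (b ∸ k) n (n ^ k) ⟩
      falling b k * n ^ k * ((b ∸ k) * n)      ≤⟨ *-mono-≤ (go k) (factor k) ⟩
      falling n k * b ^ k * ((n ∸ k) * b)      ≡⟨ lem₃ (falling n k) (n ∸ k) b (b ^ k) ⟩
      falling n k * (n ∸ k) * (b * b ^ k)      ∎

  -- After cancelling k!² the claim holds factor by factor, because (a - j)² - (c - j)(n - j) = (a²
  -- - cn) + j(c + n - 2a). It is meant for c, a, n of the form C(p,x), C(p+1,x), C(p+2,x), where
  -- the last two conditions are `C-logConcaveˡ` and `C-convex`.
  C-logConcave : ∀ {c a n} k → c ≤ a → a ≤ n → c * n ≤ a * a → a + a ≤ c + n →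
    (c choose k) * (n choose k) ≤ (a choose k) * (a choose k)
  C-logConcave {c} {a} {n} k c≤a a≤n cn≤aa 2a≤c+n = *-cancelʳ-≤′ (k ! * k !) (*-mono-≤ (1≤k! k) (1≤k! k)) (begin
    (c choose k) * (n choose k) * (k ! * k !)        ≡⟨ lem (c choose k) (n choose k) (k !) ⟩
    ((c choose k) * k !) * ((n choose k) * k !)      ≡⟨ cong₂ _*_ (nCk*k!≡falling c k) (nCk*k!≡falling n k) ⟩
    falling c k * falling n k              ≤⟨ go k ⟩
    falling a k * falling a k              ≡⟨ cong₂ _*_ (nCk*k!≡falling a k) (nCk*k!≡falling a k) ⟨
    ((a choose k) * k !) * ((a choose k) * k !)      ≡⟨ lem (a choose k) (a choose k) (k !) ⟨
    (a choose k) * (a choose k) * (k ! * k !)        ∎)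
    where
    open ≤-Reasoning
    lem : ∀ a b c → a * b * (c * c) ≡ (a * c) * (b * c)
    lem = solve-∀
    lem₂ : ∀ a b c d → a * b * (c * d) ≡ (a * c) * (b * d)
    lem₂ = solve-∀
    -- Subtraction-free form of that identity: c, a, n stand here for the numbers already lowered by
    -- j.
    shifted : ∀ c a n j → (c + j) * (n + j) ≤ (a + j) * (a + j) → (a + j) + (a + j) ≤ (c + j) + (n + j) → c * n ≤ a * a
    shifted c a n j h₁ h₂ = +-cancelʳ-≤ (j * (a + a)) (c * n) (a * a) (begin
      c * n + j * (a + a)    ≤⟨ +-monoʳ-≤ (c * n) (*-monoʳ-≤ j (+-cancelʳ-≤ (j + j) (a + a) (c + n)
                                  (subst₂ _≤_ (e₁ a j) (e₂ c n j) h₂))) ⟩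
      c * n + j * (c + n)    ≤⟨ +-cancelʳ-≤ (j * j) (c * n + j * (c + n)) (a * a + j * (a + a)) (subst₂ _≤_ (e₃ c n j) (e₄ a j) h₁) ⟩
      a * a + j * (a + a)    ∎)
      where
      e₁ : ∀ a j → (a + j) + (a + j) ≡ (a + a) + (j + j)
      e₁ = solve-∀
      e₂ : ∀ c n j → (c + j) + (n + j) ≡ (c + n) + (j + j)
      e₂ = solve-∀
      e₃ : ∀ c n j → (c + j) * (n + j) ≡ c * n + j * (c + n) + j * j
      e₃ = solve-∀
      e₄ : ∀ a j → (a + j) * (a + j) ≡ a * a + j * (a + a) + j * j
      e₄ = solve-∀
    factor : ∀ j → (c ∸ j) * (n ∸ j) ≤ (a ∸ j) * (a ∸ j)
    factor j with ≤-total c j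
    ... | inj₁ c≤j = subst (λ z → z * (n ∸ j) ≤ (a ∸ j) * (a ∸ j)) (sym (m≤n⇒m∸n≡0 c≤j)) z≤n
    ... | inj₂ j≤c = shifted (c ∸ j) (a ∸ j) (n ∸ j) j
      (subst₂ _≤_ (cong₂ _*_ (sym (m∸n+n≡m j≤c)) (sym (m∸n+n≡m j≤n))) (cong₂ _*_ (sym (m∸n+n≡m j≤a)) (sym (m∸n+n≡m j≤a))) cn≤aa)
      (subst₂ _≤_ (cong₂ _+_ (sym (m∸n+n≡m j≤a)) (sym (m∸n+n≡m j≤a))) (cong₂ _+_ (sym (m∸n+n≡m j≤c)) (sym (m∸n+n≡m j≤n))) 2a≤c+n)
      where
      j≤a = ≤-trans j≤c c≤a
      j≤n = ≤-trans j≤a a≤n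
    go : ∀ k → falling c k * falling n k ≤ falling a k * falling a k
    go zero    = ≤-refl
    go (suc k) = begin
      falling c k * (c ∸ k) * (falling n k * (n ∸ k))    ≡⟨ lem₂ (falling c k) (c ∸ k) (falling n k) (n ∸ k) ⟩
      falling c k * falling n k * ((c ∸ k) * (n ∸ k))    ≤⟨ *-mono-≤ (go k) (factor k) ⟩
      falling a k * falling a k * ((a ∸ k) * (a ∸ k))    ≡⟨ lem₂ (falling a k) (a ∸ k) (falling a k) (a ∸ k) ⟨
      falling a k * (a ∸ k) * (falling a k * (a ∸ k))    ∎

  -- By Pascal's rule the second difference in the upper argument is C(p+1,y) - C(p,y), which is
  -- nonnegative by monotonicity.
  C-convex : ∀ p y → (suc p choose suc y) + (suc p choose suc y) ≤ (p choose suc y) + (suc (suc p) choose suc y)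
  C-convex p y = begin
    a + a                                ≡⟨ cong (_+ a) (pascal p y) ⟩
    ((p choose suc y) + (p choose y)) + a          ≡⟨ +-assoc (p choose suc y) (p choose y) a ⟩
    (p choose suc y) + ((p choose y) + a)          ≤⟨ +-monoʳ-≤ (p choose suc y) (+-monoˡ-≤ a (C-monoˡ y (n≤1+n p))) ⟩
    (p choose suc y) + ((suc p choose y) + a)      ≡⟨ cong ((p choose suc y) +_) (trans (+-comm (suc p choose y) a) (sym (pascal (suc p) y))) ⟩
    (p choose suc y) + (suc (suc p) choose suc y)  ∎
    where
    open ≤-Reasoning
    a = suc p choose suc y

  -- Two uses of `co-absorption` express C(p,x) and C(p+2,x) through C(p+1,x); what remains is
  -- (p+1-x)(p+2) ≤ (p+1)(p+2-x). For x > p the left side of the claim vanishes.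
  C-logConcaveˡ : ∀ p x → (p choose x) * (suc (suc p) choose x) ≤ (suc p choose x) * (suc p choose x)
  C-logConcaveˡ p x with suc p ≤? x
  ... | yes p<x = subst (λ z → z * (suc (suc p) choose x) ≤ (suc p choose x) * (suc p choose x)) (sym (k>n⇒nCk≡0 p<x)) z≤n
  ... | no p≮x = *-cancelʳ-≤′ (suc p * (suc (suc p) ∸ x)) (*-mono-≤ {1} {suc p} (s≤s z≤n) (m<n⇒0<n∸m (m<n⇒m<1+n (≰⇒> p≮x)))) (begin
    c * n * (suc p * w)                        ≡⟨ lem c n (suc p) w ⟩
    (suc p * c) * (w * n)                      ≡⟨ cong₂ _*_ (sym (co-absorption p x)) (co-absorption (suc p) x) ⟩
    ((suc p ∸ x) * a) * (suc (suc p) * a)      ≡⟨ lem₂ (suc p ∸ x) a (suc (suc p)) ⟩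
    (suc p ∸ x) * suc (suc p) * (a * a)        ≤⟨ *-monoˡ-≤ (a * a) compared ⟩
    (suc p * w) * (a * a)                      ≡⟨ *-comm (suc p * w) (a * a) ⟩
    a * a * (suc p * w)                        ∎)
    where
    open ≤-Reasoning
    c = p choose x
    a = suc p choose x
    n = suc (suc p) choose x
    w = suc (suc p) ∸ x
    lem : ∀ c n s w → c * n * (s * w) ≡ (s * c) * (w * n)
    lem = solve-∀
    lem₂ : ∀ u a s → (u * a) * (s * a) ≡ u * s * (a * a)
    lem₂ = solve-∀
    compared : (suc p ∸ x) * suc (suc p) ≤ suc p * w
    compared = begin
      (suc p ∸ x) * suc (suc p)                  ≡⟨ *-distribʳ-∸ (suc (suc p)) (suc p) x ⟩
      suc p * suc (suc p) ∸ x * suc (suc p)      ≤⟨ ∸-monoʳ-≤ (suc p * suc (suc p)) (*-monoʳ-≤ x (n≤1+n (suc p))) ⟩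
      suc p * suc (suc p) ∸ x * suc p            ≡⟨ cong (suc p * suc (suc p) ∸_) (*-comm x (suc p)) ⟩
      suc p * suc (suc p) ∸ suc p * x            ≡⟨ *-distribˡ-∸ (suc p) (suc (suc p)) x ⟨
      suc p * w                                  ∎

  ^-distribʳ-* : ∀ k a b → (a * b) ^ k ≡ a ^ k * b ^ k
  ^-distribʳ-* zero    a b = refl
  ^-distribʳ-* (suc k) a b = trans (cong (a * b *_) (^-distribʳ-* k a b)) (lem a b (a ^ k) (b ^ k))
    where
    lem : ∀ a b c d → a * b * (c * d) ≡ a * c * (b * d)
    lem = solve-∀

  2ab≤a²+b² : ∀ a b → 2 * (a * b) ≤ a * a + b * b
  2ab≤a²+b² a b with ≤-total a b
  ... | inj₁ a≤b = subst (λ z → 2 * (a * z) ≤ a * a + z * z) (m+[n∸m]≡n a≤b) (core a (b ∸ a))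
    where
    lem : ∀ a d → a * a + (a + d) * (a + d) ≡ 2 * (a * (a + d)) + d * d
    lem = solve-∀
    core : ∀ a d → 2 * (a * (a + d)) ≤ a * a + (a + d) * (a + d)
    core a d = ≤-trans (m≤m+n _ (d * d)) (≤-reflexive (sym (lem a d)))
  ... | inj₂ b≤a = subst (λ z → 2 * (z * b) ≤ z * z + b * b) (m+[n∸m]≡n b≤a) (core b (a ∸ b))
    where
    lem : ∀ b d → (b + d) * (b + d) + b * b ≡ 2 * ((b + d) * b) + d * d
    lem = solve-∀
    core : ∀ b d → 2 * ((b + d) * b) ≤ (b + d) * (b + d) + b * b
    core b d = ≤-trans (m≤m+n _ (d * d)) (≤-reflexive (sym (lem b d)))

  -- Cauchy-Schwarz for (k,l) and (u,v).
  powerSum-step : ∀ k l u v → (k * u + l * v) * (k * u + l * v) ≤ (k * k + l * l) * (u * u + v * v)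
  powerSum-step k l u v = begin
    (k * u + l * v) * (k * u + l * v)                                      ≡⟨ e₁ k l u v ⟩
    (k * u) * (k * u) + 2 * ((k * v) * (l * u)) + (l * v) * (l * v)        ≤⟨ +-monoˡ-≤ _ (+-monoʳ-≤ ((k * u) * (k * u)) (2ab≤a²+b² (k * v) (l * u))) ⟩
    (k * u) * (k * u) + ((k * v) * (k * v) + (l * u) * (l * u)) + (l * v) * (l * v)  ≡⟨ e₂ k l u v ⟩
    (k * k + l * l) * (u * u + v * v) ∎
    where
    open ≤-Reasoning
    e₁ : ∀ k l u v → (k * u + l * v) * (k * u + l * v) ≡ (k * u) * (k * u) + 2 * ((k * v) * (l * u)) + (l * v) * (l * v)
    e₁ = solve-∀
    e₂ : ∀ k l u v → (k * u) * (k * u) + ((k * v) * (k * v) + (l * u) * (l * u)) + (l * v) * (l * v) ≡ (k * k + l * l) * (u * u + v * v)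
    e₂ = solve-∀

  -- The norm inequality ‖(k,l)‖_x ≤ ‖(k,l)‖_2 for x = y + 2, raised to the power 2x so that no root
  -- appears. Each step is Cauchy-Schwarz followed by u² + v² ≤ (u + v)².
  powerSum² : ∀ k l y → (k ^ suc (suc y) + l ^ suc (suc y)) * (k ^ suc (suc y) + l ^ suc (suc y)) ≤ (k * k + l * l) ^ suc (suc y)
  powerSum² k l zero    = ≤-reflexive (e k l)
    where
    e : ∀ k l → (k * (k * 1) + l * (l * 1)) * (k * (k * 1) + l * (l * 1)) ≡ (k * k + l * l) * ((k * k + l * l) * 1)
    e = solve-∀
  powerSum² k l (suc y) = begin
    (k * u + l * v) * (k * u + l * v)          ≤⟨ powerSum-step k l u v ⟩
    (k * k + l * l) * (u * u + v * v)          ≤⟨ *-monoʳ-≤ (k * k + l * l) (≤-trans (m≤m+n _ (2 * (u * v))) (≤-reflexive (e u v))) ⟩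
    (k * k + l * l) * ((u + v) * (u + v))      ≤⟨ *-monoʳ-≤ (k * k + l * l) (powerSum² k l y) ⟩
    (k * k + l * l) ^ suc (suc (suc y))        ∎
    where
    open ≤-Reasoning
    u = k ^ suc (suc y)
    v = l ^ suc (suc y)
    e : ∀ u v → u * u + v * v + 2 * (u * v) ≡ (u + v) * (u + v)
    e = solve-∀

  powerSum²′ : ∀ k l {x} → 2 ≤ x → (k ^ x + l ^ x) * (k ^ x + l ^ x) ≤ (k * k + l * l) ^ x
  powerSum²′ k l {suc (suc y)} _ = powerSum² k l y
  powerSum²′ k l {suc zero} (s≤s ())

  -- Here b is the number of edges of size x inside one of two sides with k and l nodes, and N =
  -- C(n,x). The chain is C(b,μ)/C(N,μ) ≤ (b/N)^μ, then b/N ≤ (k/n)^x + (l/n)^x, then `powerSum²`;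
  -- squaring avoids the exponent xμ/2. The case μ = 0 is separate because N > 0 is derived from 1 ≤
  -- μ ≤ N.
  noncrossing-choices : ∀ {b k l n x} μ → 2 ≤ x → b ≤ n choose x → b ≤ k choose x + l choose x → k ≤ n → l ≤ n →
    μ ≤ n choose x →
    ((b choose μ) * (b choose μ)) * (n * n) ^ (x * μ) ≤
    (((n choose x) choose μ) * ((n choose x) choose μ)) * (k * k + l * l) ^ (x * μ)
  noncrossing-choices {b} {k} {l} {n} {x} zero 2≤x b≤N b≤ k≤n l≤n μ≤N =
    ≤-reflexive (cong₂ _*_ (cong₂ _*_ (trans (nC0≡1 b) (sym (nC0≡1 (n choose x)))) (trans (nC0≡1 b) (sym (nC0≡1 (n choose x)))))
      (trans (cong ((n * n) ^_) (*-zeroʳ x)) (sym (cong ((k * k + l * l) ^_) (*-zeroʳ x)))))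
  noncrossing-choices {b} {k} {l} {n} {x} μ@(suc _) 2≤x b≤N b≤ k≤n l≤n μ≤N = begin
    (B * B) * (n * n) ^ (x * μ)        ≡⟨ cong ((B * B) *_) (trans (^-distribʳ-* (x * μ) n n)
                                             (cong₂ _*_ (sym (^-*-assoc n x μ)) (sym (^-*-assoc n x μ)))) ⟩
    (B * B) * ((n ^ x) ^ μ * (n ^ x) ^ μ)      ≡⟨ lem B ((n ^ x) ^ μ) ⟩
    (B * (n ^ x) ^ μ) * (B * (n ^ x) ^ μ)      ≤⟨ *-mono-≤ half half ⟩
    (NC * s ^ μ) * (NC * s ^ μ)                ≡⟨ lem NC (s ^ μ) ⟨
    (NC * NC) * (s ^ μ * s ^ μ)                ≡⟨ cong ((NC * NC) *_) (^-distribʳ-* μ s s) ⟨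
    (NC * NC) * (s * s) ^ μ                    ≤⟨ *-monoʳ-≤ (NC * NC) (^-monoˡ-≤ μ (powerSum²′ k l 2≤x)) ⟩
    (NC * NC) * ((k * k + l * l) ^ x) ^ μ      ≡⟨ cong ((NC * NC) *_) (^-*-assoc (k * k + l * l) x μ) ⟩
    (NC * NC) * (k * k + l * l) ^ (x * μ)      ∎
    where
    open ≤-Reasoning
    N = n choose x
    B = b choose μ
    NC = N choose μ
    s = k ^ x + l ^ x
    lem : ∀ a b → a * a * (b * b) ≡ (a * b) * (a * b)
    lem = solve-∀
    lem₂ : ∀ a b c → a * b * c ≡ (a * c) * b
    lem₂ = solve-∀
    one : b * n ^ x ≤ N * s
    one = begin
      b * n ^ x                              ≤⟨ *-monoˡ-≤ (n ^ x) b≤ ⟩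
      (k choose x + l choose x) * n ^ x                ≡⟨ *-distribʳ-+ (n ^ x) (k choose x) (l choose x) ⟩
      (k choose x) * n ^ x + (l choose x) * n ^ x      ≤⟨ +-mono-≤ (C-ratio x k≤n) (C-ratio x l≤n) ⟩
      N * k ^ x + N * l ^ x                  ≡⟨ *-distribˡ-+ N (k ^ x) (l ^ x) ⟨
      N * s                                  ∎
    1≤N^μ : 1 ≤ N ^ μ
    1≤N^μ = m^n>0 N {{>-nonZero (≤-trans (s≤s z≤n) μ≤N)}} μ
    half : B * (n ^ x) ^ μ ≤ NC * s ^ μ
    half = *-cancelʳ-≤′ (N ^ μ) 1≤N^μ (begin
      B * (n ^ x) ^ μ * N ^ μ          ≡⟨ lem₂ B ((n ^ x) ^ μ) (N ^ μ) ⟩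
      B * N ^ μ * (n ^ x) ^ μ          ≤⟨ *-monoˡ-≤ ((n ^ x) ^ μ) (C-ratio μ b≤N) ⟩
      NC * b ^ μ * (n ^ x) ^ μ         ≡⟨ trans (*-assoc NC (b ^ μ) _) (cong (NC *_) (sym (^-distribʳ-* μ b (n ^ x)))) ⟩
      NC * (b * n ^ x) ^ μ             ≤⟨ *-monoʳ-≤ NC (^-monoˡ-≤ μ one) ⟩
      NC * (N * s) ^ μ                 ≡⟨ cong (NC *_) (trans (^-distribʳ-* μ N s) (*-comm (N ^ μ) (s ^ μ))) ⟩
      NC * (s ^ μ * N ^ μ)             ≡⟨ *-assoc NC (s ^ μ) (N ^ μ) ⟨
      NC * s ^ μ * N ^ μ               ∎)


open Binomials

open import Data.Rational
  using (ℚ; 0ℚ; 1ℚ; _*_; _/_; _+_; _-_; -_; _≤_; _<_; mkℚ; toℚᵘ; nonNegative; positive)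
  renaming (∣_∣ to abs)
import Data.Rational.Properties as ℚₚ
open import Data.Rational.Solver using (module +-*-Solver)
open import Data.Rational.Unnormalised using (mkℚᵘ; *≡*; *≤*)
import Data.Rational.Unnormalised as ℚᵘ
import Data.Rational.Unnormalised.Properties as ℚᵘₚ

open +-*-Solver using (solve; con; _:=_; _:+_; _:*_; _:-_; :-_)

-- Rational arithmetic

fromℕ-toℚᵘ : ∀ a → toℚᵘ (fromℕ a) ℚᵘ.≃ mkℚᵘ (ℤ.+ a) 0
fromℕ-toℚᵘ a = ℚₚ.toℚᵘ-fromℚᵘ (mkℚᵘ (ℤ.+ a) 0)

fromℕ-+ : ∀ a b → fromℕ (a ℕ.+ b) ≡ fromℕ a + fromℕ b
fromℕ-+ a b = ℚₚ.toℚᵘ-injective (begin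
  toℚᵘ (fromℕ (a ℕ.+ b))               ≈⟨ fromℕ-toℚᵘ (a ℕ.+ b) ⟩
  mkℚᵘ (ℤ.+ (a ℕ.+ b)) 0                 ≈⟨ *≡* (cong (ℤ._* ℤ.+ 1) (cong₂ ℤ._+_ (sym (ℤₚ.*-identityʳ (ℤ.+ a))) (sym (ℤₚ.*-identityʳ (ℤ.+ b))))) ⟩
  mkℚᵘ (ℤ.+ a) 0 ℚᵘ.+ mkℚᵘ (ℤ.+ b) 0       ≈⟨ ℚᵘₚ.+-cong (fromℕ-toℚᵘ a) (fromℕ-toℚᵘ b) ⟨
  toℚᵘ (fromℕ a) ℚᵘ.+ toℚᵘ (fromℕ b)   ≈⟨ ℚₚ.toℚᵘ-homo-+ (fromℕ a) (fromℕ b) ⟨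
  toℚᵘ (fromℕ a + fromℕ b)             ∎)
  where open import Relation.Binary.Reasoning.Setoid ℚᵘₚ.≃-setoid

fromℕ-* : ∀ a b → fromℕ (a ℕ.* b) ≡ fromℕ a * fromℕ b
fromℕ-* a b = ℚₚ.toℚᵘ-injective (begin
  toℚᵘ (fromℕ (a ℕ.* b))               ≈⟨ fromℕ-toℚᵘ (a ℕ.* b) ⟩
  mkℚᵘ (ℤ.+ (a ℕ.* b)) 0                 ≈⟨ *≡* (cong (ℤ._* ℤ.+ 1) (ℤₚ.pos-* a b)) ⟩
  mkℚᵘ (ℤ.+ a) 0 ℚᵘ.* mkℚᵘ (ℤ.+ b) 0       ≈⟨ ℚᵘₚ.*-cong (fromℕ-toℚᵘ a) (fromℕ-toℚᵘ b) ⟨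
  toℚᵘ (fromℕ a) ℚᵘ.* toℚᵘ (fromℕ b)   ≈⟨ ℚₚ.toℚᵘ-homo-* (fromℕ a) (fromℕ b) ⟨
  toℚᵘ (fromℕ a * fromℕ b)             ∎)
  where open import Relation.Binary.Reasoning.Setoid ℚᵘₚ.≃-setoid

fromℕ-mono-≤ : ∀ {a b} → a ≤ℕ b → fromℕ a ≤ fromℕ b
fromℕ-mono-≤ {a} {b} a≤b = ℚₚ.toℚᵘ-cancel-≤
  (ℚᵘₚ.≤-respˡ-≃ (ℚᵘₚ.≃-sym (fromℕ-toℚᵘ a)) (ℚᵘₚ.≤-respʳ-≃ (ℚᵘₚ.≃-sym (fromℕ-toℚᵘ b))
    (*≤* (ℤₚ.*-monoʳ-≤-nonNeg (ℤ.+ 1) (ℤ.+≤+ a≤b)))))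

fromℕ-cancel-≤ : ∀ {a b} → fromℕ a ≤ fromℕ b → a ≤ℕ b
fromℕ-cancel-≤ {a} {b} a≤b
  with ℚᵘₚ.≤-respˡ-≃ (fromℕ-toℚᵘ a) (ℚᵘₚ.≤-respʳ-≃ (fromℕ-toℚᵘ b) (ℚₚ.toℚᵘ-mono-≤ a≤b))
... | *≤* le = ℤₚ.drop‿+≤+ (subst₂ ℤ._≤_ (ℤₚ.*-identityʳ (ℤ.+ a)) (ℤₚ.*-identityʳ (ℤ.+ b)) le)

0≤fromℕ : ∀ a → 0ℚ ≤ fromℕ a
0≤fromℕ a = fromℕ-mono-≤ {0} {a} ℕ.z≤n

*-monoʳ : ∀ {p q} r → 0ℚ ≤ r → p ≤ q → p * r ≤ q * r
*-monoʳ r 0≤r = ℚₚ.*-monoʳ-≤-nonNeg r {{nonNegative 0≤r}}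

*-monoˡ : ∀ {p q} r → 0ℚ ≤ r → p ≤ q → r * p ≤ r * q
*-monoˡ r 0≤r = ℚₚ.*-monoˡ-≤-nonNeg r {{nonNegative 0≤r}}

0≤* : ∀ {p q} → 0ℚ ≤ p → 0ℚ ≤ q → 0ℚ ≤ p * q
0≤* {p} {q} 0≤p 0≤q = subst (_≤ p * q) (ℚₚ.*-zeroʳ p) (*-monoˡ p 0≤p 0≤q)

0≤+ : ∀ {p q} → 0ℚ ≤ p → 0ℚ ≤ q → 0ℚ ≤ p + q
0≤+ {p} {q} 0≤p 0≤q = ℚₚ.+-mono-≤ {0ℚ} {p} {0ℚ} {q} 0≤p 0≤q

*-mono : ∀ {p q r s} → 0ℚ ≤ q → 0ℚ ≤ r → p ≤ q → r ≤ s → p * r ≤ q * s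
*-mono {p} {q} {r} {s} 0≤q 0≤r p≤q r≤s = ℚₚ.≤-trans (*-monoʳ r 0≤r p≤q) (*-monoˡ q 0≤q r≤s)

≤⇒0≤- : ∀ {p q} → p ≤ q → 0ℚ ≤ q - p
≤⇒0≤- {p} {q} p≤q = subst (_≤ q - p) (ℚₚ.+-inverseʳ p) (ℚₚ.+-monoˡ-≤ (- p) p≤q)

-- Reduces an inequality to a ring identity exhibiting q - p as something nonnegative.
≤-by : ∀ {p q d} → q ≡ p + d → 0ℚ ≤ d → p ≤ q
≤-by {p} {q} {d} eq 0≤d = subst₂ _≤_ (ℚₚ.+-identityʳ p) (sym eq) (ℚₚ.+-monoʳ-≤ p 0≤d)

-- Exponential bounds

∏1+ : List ℚ → ℚ
∏1+ []       = 1ℚ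
∏1+ (u ∷ us) = (1ℚ + u) * ∏1+ us

total : List ℚ → ℚ
total []       = 0ℚ
total (u ∷ us) = u + total us

≥-1 : ℚ → Set
≥-1 u = 0ℚ ≤ 1ℚ + u

∏1+-++ : ∀ us vs → ∏1+ (us ++ vs) ≡ ∏1+ us * ∏1+ vs
∏1+-++ []       vs = sym (ℚₚ.*-identityˡ _)
∏1+-++ (u ∷ us) vs = trans (cong ((1ℚ + u) *_) (∏1+-++ us vs)) (sym (ℚₚ.*-assoc (1ℚ + u) (∏1+ us) (∏1+ vs)))

total-++ : ∀ us vs → total (us ++ vs) ≡ total us + total vs
total-++ []       vs = sym (ℚₚ.+-identityˡ _)
total-++ (u ∷ us) vs = trans (cong (u +_) (total-++ us vs)) (sym (ℚₚ.+-assoc u (total us) (total vs)))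

0≤∏1+ : ∀ {us} → All ≥-1 us → 0ℚ ≤ ∏1+ us
0≤∏1+ []       = 0≤fromℕ 1
0≤∏1+ (h ∷ hs) = 0≤* h (0≤∏1+ hs)

0≤1ℚ : 0ℚ ≤ 1ℚ
0≤1ℚ = 0≤fromℕ 1

0≤⇒≥-1 : ∀ {u} → 0ℚ ≤ u → ≥-1 u
0≤⇒≥-1 = 0≤+ 0≤1ℚ

-- `balance` must be able to pick a factor of a prescribed sign. Since only the sum and the product
-- of the increments matter, they are sorted by sign beforehand.
record SignSplit (us : List ℚ) : Set where
  field
    pos neg   : List ℚ
    pos-sign  : All (0ℚ ≤_) pos
    neg-sign  : All (_≤ 0ℚ) neg
    neg-≥-1   : All ≥-1 neg
    total-eq  : total us ≡ total pos + total neg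
    prod-eq   : ∏1+ us ≡ ∏1+ pos * ∏1+ neg

signSplit : ∀ {us} → All ≥-1 us → SignSplit us
signSplit [] = record
  { pos = [] ; neg = [] ; pos-sign = [] ; neg-sign = [] ; neg-≥-1 = []
  ; total-eq = refl ; prod-eq = refl }
signSplit {u ∷ us} (h ∷ hs) with ℚₚ.≤-total 0ℚ u | signSplit hs
... | inj₁ 0≤u | s = record
  { pos = u ∷ pos ; neg = neg ; pos-sign = 0≤u ∷ pos-sign ; neg-sign = neg-sign ; neg-≥-1 = neg-≥-1
  ; total-eq = trans (cong (u +_) total-eq) (sym (ℚₚ.+-assoc u (total pos) (total neg)))
  ; prod-eq = trans (cong ((1ℚ + u) *_) prod-eq) (sym (ℚₚ.*-assoc (1ℚ + u) (∏1+ pos) (∏1+ neg))) }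
  where open SignSplit s
... | inj₂ u≤0 | s = record
  { pos = pos ; neg = u ∷ neg ; pos-sign = pos-sign ; neg-sign = u≤0 ∷ neg-sign ; neg-≥-1 = h ∷ neg-≥-1
  ; total-eq = trans (cong (u +_) total-eq)
      (solve 3 (λ a b c → a :+ (b :+ c) := b :+ (a :+ c)) refl u (total pos) (total neg))
  ; prod-eq = trans (cong ((1ℚ + u) *_) prod-eq)
      (solve 3 (λ a b c → a :* (b :* c) := b :* (a :* c)) refl (1ℚ + u) (∏1+ pos) (∏1+ neg)) }
  where
  open SignSplit s

0≤total : ∀ {us} → All (0ℚ ≤_) us → 0ℚ ≤ total us
0≤total []       = ℚₚ.≤-refl
0≤total (h ∷ hs) = 0≤+ h (0≤total hs)

∏1+-nonPos : ∀ {us} → All ≥-1 us → All (_≤ 0ℚ) us → ∏1+ us ≤ 1ℚ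
∏1+-nonPos []       []                   = ℚₚ.≤-refl
∏1+-nonPos {u ∷ us} (h ∷ hs) (u≤0 ∷ us≤0) =
  *-mono 0≤1ℚ (0≤∏1+ hs) (subst (1ℚ + u ≤_) (ℚₚ.+-identityʳ 1ℚ) (ℚₚ.+-monoʳ-≤ 1ℚ u≤0)) (∏1+-nonPos hs us≤0)

total≤0⇒nonPos : ∀ {us} → All (0ℚ ≤_) us → total us ≤ 0ℚ → All (_≤ 0ℚ) us
total≤0⇒nonPos []       _ = []
total≤0⇒nonPos {u ∷ us} (h ∷ hs) t≤0 =
  ℚₚ.≤-trans (subst (_≤ u + total us) (ℚₚ.+-identityʳ u) (ℚₚ.+-monoʳ-≤ u (0≤total hs))) t≤0 ∷
  total≤0⇒nonPos hs
    (ℚₚ.≤-trans (subst (_≤ u + total us) (ℚₚ.+-identityˡ (total us)) (ℚₚ.+-monoˡ-≤ (total us) h)) t≤0)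

merge : ∀ {r s} → 0ℚ ≤ r → s ≤ 0ℚ → (1ℚ + r) * (1ℚ + s) ≤ 1ℚ + (r + s)
merge {r} {s} 0≤r s≤0 = ≤-by
  (solve 2 (λ r s → con 1ℚ :+ (r :+ s) := (con 1ℚ :+ r) :* (con 1ℚ :+ s) :+ r :* (con 0ℚ :- s)) refl r s)
  (0≤* 0≤r (≤⇒0≤- s≤0))

-- Replacing two factors 1 + r and 1 + u of opposite signs by 1 + (r + u) does not decrease the
-- product, so r can absorb all the factors, at each step one of the sign opposite to its own.
balance : ∀ r ps ns → ≥-1 r → All (0ℚ ≤_) ps → All ≥-1 ns → All (_≤ 0ℚ) ns →
  r + (total ps + total ns) ≤ 0ℚ → (1ℚ + r) * (∏1+ ps * ∏1+ ns) ≤ 1ℚ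
balance r ps ns hr hp hn hn′ t with ℚₚ.≤-total 0ℚ r
balance r ps [] hr hp hn hn′ t | inj₁ 0≤r =
  subst (λ z → (1ℚ + r) * z ≤ 1ℚ) (sym (ℚₚ.*-identityʳ (∏1+ ps)))
    (∏1+-nonPos {r ∷ ps} (hr ∷ All.map 0≤⇒≥-1 hp)
      (total≤0⇒nonPos (0≤r ∷ hp) (subst (λ z → r + z ≤ 0ℚ) (ℚₚ.+-identityʳ (total ps)) t)))
balance r ps (s ∷ ns) hr hp (hs ∷ hn) (s≤0 ∷ hn′) t | inj₁ 0≤r = ℚₚ.≤-trans
  (ℚₚ.≤-trans
    (ℚₚ.≤-reflexive (solve 4 (λ a b c d → a :* (b :* (c :* d)) := (a :* c) :* (b :* d)) refl
      (1ℚ + r) (∏1+ ps) (1ℚ + s) (∏1+ ns)))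
    (*-monoʳ (∏1+ ps * ∏1+ ns) (0≤* (0≤∏1+ (All.map 0≤⇒≥-1 hp)) (0≤∏1+ hn)) (merge 0≤r s≤0)))
  (balance (r + s) ps ns
    (≤-trans′ hs (solve 2 (λ r s → con 1ℚ :+ (r :+ s) := (con 1ℚ :+ s) :+ r) refl r s) 0≤r)
    hp hn hn′
    (subst (_≤ 0ℚ) (solve 4 (λ r s p n → r :+ (p :+ (s :+ n)) := (r :+ s) :+ (p :+ n)) refl r s (total ps) (total ns)) t))
  where
  ≤-trans′ : ∀ {a b c} → 0ℚ ≤ a → b ≡ a + c → 0ℚ ≤ c → 0ℚ ≤ b
  ≤-trans′ 0≤a eq 0≤c = ℚₚ.≤-trans 0≤a (≤-by eq 0≤c)
balance r [] ns hr hp hn hn′ t | inj₂ r≤0 =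
  subst (λ z → (1ℚ + r) * z ≤ 1ℚ) (sym (ℚₚ.*-identityˡ (∏1+ ns)))
    (∏1+-nonPos {r ∷ ns} (hr ∷ hn) (r≤0 ∷ hn′))
balance r (p ∷ ps) ns hr (0≤p ∷ hp) hn hn′ t | inj₂ r≤0 = ℚₚ.≤-trans
  (ℚₚ.≤-trans
    (ℚₚ.≤-reflexive (solve 4 (λ a b c d → a :* ((b :* c) :* d) := (b :* a) :* (c :* d)) refl
      (1ℚ + r) (1ℚ + p) (∏1+ ps) (∏1+ ns)))
    (*-monoʳ (∏1+ ps * ∏1+ ns) (0≤* (0≤∏1+ (All.map 0≤⇒≥-1 hp)) (0≤∏1+ hn)) (merge 0≤p r≤0)))
  (balance (p + r) ps ns
    (ℚₚ.≤-trans hr (≤-by (solve 2 (λ r p → con 1ℚ :+ (p :+ r) := (con 1ℚ :+ r) :+ p) refl r p) 0≤p))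
    hp hn hn′
    (subst (_≤ 0ℚ) (solve 4 (λ r s p n → r :+ ((s :+ p) :+ n) := (s :+ r) :+ (p :+ n)) refl r p (total ps) (total ns)) t))

-- AM-GM for the nonnegative factors 1 + u, whose mean is at most 1. `balance` starts from the
-- neutral increment 0.
∏1+≤1 : ∀ {us} → All ≥-1 us → total us ≤ 0ℚ → ∏1+ us ≤ 1ℚ
∏1+≤1 {us} h t = subst (_≤ 1ℚ)
  (trans (trans (cong (_* (∏1+ pos * ∏1+ neg)) (ℚₚ.+-identityʳ 1ℚ)) (ℚₚ.*-identityˡ _)) (sym prod-eq))
  (balance 0ℚ pos neg (0≤⇒≥-1 ℚₚ.≤-refl) pos-sign neg-≥-1 neg-sign
    (subst (_≤ 0ℚ) (trans total-eq (sym (ℚₚ.+-identityˡ (total pos + total neg)))) t))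
  where open SignSplit (signSplit h)

-- a ≼ b exp q stands for a ≤ b e^q.

infix 4 _≼_exp_

record _≼_exp_ (a b : ℕ) (q : ℚ) : Set where
  constructor expBound
  field
    increments : List ℚ
    ≥-1s       : All ≥-1 increments
    total≤     : total increments ≤ q
    estimate   : fromℕ a ≤ fromℕ b * ∏1+ increments

≼-lin : ∀ {a b u} → ≥-1 u → fromℕ a ≤ fromℕ b * (1ℚ + u) → a ≼ b exp u
≼-lin {a} {b} {u} h le = expBound (u ∷ []) (h ∷ []) (ℚₚ.≤-reflexive (ℚₚ.+-identityʳ u))
  (subst (λ z → fromℕ a ≤ fromℕ b * z) (sym (ℚₚ.*-identityʳ (1ℚ + u))) le)

≤⇒≼ : ∀ {a b} → a ≤ℕ b → a ≼ b exp 0ℚ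
≤⇒≼ {a} {b} a≤b = expBound [] [] ℚₚ.≤-refl
  (subst (fromℕ a ≤_) (sym (ℚₚ.*-identityʳ (fromℕ b))) (fromℕ-mono-≤ a≤b))

-- The way back to ℕ: gains and losses are collected in one exponent, and once that is `≤ 0` the
-- product of the factors is at most 1.
≼⇒≤ : ∀ {a b q} → q ≤ 0ℚ → a ≼ b exp q → a ≤ℕ b
≼⇒≤ {a} {b} q≤0 (expBound us h t e) = fromℕ-cancel-≤
  (ℚₚ.≤-trans e (subst (fromℕ b * ∏1+ us ≤_) (ℚₚ.*-identityʳ (fromℕ b))
    (*-monoˡ (fromℕ b) (0≤fromℕ b) (∏1+≤1 h (ℚₚ.≤-trans t q≤0)))))

≼-weaken : ∀ {a b q r} → q ≤ r → a ≼ b exp q → a ≼ b exp r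
≼-weaken q≤r (expBound us h t e) = expBound us h (ℚₚ.≤-trans t q≤r) e

≼-* : ∀ {a b c d q r} → a ≼ b exp q → c ≼ d exp r → a ℕ.* c ≼ b ℕ.* d exp (q + r)
≼-* {a} {b} {c} {d} {q} {r} (expBound us hu tu eu) (expBound vs hv tv ev) =
  expBound (us ++ vs) (Allₚ.++⁺ hu hv)
    (subst (_≤ q + r) (sym (total-++ us vs)) (ℚₚ.+-mono-≤ {total us} {q} {total vs} {r} tu tv))
    (subst₂ _≤_ (sym (fromℕ-* a c))
      (trans (solve 4 (λ b u d v → (b :* u) :* (d :* v) := (b :* d) :* (u :* v)) refl (fromℕ b) (∏1+ us) (fromℕ d) (∏1+ vs))
        (cong₂ _*_ (sym (fromℕ-* b d)) (sym (∏1+-++ us vs))))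
      (*-mono (0≤* (0≤fromℕ b) (0≤∏1+ hu)) (0≤fromℕ c) eu ev))

≼-trans : ∀ {a b c q r} → a ≼ b exp q → b ≼ c exp r → a ≼ c exp (q + r)
≼-trans {a} {b} {c} {q} {r} (expBound us hu tu eu) (expBound vs hv tv ev) =
  expBound (us ++ vs) (Allₚ.++⁺ hu hv)
    (subst (_≤ q + r) (sym (total-++ us vs)) (ℚₚ.+-mono-≤ {total us} {q} {total vs} {r} tu tv))
    (ℚₚ.≤-trans eu (subst (fromℕ b * ∏1+ us ≤_)
      (trans (solve 3 (λ c u v → (c :* v) :* u := c :* (u :* v)) refl (fromℕ c) (∏1+ us) (∏1+ vs))
        (cong (fromℕ c *_) (sym (∏1+-++ us vs))))
      (*-monoʳ (∏1+ us) (0≤∏1+ hu) ev)))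

≼-≤ˡ : ∀ {a b c q} → a ≤ℕ b → b ≼ c exp q → a ≼ c exp q
≼-≤ˡ a≤b (expBound us h t e) = expBound us h t (ℚₚ.≤-trans (fromℕ-mono-≤ a≤b) e)

≼-≤ʳ : ∀ {a b c q} → a ≼ b exp q → b ≤ℕ c → a ≼ c exp q
≼-≤ʳ (expBound us h t e) b≤c = expBound us h t
  (ℚₚ.≤-trans e (*-monoʳ (∏1+ us) (0≤∏1+ h) (fromℕ-mono-≤ b≤c)))

≼-^ : ∀ {a b q} k → a ≼ b exp q → a ^ k ≼ b ^ k exp (fromℕ k * q)
≼-^ {a} {b} {q} zero    h = ≼-weaken (ℚₚ.≤-reflexive (sym (ℚₚ.*-zeroˡ q))) (≤⇒≼ ℕₚ.≤-refl)
≼-^ {a} {b} {q} (suc k) h = ≼-weaken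
  (ℚₚ.≤-reflexive (sym (trans (cong (_* q) (fromℕ-+ 1 k))
    (trans (ℚₚ.*-distribʳ-+ q 1ℚ (fromℕ k)) (cong (_+ fromℕ k * q) (ℚₚ.*-identityˡ q))))))
  (≼-* h (≼-^ k h))

module ∏ = CommutativeMonoidSum ℕₚ.*-1-commutativeMonoid
∏ : ∀ {n} → (Fin n → ℕ) → ℕ
∏ = ∏.sum

≼-∏ : ∀ {n} (a b : Fin n → ℕ) (q : Fin n → ℚ) → (∀ x → a x ≼ b x exp q x) → ∏ a ≼ ∏ b exp sum q
≼-∏ {zero}  a b q h = ≤⇒≼ ℕₚ.≤-refl
≼-∏ {suc n} a b q h = ≼-* (h zero) (≼-∏ (λ x → a (suc x)) (λ x → b (suc x)) (λ x → q (suc x)) (λ x → h (suc x)))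

module ∑ = SemiringSum ℕₚ.+-*-semiring
∑ : ∀ {n} → (Fin n → ℕ) → ℕ
∑ = ∑.sum

-- Counting

𝟙 : {P : Set} → Dec P → ℕ
𝟙 d = if does d then 1 else 0

𝟙-true : {P : Set} (d : Dec P) → P → 𝟙 d ≡ 1
𝟙-true d p rewrite dec-true d p = refl

𝟙-false : {P : Set} (d : Dec P) → ¬ P → 𝟙 d ≡ 0
𝟙-false d ¬p rewrite dec-false d ¬p = refl

𝟙-mono : {P Q : Set} (d : Dec P) (d′ : Dec Q) → (P → Q) → 𝟙 d ≤ℕ 𝟙 d′
𝟙-mono (no _)  d′ f = z≤n
𝟙-mono (yes p) d′ f = ℕₚ.≤-reflexive (sym (𝟙-true d′ (f p)))

𝟙-cong : {P Q : Set} (d : Dec P) (d′ : Dec Q) → (P → Q) → (Q → P) → 𝟙 d ≡ 𝟙 d′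
𝟙-cong d d′ f g = ℕₚ.≤-antisym (𝟙-mono d d′ f) (𝟙-mono d′ d g)

𝟙-× : {P Q : Set} (d : Dec P) (d′ : Dec Q) → 𝟙 (d ×-dec d′) ≡ 𝟙 d ℕ.* 𝟙 d′
𝟙-× d d′ with does d | does d′
... | true  | true  = refl
... | true  | false = refl
... | false | _     = refl

sumBy : {A : Set} → (A → ℕ) → List A → ℕ
sumBy w []       = 0
sumBy w (x ∷ xs) = w x ℕ.+ sumBy w xs

length≡sumBy : {A : Set} (xs : List A) → length xs ≡ sumBy (λ _ → 1) xs
length≡sumBy []       = refl
length≡sumBy (x ∷ xs) = cong suc (length≡sumBy xs)

length-filter : {A : Set} {R : A → Set} (R? : Decidable R) (xs : List A) →
                length (filter R? xs) ≡ sumBy (𝟙 ∘ R?) xs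
length-filter R? []       = refl
length-filter R? (x ∷ xs) with does (R? x)
... | true  = cong suc (length-filter R? xs)
... | false = length-filter R? xs

sumBy-filter : {A : Set} {R : A → Set} (R? : Decidable R) (w : A → ℕ) (xs : List A) →
               sumBy w (filter R? xs) ≡ sumBy (λ x → 𝟙 (R? x) ℕ.* w x) xs
sumBy-filter R? w []       = refl
sumBy-filter R? w (x ∷ xs) with does (R? x)
... | true  = cong₂ ℕ._+_ (sym (ℕₚ.+-identityʳ (w x))) (sumBy-filter R? w xs)
... | false = sumBy-filter R? w xs

sumBy-++ : {A : Set} (w : A → ℕ) (xs ys : List A) → sumBy w (xs ++ ys) ≡ sumBy w xs ℕ.+ sumBy w ys
sumBy-++ w []       ys = refl
sumBy-++ w (x ∷ xs) ys = trans (cong (w x ℕ.+_) (sumBy-++ w xs ys)) (sym (ℕₚ.+-assoc (w x) _ _))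

sumBy-map : {A B : Set} (w : B → ℕ) (f : A → B) (xs : List A) → sumBy w (map f xs) ≡ sumBy (w ∘ f) xs
sumBy-map w f []       = refl
sumBy-map w f (x ∷ xs) = cong (w (f x) ℕ.+_) (sumBy-map w f xs)

sumBy-cong : {A : Set} {v w : A → ℕ} → (∀ x → v x ≡ w x) → (xs : List A) → sumBy v xs ≡ sumBy w xs
sumBy-cong eq []       = refl
sumBy-cong eq (x ∷ xs) = cong₂ ℕ._+_ (eq x) (sumBy-cong eq xs)

sumBy-congᴬ : {A : Set} {v w : A → ℕ} {xs : List A} → All (λ x → v x ≡ w x) xs → sumBy v xs ≡ sumBy w xs
sumBy-congᴬ []        = refl
sumBy-congᴬ (eq ∷ eqs) = cong₂ ℕ._+_ eq (sumBy-congᴬ eqs)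

sumBy-mono : {A : Set} {v w : A → ℕ} → (∀ x → v x ≤ℕ w x) → (xs : List A) → sumBy v xs ≤ℕ sumBy w xs
sumBy-mono le []       = z≤n
sumBy-mono le (x ∷ xs) = ℕₚ.+-mono-≤ (le x) (sumBy-mono le xs)

sumBy-0 : {A : Set} (xs : List A) → sumBy (λ _ → 0) xs ≡ 0
sumBy-0 []       = refl
sumBy-0 (x ∷ xs) = sumBy-0 xs

sumBy-+ : {A : Set} (v w : A → ℕ) (xs : List A) → sumBy (λ x → v x ℕ.+ w x) xs ≡ sumBy v xs ℕ.+ sumBy w xs
sumBy-+ v w []       = refl
sumBy-+ v w (x ∷ xs) = trans (cong (v x ℕ.+ w x ℕ.+_) (sumBy-+ v w xs))
  (interchange ℕₚ.+-commutativeSemigroup (v x) (w x) (sumBy v xs) (sumBy w xs))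

sumBy-*ˡ : {A : Set} (c : ℕ) (w : A → ℕ) (xs : List A) → sumBy (λ x → c ℕ.* w x) xs ≡ c ℕ.* sumBy w xs
sumBy-*ˡ c w []       = sym (ℕₚ.*-zeroʳ c)
sumBy-*ˡ c w (x ∷ xs) = trans (cong (c ℕ.* w x ℕ.+_) (sumBy-*ˡ c w xs)) (sym (ℕₚ.*-distribˡ-+ c (w x) _))

sumBy-swap : {A B : Set} (w : A → B → ℕ) (xs : List A) (ys : List B) →
  sumBy (λ x → sumBy (w x) ys) xs ≡ sumBy (λ y → sumBy (λ x → w x y) xs) ys
sumBy-swap w []       ys = sym (sumBy-0 ys)
sumBy-swap w (x ∷ xs) ys = trans (cong (sumBy (w x) ys ℕ.+_) (sumBy-swap w xs ys))
  (sym (sumBy-+ (w x) (λ y → sumBy (λ x → w x y) xs) ys))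

∑-sumBy-swap : ∀ {B : Set} {n} (w : Fin n → B → ℕ) (ys : List B) →
  ∑ (λ x → sumBy (w x) ys) ≡ sumBy (λ y → ∑ (λ x → w x y)) ys
∑-sumBy-swap {n = n} w [] = ∑.sum-replicate-zero n
∑-sumBy-swap w (y ∷ ys) = trans (∑.∑-distrib-+ (λ x → w x y) (λ x → sumBy (w x) ys))
  (cong (∑ (λ x → w x y) ℕ.+_) (∑-sumBy-swap w ys))

∑-𝟙≡ : ∀ {n} (y : Fin n) → ∑ (λ x → 𝟙 (y Finₚ.≟ x)) ≡ 1
∑-𝟙≡ {suc n} zero    = cong suc (trans (∑.sum-cong-≗ {n} (λ x → 𝟙-false (zero Finₚ.≟ suc x) λ ())) (∑.sum-replicate-zero n))
∑-𝟙≡ {suc n} (suc y) = trans (cong (ℕ._+ ∑ (λ x → 𝟙 (suc y Finₚ.≟ suc x))) (𝟙-false (suc y Finₚ.≟ zero) λ ()))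
  (trans (∑.sum-cong-≗ {n} (λ x → 𝟙-cong (suc y Finₚ.≟ suc x) (y Finₚ.≟ x) Finₚ.suc-injective (cong suc))) (∑-𝟙≡ y))

∏-zero : ∀ {n} (f : Fin n → ℕ) x → f x ≡ 0 → ∏ f ≡ 0
∏-zero f zero    eq = cong (ℕ._* ∏ (f ∘ suc)) eq
∏-zero f (suc x) eq = trans (cong (f zero ℕ.*_) (∏-zero (f ∘ suc) x eq)) (ℕₚ.*-zeroʳ (f zero))

∏-one : ∀ {n} (f : Fin n → ℕ) → (∀ x → f x ≡ 1) → ∏ f ≡ 1
∏-one {zero}  f eq = refl
∏-one {suc n} f eq = cong₂ ℕ._*_ (eq zero) (∏-one (f ∘ suc) (eq ∘ suc))

∏-mono : ∀ {n} (f g : Fin n → ℕ) → (∀ x → f x ≤ℕ g x) → ∏ f ≤ℕ ∏ g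
∏-mono {zero}  f g le = ℕₚ.≤-refl
∏-mono {suc n} f g le = ℕₚ.*-mono-≤ (le zero) (∏-mono (f ∘ suc) (g ∘ suc) (le ∘ suc))

-- Additivity in the single factor at `y`; it turns Pascal's rule in one class into a recursion for
-- the whole product `choices`.
∏-split : ∀ {n} (f g h : Fin n → ℕ) y → f y ≡ g y ℕ.+ h y →
  (∀ x → x ≢ y → f x ≡ g x) → (∀ x → x ≢ y → f x ≡ h x) → ∏ f ≡ ∏ g ℕ.+ ∏ h
∏-split {suc n} f g h zero    eq fg fh = begin
  f zero ℕ.* ∏ (f ∘ suc)                              ≡⟨ cong (ℕ._* ∏ (f ∘ suc)) eq ⟩
  (g zero ℕ.+ h zero) ℕ.* ∏ (f ∘ suc)                 ≡⟨ ℕₚ.*-distribʳ-+ (∏ (f ∘ suc)) (g zero) (h zero) ⟩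
  g zero ℕ.* ∏ (f ∘ suc) ℕ.+ h zero ℕ.* ∏ (f ∘ suc)   ≡⟨ cong₂ (λ a b → g zero ℕ.* a ℕ.+ h zero ℕ.* b)
    (∏.sum-cong-≗ {n} (λ x → fg (suc x) λ ())) (∏.sum-cong-≗ {n} (λ x → fh (suc x) λ ())) ⟩
  ∏ g ℕ.+ ∏ h                                         ∎
  where open ≡-Reasoning
∏-split {suc n} f g h (suc y) eq fg fh = begin
  f zero ℕ.* ∏ (f ∘ suc)                              ≡⟨ cong (f zero ℕ.*_) (∏-split (f ∘ suc) (g ∘ suc) (h ∘ suc) y eq
    (λ x x≢y → fg (suc x) (x≢y ∘ Finₚ.suc-injective)) (λ x x≢y → fh (suc x) (x≢y ∘ Finₚ.suc-injective))) ⟩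
  f zero ℕ.* (∏ (g ∘ suc) ℕ.+ ∏ (h ∘ suc))            ≡⟨ ℕₚ.*-distribˡ-+ (f zero) _ _ ⟩
  f zero ℕ.* ∏ (g ∘ suc) ℕ.+ f zero ℕ.* ∏ (h ∘ suc)   ≡⟨ cong₂ (λ a b → a ℕ.* ∏ (g ∘ suc) ℕ.+ b ℕ.* ∏ (h ∘ suc))
    (fg zero λ ()) (fh zero λ ()) ⟩
  ∏ g ℕ.+ ∏ h                                         ∎
  where open ≡-Reasoning

𝟙-∀ : ∀ {P : Set} {n} {R : Fin n → Set} (d : Dec P) (R? : Decidable R) →
  (P → ∀ x → R x) → ((∀ x → R x) → P) → 𝟙 d ≡ ∏ (λ x → 𝟙 (R? x))
𝟙-∀ (yes p) R? f g = sym (∏-one _ (λ x → 𝟙-true (R? x) (f p x)))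
𝟙-∀ (no ¬p) R? f g with Finₚ.¬∀⟶∃¬ _ _ R? (¬p ∘ g)
... | x , ¬r = sym (∏-zero _ x (𝟙-false (R? x) ¬r))

0choose : ∀ k → 𝟙 (0 ℕ.≟ k) ≡ 0 choose k
0choose zero    = sym (nC0≡1 0)
0choose (suc k) = sym (k>n⇒nCk≡0 {0} {suc k} (s≤s z≤n))

module Sublists {A : Set} {n : ℕ} (class : A → Fin n) {R : A → Set} (R? : Decidable R) where

  occurrences : Fin n → List A → ℕ
  occurrences x = sumBy (λ e → 𝟙 (class e Finₚ.≟ x))

  available : Fin n → List A → ℕ
  available x = sumBy (λ e → 𝟙 (R? e) ℕ.* 𝟙 (class e Finₚ.≟ x))

  fits : (Fin n → ℕ) → List A → ℕ
  fits μ ys = 𝟙 (all? R? ys) ℕ.* ∏ (λ x → 𝟙 (occurrences x ys ℕ.≟ μ x))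

  choices : (Fin n → ℕ) → List A → ℕ
  choices μ L = ∏ (λ x → available x L choose μ x)

  private
    lower : (Fin n → ℕ) → Fin n → Fin n → ℕ
    lower μ y = updateAt μ y pred

    all-∷ : ∀ e ys → 𝟙 (all? R? (e ∷ ys)) ≡ 𝟙 (R? e) ℕ.* 𝟙 (all? R? ys)
    all-∷ e ys = 𝟙-× (R? e) (all? R? ys)

    fits-bad : ∀ μ e ys → ¬ R e → fits μ (e ∷ ys) ≡ 0
    fits-bad μ e ys ¬r = cong (ℕ._* ∏ (λ x → 𝟙 (occurrences x (e ∷ ys) ℕ.≟ μ x)))
      (trans (all-∷ e ys) (cong (ℕ._* 𝟙 (all? R? ys)) (𝟙-false (R? e) ¬r)))

    fits-zero : ∀ μ e ys → μ (class e) ≡ 0 → fits μ (e ∷ ys) ≡ 0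
    fits-zero μ e ys μ≡0 = trans
      (cong (𝟙 (all? R? (e ∷ ys)) ℕ.*_) (∏-zero _ (class e)
        (𝟙-false (occurrences (class e) (e ∷ ys) ℕ.≟ μ (class e)) λ eq →
          ℕₚ.1+n≢0 (trans (sym (cong (ℕ._+ occurrences (class e) ys) (𝟙-true (class e Finₚ.≟ class e) refl))) (trans eq μ≡0)))))
      (ℕₚ.*-zeroʳ (𝟙 (all? R? (e ∷ ys))))

    fits-suc : ∀ μ e ys {v} → R e → μ (class e) ≡ suc v → fits μ (e ∷ ys) ≡ fits (lower μ (class e)) ys
    fits-suc μ e ys {v} r μ≡ = cong₂ ℕ._*_
      (trans (all-∷ e ys) (trans (cong (ℕ._* 𝟙 (all? R? ys)) (𝟙-true (R? e) r)) (ℕₚ.+-identityʳ _)))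
      (∏.sum-cong-≗ {n} pointwise)
      where
      pointwise : ∀ x → 𝟙 (occurrences x (e ∷ ys) ℕ.≟ μ x) ≡ 𝟙 (occurrences x ys ℕ.≟ lower μ (class e) x)
      pointwise x with class e Finₚ.≟ x
      ... | yes refl rewrite updateAt-updates (class e) {f = pred} μ | μ≡ =
        𝟙-cong (suc (occurrences (class e) ys) ℕ.≟ suc v) (occurrences (class e) ys ℕ.≟ v) ℕₚ.suc-injective (cong suc)
      ... | no y≢x rewrite updateAt-minimal x (class e) {f = pred} μ (y≢x ∘ sym) = refl

    available-bad : ∀ e L x → ¬ R e → available x (e ∷ L) ≡ available x L
    available-bad e L x ¬r = cong (λ i → i ℕ.* 𝟙 (class e Finₚ.≟ x) ℕ.+ available x L) (𝟙-false (R? e) ¬r)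

    available-≡ : ∀ e L → R e → available (class e) (e ∷ L) ≡ suc (available (class e) L)
    available-≡ e L r = cong (ℕ._+ available (class e) L)
      (cong₂ ℕ._*_ (𝟙-true (R? e) r) (𝟙-true (class e Finₚ.≟ class e) refl))

    available-≢ : ∀ e L x → x ≢ class e → available x (e ∷ L) ≡ available x L
    available-≢ e L x x≢ = cong (ℕ._+ available x L)
      (trans (cong (𝟙 (R? e) ℕ.*_) (𝟙-false (class e Finₚ.≟ x) (x≢ ∘ sym))) (ℕₚ.*-zeroʳ (𝟙 (R? e))))

    choices-zero : ∀ μ e L → R e → μ (class e) ≡ 0 → choices μ (e ∷ L) ≡ choices μ L
    choices-zero μ e L r μ≡0 = ∏.sum-cong-≗ {n} pointwise
      where
      pointwise : ∀ x → available x (e ∷ L) choose μ x ≡ available x L choose μ x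
      pointwise x with x Finₚ.≟ class e
      ... | yes refl = trans (cong (available (class e) (e ∷ L) choose_) μ≡0)
        (trans (nC0≡1 (available (class e) (e ∷ L))) (sym (trans (cong (available (class e) L choose_) μ≡0) (nC0≡1 (available (class e) L)))))
      ... | no x≢    = cong (_choose μ x) (available-≢ e L x x≢)

    choices-suc : ∀ μ e L {v} → R e → μ (class e) ≡ suc v →
      choices μ (e ∷ L) ≡ choices μ L ℕ.+ choices (lower μ (class e)) L
    choices-suc μ e L {v} r μ≡ = ∏-split
      (λ x → available x (e ∷ L) choose μ x) (λ x → available x L choose μ x)
      (λ x → available x L choose lower μ (class e) x) (class e)
      (begin
        available (class e) (e ∷ L) choose μ (class e)                   ≡⟨ cong₂ _choose_ (available-≡ e L r) μ≡ ⟩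
        suc N choose suc v                                               ≡⟨ pascal N v ⟩
        N choose suc v ℕ.+ N choose v                                         ≡⟨ cong₂ (λ a b → N choose a ℕ.+ N choose b) (sym μ≡)
          (sym (trans (updateAt-updates (class e) {f = pred} μ) (cong pred μ≡))) ⟩
        N choose μ (class e) ℕ.+ N choose lower μ (class e) (class e)         ∎)
      (λ x x≢ → cong (_choose μ x) (available-≢ e L x x≢))
      (λ x x≢ → cong₂ _choose_ (available-≢ e L x x≢) (sym (updateAt-minimal x (class e) {f = pred} μ x≢)))
      where
      open ≡-Reasoning
      N = available (class e) L

  -- Induction on the list. Sublists that drop `e` are counted by `choices μ L`. Those that keep it
  -- use up one place of its class, so they are counted with the lowered `μ`, and Pascal's rule in
  -- that class adds the two numbers. Keeping `e` contributes 0 when `e` violates `R` or its class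
  -- has no place left.
  count-sublists : ∀ L μ → sumBy (λ s → fits μ (proj₁ s)) (sublists L) ≡ choices μ L
  count-sublists []      μ = trans (ℕₚ.+-identityʳ _) (trans (ℕₚ.+-identityʳ _) (∏.sum-cong-≗ {n} (λ x → 0choose (μ x))))
  count-sublists (e ∷ L) μ = begin
    sumBy (λ s → fits μ (proj₁ s)) (sublists (e ∷ L))
      ≡⟨ sumBy-++ (λ s → fits μ (proj₁ s)) (map skip (sublists L)) (map keep (sublists L)) ⟩
    sumBy (λ s → fits μ (proj₁ s)) (map skip (sublists L)) ℕ.+ sumBy (λ s → fits μ (proj₁ s)) (map keep (sublists L))
      ≡⟨ cong₂ ℕ._+_ (sumBy-map (λ s → fits μ (proj₁ s)) skip (sublists L)) (sumBy-map (λ s → fits μ (proj₁ s)) keep (sublists L)) ⟩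
    sumBy (λ s → fits μ (proj₁ s)) (sublists L) ℕ.+ kept
      ≡⟨ cong (ℕ._+ kept) (count-sublists L μ) ⟩
    choices μ L ℕ.+ kept
      ≡⟨ step (R? e) (μ (class e)) refl ⟩
    choices μ (e ∷ L) ∎
    where
    open ≡-Reasoning
    kept = sumBy (λ s → fits μ (e ∷ proj₁ s)) (sublists L)
    none : (∀ ys → fits μ (e ∷ ys) ≡ 0) → choices μ L ℕ.+ kept ≡ choices μ L
    none z = trans (cong (choices μ L ℕ.+_) (trans (sumBy-cong (λ s → z (proj₁ s)) (sublists L)) (sumBy-0 (sublists L))))
                   (ℕₚ.+-identityʳ _)
    step : Dec (R e) → ∀ v → μ (class e) ≡ v → choices μ L ℕ.+ kept ≡ choices μ (e ∷ L)
    step (no ¬r) v       μ≡ = trans (none (λ ys → fits-bad μ e ys ¬r))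
      (∏.sum-cong-≗ {n} (λ x → cong (_choose μ x) (sym (available-bad e L x ¬r))))
    step (yes r) zero    μ≡ = trans (none (λ ys → fits-zero μ e ys μ≡)) (sym (choices-zero μ e L r μ≡))
    step (yes r) (suc v) μ≡ = trans
      (cong (choices μ L ℕ.+_) (trans (sumBy-cong (λ s → fits-suc μ e (proj₁ s) r μ≡) (sublists L))
        (count-sublists L (lower μ (class e)))))
      (sym (choices-suc μ e L r μ≡))

count-subsets : ∀ {n} (V : Subset n) k →
  sumBy (λ e → 𝟙 (e Subₚ.⊆? V) ℕ.* 𝟙 (∣ e ∣ ℕ.≟ k)) (subsets n) ≡ ∣ V ∣ choose k
count-subsets [] k = trans (ℕₚ.+-identityʳ _)
  (trans (cong (ℕ._* 𝟙 (0 ℕ.≟ k)) (𝟙-true ([] Subₚ.⊆? []) (λ ()))) (trans (ℕₚ.+-identityʳ _) (0choose k)))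
count-subsets {suc n} (v ∷ V) k = trans
  (sumBy-++ w (map (outside ∷_) (subsets n)) (map (inside ∷_) (subsets n)))
  (trans (cong₂ ℕ._+_ (sumBy-map w (outside ∷_) (subsets n)) (sumBy-map w (inside ∷_) (subsets n)))
  (trans (cong (ℕ._+ ins) (trans (sumBy-cong outs (subsets n)) (count-subsets V k))) (rest v k refl refl)))
  where
  w : Subset (suc n) → ℕ
  w e = 𝟙 (e Subₚ.⊆? (v ∷ V)) ℕ.* 𝟙 (∣ e ∣ ℕ.≟ k)
  ins = sumBy (λ e → w (inside ∷ e)) (subsets n)
  outs : ∀ e → w (outside ∷ e) ≡ 𝟙 (e Subₚ.⊆? V) ℕ.* 𝟙 (∣ e ∣ ℕ.≟ k)
  outs e = cong (ℕ._* 𝟙 (∣ e ∣ ℕ.≟ k))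
    (𝟙-cong ((outside ∷ e) Subₚ.⊆? (v ∷ V)) (e Subₚ.⊆? V) Subₚ.drop-∷-⊆ Subₚ.out⊆)
  zeros : (∀ e → w (inside ∷ e) ≡ 0) → ins ≡ 0
  zeros z = trans (sumBy-cong z (subsets n)) (sumBy-0 (subsets n))
  rest : ∀ u j → u ≡ v → j ≡ k → ∣ V ∣ choose k ℕ.+ ins ≡ ∣ v ∷ V ∣ choose k
  rest outside j refl refl = trans (cong (∣ V ∣ choose k ℕ.+_) (zeros λ e →
    cong (ℕ._* 𝟙 (suc ∣ e ∣ ℕ.≟ k)) (𝟙-false ((inside ∷ e) Subₚ.⊆? (outside ∷ V)) λ sub → out∌ (sub here)))) (ℕₚ.+-identityʳ _)
    where
    out∌ : ¬ (zero Data.Fin.Subset.∈ (outside ∷ V))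
    out∌ ()
  rest inside zero    refl refl = trans (cong (∣ V ∣ choose 0 ℕ.+_) (zeros λ e →
    trans (cong (𝟙 ((inside ∷ e) Subₚ.⊆? (inside ∷ V)) ℕ.*_) (𝟙-false (suc ∣ e ∣ ℕ.≟ 0) λ ())) (ℕₚ.*-zeroʳ (𝟙 ((inside ∷ e) Subₚ.⊆? (inside ∷ V))))))
    (trans (ℕₚ.+-identityʳ _) (trans (nC0≡1 ∣ V ∣) (sym (nC0≡1 (suc ∣ V ∣)))))
  rest inside (suc j) refl refl = trans (cong (∣ V ∣ choose suc j ℕ.+_)
    (trans (sumBy-cong (λ e → cong₂ ℕ._*_
        (𝟙-cong ((inside ∷ e) Subₚ.⊆? (inside ∷ V)) (e Subₚ.⊆? V) Subₚ.drop-∷-⊆ Subₚ.s⊆s)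
        (𝟙-cong (suc ∣ e ∣ ℕ.≟ suc j) (∣ e ∣ ℕ.≟ j) ℕₚ.suc-injective (cong suc))) (subsets n))
      (count-subsets V j)))
    (sym (pascal ∣ V ∣ j))

fromℕ-÷ : ∀ a b → 1 ≤ℕ b → fromℕ b * (a ÷ b) ≡ fromℕ a
fromℕ-÷ a (suc d) _ = ℚₚ.toℚᵘ-injective (begin
  toℚᵘ (fromℕ (suc d) * (a ÷ suc d))              ≈⟨ ℚₚ.toℚᵘ-homo-* (fromℕ (suc d)) (a ÷ suc d) ⟩
  toℚᵘ (fromℕ (suc d)) ℚᵘ.* toℚᵘ (a ÷ suc d)    ≈⟨ ℚᵘₚ.*-cong (fromℕ-toℚᵘ (suc d)) (ℚₚ.toℚᵘ-fromℚᵘ (mkℚᵘ (ℤ.+ a) d)) ⟩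
  mkℚᵘ (ℤ.+ suc d) 0 ℚᵘ.* mkℚᵘ (ℤ.+ a) d            ≈⟨ *≡* (trans (ℤₚ.*-identityʳ (ℤ.+ suc d ℤ.* ℤ.+ a))
    (trans (ℤₚ.*-comm (ℤ.+ suc d) (ℤ.+ a)) (cong (λ z → ℤ.+ a ℤ.* ℤ.+ z) (sym (ℕₚ.+-identityʳ (suc d)))))) ⟩
  mkℚᵘ (ℤ.+ a) 0                                    ≈⟨ fromℕ-toℚᵘ a ⟨
  toℚᵘ (fromℕ a)                                  ∎)
  where open import Relation.Binary.Reasoning.Setoid ℚᵘₚ.≃-setoid

fromℕ-injective : ∀ {a b} → fromℕ a ≡ fromℕ b → a ≡ b
fromℕ-injective eq = ℕₚ.≤-antisym (fromℕ-cancel-≤ (ℚₚ.≤-reflexive eq)) (fromℕ-cancel-≤ (ℚₚ.≤-reflexive (sym eq)))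

0<fromℕ : ∀ {a} → 1 ≤ℕ a → 0ℚ < fromℕ a
0<fromℕ {a} 1≤a = ℚₚ.<-≤-trans (ℚₚ.positive⁻¹ 1ℚ) (fromℕ-mono-≤ {1} {a} 1≤a)

*-cancelˡ-≤ : ∀ {p q} r → 0ℚ < r → r * p ≤ r * q → p ≤ q
*-cancelˡ-≤ r 0<r = ℚₚ.*-cancelˡ-≤-pos r {{positive 0<r}}

*-cancelˡ-≡ : ∀ {p q} r → 0ℚ < r → r * p ≡ r * q → p ≡ q
*-cancelˡ-≡ r 0<r eq = ℚₚ.≤-antisym (*-cancelˡ-≤ r 0<r (ℚₚ.≤-reflexive eq)) (*-cancelˡ-≤ r 0<r (ℚₚ.≤-reflexive (sym eq)))

-- Hypergraphs with a prescribed number of edges of each size.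

nonempty⇒0<∣∣ : ∀ {n} {e : Subset n} → Nonempty e → 1 ≤ℕ ∣ e ∣
nonempty⇒0<∣∣ (x , x∈e) = ℕₚ.≤-trans (s≤s z≤n) (Subₚ.x∈p⇒∣p-x∣<∣p∣ x∈e)

0<∣∣⇒nonempty : ∀ {n} {e : Subset n} → 1 ≤ℕ ∣ e ∣ → Nonempty e
0<∣∣⇒nonempty {n} {e} 1≤ with Subₚ.nonempty? e
... | yes ne = ne
... | no ¬ne = contradiction (trans (cong ∣_∣ (Subₚ.Empty-unique ¬ne)) (Subₚ.∣⊥∣≡0 n)) (ℕₚ.>⇒≢ 1≤)

pred∣∣<n : ∀ {n} → 1 ≤ℕ n → (e : Subset n) → pred ∣ e ∣ ℕ.< n
pred∣∣<n {suc n} _ e = s≤s (ℕₚ.pred-mono-≤ (Subₚ.∣p∣≤n e))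

-- For nonempty `e` this is the index whose `size` is |e|. The empty set gets the class of size 1,
-- by the convention pred 0 = 0, so it has to be excluded wherever classes are compared with sizes.
class : ∀ {n} → 1 ≤ℕ n → Subset n → Fin n
class 1≤n e = fromℕ< (pred∣∣<n 1≤n e)

size-class : ∀ {n} (1≤n : 1 ≤ℕ n) {e : Subset n} → Nonempty e → size (class 1≤n e) ≡ ∣ e ∣
size-class 1≤n {e} ne = trans (cong suc (Finₚ.toℕ-fromℕ< (pred∣∣<n 1≤n e)))
  (ℕₚ.suc-pred ∣ e ∣ {{ℕ.>-nonZero (nonempty⇒0<∣∣ ne)}})

class≡⇒ : ∀ {n} (1≤n : 1 ≤ℕ n) {e : Subset n} {x} → Nonempty e → class 1≤n e ≡ x → ∣ e ∣ ≡ size x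
class≡⇒ 1≤n ne refl = sym (size-class 1≤n ne)

class≡⇐ : ∀ {n} (1≤n : 1 ≤ℕ n) {e : Subset n} {x} → Nonempty e → ∣ e ∣ ≡ size x → class 1≤n e ≡ x
class≡⇐ 1≤n ne eq = Finₚ.toℕ-injective (ℕₚ.suc-injective (trans (size-class 1≤n ne) eq))

module Counts {n : ℕ} (1≤n : 1 ≤ℕ n) (m : ℕ) (f : Fin n → ℚ) (μ : Fin n → ℕ)
  (1≤m : 1 ≤ℕ m) (mf≡μ : ∀ x → fromℕ m * f x ≡ fromℕ (μ x)) (∑μ≡m : ∑ μ ≡ m) where

  count : {R : Subset n → Set} → Decidable R → ℕ
  count R? = sumBy (λ h → 𝟙 (all? R? (edges h))) (𝓗 n m f)

  avail : {R : Subset n → Set} → Decidable R → Fin n → ℕ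
  avail R? x = sumBy (λ e → 𝟙 (R? e) ℕ.* 𝟙 (∣ e ∣ ℕ.≟ size x)) (subsets n)

  module _ {R : Subset n → Set} (R? : Decidable R) where

    open Sublists (class 1≤n) R?

    edges-nonempty : ∀ {es} → es ⊆ nonemptySubsets n → All Nonempty es
    edges-nonempty s = Sublistₚ.All-resp-⊆ s (Allₚ.all-filter Subₚ.nonempty? (subsets n))

    ofSize≡ : ∀ {es} → All Nonempty es → ∀ x →
      length (filter (λ e → ∣ e ∣ ℕ.≟ size x) es) ≡ occurrences x es
    ofSize≡ {es} ne x = trans (length-filter (λ e → ∣ e ∣ ℕ.≟ size x) es)
      (sumBy-congᴬ (All.map (λ {e} h → 𝟙-cong (∣ e ∣ ℕ.≟ size x) (class 1≤n e Finₚ.≟ x) (class≡⇐ 1≤n h) (class≡⇒ 1≤n h)) ne))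

    ∑-occurrences : ∀ es → ∑ (λ x → occurrences x es) ≡ length es
    ∑-occurrences es = trans (∑-sumBy-swap (λ x e → 𝟙 (class 1≤n e Finₚ.≟ x)) es)
      (trans (sumBy-cong (λ e → ∑-𝟙≡ (class 1≤n e)) es) (sym (length≡sumBy es)))

    parameters⇒ : ∀ h → HasParameters m f h → ∀ x → occurrences x (edges h) ≡ μ x
    parameters⇒ h (refl , emp) x = trans (sym (ofSize≡ (edges-nonempty (edges⊆all h)) x)) (fromℕ-injective (begin
      fromℕ k                               ≡⟨ fromℕ-÷ k (length (edges h)) 1≤m ⟨
      fromℕ m * (k ÷ length (edges h))      ≡⟨ cong (fromℕ m *_) (emp x) ⟩
      fromℕ m * f x                         ≡⟨ mf≡μ x ⟩
      fromℕ (μ x)                           ∎))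
      where
      open ≡-Reasoning
      k = length (filter (λ e → ∣ e ∣ ℕ.≟ size x) (edges h))

    parameters⇐ : ∀ h → (∀ x → occurrences x (edges h) ≡ μ x) → HasParameters m f h
    parameters⇐ h occ = len , λ x → *-cancelˡ-≡ (fromℕ m) (0<fromℕ 1≤m) (begin
      fromℕ m * (k x ÷ length (edges h))      ≡⟨ cong (λ l → fromℕ m * (k x ÷ l)) len ⟩
      fromℕ m * (k x ÷ m)                     ≡⟨ fromℕ-÷ (k x) m 1≤m ⟩
      fromℕ (k x)                             ≡⟨ cong fromℕ (trans (ofSize≡ (edges-nonempty (edges⊆all h)) x) (occ x)) ⟩
      fromℕ (μ x)                             ≡⟨ mf≡μ x ⟨
      fromℕ m * f x                           ∎)
      where
      open ≡-Reasoning
      k : Fin n → ℕ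
      k x = length (filter (λ e → ∣ e ∣ ℕ.≟ size x) (edges h))
      len : length (edges h) ≡ m
      len = trans (sym (∑-occurrences (edges h))) (trans (∑.sum-cong-≗ {n} occ) ∑μ≡m)

    available≡avail : ∀ x → available x (nonemptySubsets n) ≡ avail R? x
    available≡avail x = trans
      (sumBy-filter Subₚ.nonempty? (λ e → 𝟙 (R? e) ℕ.* 𝟙 (class 1≤n e Finₚ.≟ x)) (subsets n))
      (sumBy-cong pointwise (subsets n))
      where
      pointwise : ∀ e → 𝟙 (Subₚ.nonempty? e) ℕ.* (𝟙 (R? e) ℕ.* 𝟙 (class 1≤n e Finₚ.≟ x)) ≡
                        𝟙 (R? e) ℕ.* 𝟙 (∣ e ∣ ℕ.≟ size x)
      pointwise e = case (Subₚ.nonempty? e)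
        where
        i = 𝟙 (R? e) ℕ.* 𝟙 (class 1≤n e Finₚ.≟ x)
        case : Dec (Nonempty e) → 𝟙 (Subₚ.nonempty? e) ℕ.* i ≡ 𝟙 (R? e) ℕ.* 𝟙 (∣ e ∣ ℕ.≟ size x)
        case (yes ne) = trans (cong (ℕ._* i) (𝟙-true (Subₚ.nonempty? e) ne)) (trans (ℕₚ.+-identityʳ i)
          (cong (𝟙 (R? e) ℕ.*_) (𝟙-cong (class 1≤n e Finₚ.≟ x) (∣ e ∣ ℕ.≟ size x) (class≡⇒ 1≤n ne) (class≡⇐ 1≤n ne))))
        case (no ¬ne) = trans (cong (ℕ._* i) (𝟙-false (Subₚ.nonempty? e) ¬ne)) (sym (trans
          (cong (𝟙 (R? e) ℕ.*_) (𝟙-false (∣ e ∣ ℕ.≟ size x) λ eq → ¬ne (0<∣∣⇒nonempty (subst (1 ≤ℕ_) (sym eq) (s≤s z≤n)))))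
          (ℕₚ.*-zeroʳ (𝟙 (R? e)))))

    -- By `parameters⇒` and `parameters⇐`, membership in `𝓗` means exactly μ x edges of each size x,
    -- so the choices for different sizes are independent and `count-sublists` applies.
    count≡∏ : count R? ≡ ∏ (λ x → avail R? x choose μ x)
    count≡∏ = begin
      sumBy (λ h → 𝟙 (all? R? (edges h))) (𝓗 n m f)
        ≡⟨ sumBy-filter (hasParameters? m f) (λ h → 𝟙 (all? R? (edges h))) (hypergraphs n) ⟩
      sumBy (λ h → 𝟙 (hasParameters? m f h) ℕ.* 𝟙 (all? R? (edges h))) (hypergraphs n)
        ≡⟨ sumBy-cong (λ h → trans (ℕₚ.*-comm (𝟙 (hasParameters? m f h)) (𝟙 (all? R? (edges h))))
             (cong (𝟙 (all? R? (edges h)) ℕ.*_)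
               (𝟙-∀ (hasParameters? m f h) (λ x → occurrences x (edges h) ℕ.≟ μ x) (parameters⇒ h) (parameters⇐ h))))
             (hypergraphs n) ⟩
      sumBy (λ h → fits μ (edges h)) (hypergraphs n)
        ≡⟨ sumBy-map (λ h → fits μ (edges h)) (λ s → hypergraph (proj₁ s) (proj₂ s)) (sublists (nonemptySubsets n)) ⟩
      sumBy (λ s → fits μ (proj₁ s)) (sublists (nonemptySubsets n))
        ≡⟨ count-sublists (nonemptySubsets n) μ ⟩
      ∏ (λ x → available x (nonemptySubsets n) choose μ x)
        ≡⟨ ∏.sum-cong-≗ {n} (λ x → cong (_choose μ x) (available≡avail x)) ⟩
      ∏ (λ x → avail R? x choose μ x) ∎
      where open ≡-Reasoning

-- Exponential estimates for powers, factorials and harmonic sums.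

≼-gain : ∀ b c → 1 ≤ℕ b → b ℕ.+ c ≼ b exp (c ÷ b)
≼-gain b c 1≤b = ≼-lin (0≤⇒≥-1 0≤c÷b) (ℚₚ.≤-reflexive (trans (fromℕ-+ b c)
  (trans (cong (fromℕ b +_) (sym (fromℕ-÷ c b 1≤b)))
    (solve 2 (λ b q → b :+ b :* q := b :* (con 1ℚ :+ q)) refl (fromℕ b) (c ÷ b)))))
  where
  0≤c÷b : 0ℚ ≤ c ÷ b
  0≤c÷b = *-cancelˡ-≤ (fromℕ b) (0<fromℕ 1≤b)
    (subst₂ _≤_ (sym (ℚₚ.*-zeroʳ (fromℕ b))) (sym (fromℕ-÷ c b 1≤b)) (0≤fromℕ c))

0≤÷ : ∀ a b → 0ℚ ≤ a ÷ b
0≤÷ a zero    = ℚₚ.≤-refl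
0≤÷ a (suc b) = *-cancelˡ-≤ (fromℕ (suc b)) (0<fromℕ {suc b} (s≤s z≤n))
    (subst₂ _≤_ (sym (ℚₚ.*-zeroʳ (fromℕ (suc b)))) (sym (fromℕ-÷ a (suc b) (s≤s z≤n))) (0≤fromℕ a))

-- The factor 1 - c/b equals a/b, which is nonnegative, so the increment -c/b is at least -1.
≼-loss : ∀ a b c → 1 ≤ℕ b → a ℕ.+ c ≡ b → a ≼ b exp (- (c ÷ b))
≼-loss a b c 1≤b a+c≡b = ≼-lin
  (*-cancelˡ-≤ (fromℕ b) (0<fromℕ 1≤b) (subst₂ _≤_ (sym (ℚₚ.*-zeroʳ (fromℕ b))) eq (0≤fromℕ a)))
  (ℚₚ.≤-reflexive eq)
  where
  eq : fromℕ a ≡ fromℕ b * (1ℚ + - (c ÷ b))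
  eq = begin
    fromℕ a                                   ≡⟨ solve 2 (λ a c → a := (a :+ c) :- c) refl (fromℕ a) (fromℕ c) ⟩
    (fromℕ a + fromℕ c) - fromℕ c             ≡⟨ cong (_- fromℕ c) (trans (sym (fromℕ-+ a c)) (cong fromℕ a+c≡b)) ⟩
    fromℕ b - fromℕ c                         ≡⟨ cong (λ z → fromℕ b - z) (sym (fromℕ-÷ c b 1≤b)) ⟩
    fromℕ b - fromℕ b * (c ÷ b)               ≡⟨ solve 2 (λ b q → b :- b :* q := b :* (con 1ℚ :+ :- q)) refl (fromℕ b) (c ÷ b) ⟩
    fromℕ b * (1ℚ + - (c ÷ b))                ∎
    where open ≡-Reasoning

≼-cancelʳ : ∀ {a b q} k → 1 ≤ℕ k → a ℕ.* k ≼ b ℕ.* k exp q → a ≼ b exp q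
≼-cancelʳ {a} {b} k 1≤k (expBound us h t e) = expBound us h t
  (*-cancelˡ-≤ (fromℕ k) (0<fromℕ 1≤k) (subst₂ _≤_
    (trans (fromℕ-* a k) (ℚₚ.*-comm (fromℕ a) (fromℕ k)))
    (trans (cong (_* ∏1+ us) (trans (fromℕ-* b k) (ℚₚ.*-comm (fromℕ b) (fromℕ k)))) (ℚₚ.*-assoc (fromℕ k) (fromℕ b) (∏1+ us)))
    e))

≼-≡ : ∀ {a b q r} → q ≡ r → a ≼ b exp q → a ≼ b exp r
≼-≡ q≡r = ≼-weaken (ℚₚ.≤-reflexive q≡r)

≼-1^ : ∀ {a q} k → a ≼ 1 exp q → a ^ k ≼ 1 exp (fromℕ k * q)
≼-1^ k h = ≼-≤ʳ (≼-^ k h) (ℕₚ.≤-reflexive (ℕₚ.^-zeroˡ k))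

suc≼1 : ∀ k → suc k ≼ 1 exp fromℕ k
suc≼1 k = ≼-lin (0≤⇒≥-1 (0≤fromℕ k)) (ℚₚ.≤-reflexive (trans (fromℕ-+ 1 k) (sym (ℚₚ.*-identityˡ (1ℚ + fromℕ k)))))

^≤^⇒≤ : ∀ {a b} k → 1 ≤ℕ k → a ^ k ≤ℕ b ^ k → a ≤ℕ b
^≤^⇒≤ {a} {b} k@(suc _) _ le with ℕₚ.≤-<-connex a b
... | inj₁ a≤b = a≤b
... | inj₂ b<a = contradiction le (ℕₚ.<⇒≱ (ℕₚ.^-monoˡ-< k b<a))

-- Induction with (1 + 1/k)^k ≤ e: the k increments 1/k add up to 1. The step from 0 to 1 is
-- separate because `≼-gain` needs a positive base.
n^n≼n! : ∀ k → k ^ k ≼ k ! exp fromℕ k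
n^n≼n! zero = ≤⇒≼ ℕₚ.≤-refl
n^n≼n! (suc zero) = ≼-weaken (0≤fromℕ 1) (≤⇒≼ ℕₚ.≤-refl)
n^n≼n! (suc k@(suc _)) = ≼-≡ exponent
  (≼-* (≤⇒≼ {suc k} ℕₚ.≤-refl) (≼-trans (≼-^ k (≼-≤ˡ (ℕₚ.≤-reflexive (sym (ℕₚ.+-comm k 1))) (≼-gain k 1 (s≤s z≤n)))) (n^n≼n! k)))
  where
  exponent : 0ℚ + (fromℕ k * (1 ÷ k) + fromℕ k) ≡ fromℕ (suc k)
  exponent = trans (ℚₚ.+-identityˡ _) (trans (cong (_+ fromℕ k) (fromℕ-÷ 1 k (s≤s z≤n))) (sym (fromℕ-+ 1 k)))

-- This is n^(k/n) ≤ e³ (k!)^(1/k), raised to the power nk. For n ≤ k² one has n^(k²) ≤ k^(2k²) ≤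
-- k^(kn), and k^k ≤ k! e^k. For k² ≤ n one has n ≤ k² e^(n/k²) and k ≤ e^k, so n^(k²) ≤ e^(n +
-- 2k³), where n + 2k³ ≤ 3nk.
power≼factorial : ∀ {n k} → 1 ≤ℕ k → k ℕ.+ k ≤ℕ n → n ^ (k ℕ.* k) ≼ (k !) ^ n exp fromℕ (3 ℕ.* (n ℕ.* k))
power≼factorial {n} {k} 1≤k 2k≤n with ℕₚ.≤-total n (k ℕ.* k)
... | inj₁ n≤kk = ≼-weaken exponent (≼-≤ˡ (begin
    n ^ (k ℕ.* k)                 ≤⟨ ℕₚ.^-monoˡ-≤ (k ℕ.* k) n≤kk ⟩
    (k ℕ.* k) ^ (k ℕ.* k)         ≡⟨ ^-distribʳ-* (k ℕ.* k) k k ⟩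
    k ^ (k ℕ.* k) ℕ.* k ^ (k ℕ.* k)   ≡⟨ ℕₚ.^-distribˡ-+-* k (k ℕ.* k) (k ℕ.* k) ⟨
    k ^ (k ℕ.* k ℕ.+ k ℕ.* k)     ≡⟨ cong (k ^_) (ℕₚ.*-distribˡ-+ k k k) ⟨
    k ^ (k ℕ.* (k ℕ.+ k))         ≤⟨ ℕₚ.^-monoʳ-≤ k {{ℕ.>-nonZero 1≤k}} (ℕₚ.*-monoʳ-≤ k 2k≤n) ⟩
    k ^ (k ℕ.* n)                 ≡⟨ ℕₚ.^-*-assoc k k n ⟨
    (k ^ k) ^ n                   ∎) (≼-^ n (n^n≼n! k)))
  where
  open ℕₚ.≤-Reasoning
  exponent : fromℕ n * fromℕ k ≤ fromℕ (3 ℕ.* (n ℕ.* k))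
  exponent = subst (_≤ fromℕ (3 ℕ.* (n ℕ.* k))) (fromℕ-* n k) (fromℕ-mono-≤ (ℕₚ.m≤m+n (n ℕ.* k) _))
... | inj₂ kk≤n = ≼-≤ʳ (≼-weaken exponent (≼-trans
    (≼-^ (k ℕ.* k) (≼-≤ˡ (ℕₚ.m≤n+m n (k ℕ.* k)) (≼-gain (k ℕ.* k) n 1≤kk)))
    (≼-1^ (k ℕ.* k) (≼-* {k} {1} {k} {1} k≼1 k≼1))))
    (ℕₚ.m^n>0 (k !) {{ℕ.>-nonZero (1≤k! k)}} n)
  where
  1≤kk : 1 ≤ℕ k ℕ.* k
  1≤kk = ℕₚ.*-mono-≤ 1≤k 1≤k
  k≼1 : k ≼ 1 exp fromℕ k
  k≼1 = ≼-≤ˡ (ℕₚ.n≤1+n k) (suc≼1 k)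
  bound : n ℕ.+ (k ℕ.* k) ℕ.* (k ℕ.+ k) ≤ℕ 3 ℕ.* (n ℕ.* k)
  bound = begin
    n ℕ.+ (k ℕ.* k) ℕ.* (k ℕ.+ k)        ≤⟨ ℕₚ.+-mono-≤ (ℕₚ.m≤m*n n k {{ℕ.>-nonZero 1≤k}}) (ℕₚ.*-monoˡ-≤ (k ℕ.+ k) kk≤n) ⟩
    n ℕ.* k ℕ.+ n ℕ.* (k ℕ.+ k)          ≡⟨ lem n k ⟩
    3 ℕ.* (n ℕ.* k)                      ∎
    where
    open ℕₚ.≤-Reasoning
    lem : ∀ n k → n ℕ.* k ℕ.+ n ℕ.* (k ℕ.+ k) ≡ 3 ℕ.* (n ℕ.* k)
    lem = solve-∀
  exponent : fromℕ (k ℕ.* k) * (n ÷ (k ℕ.* k)) + fromℕ (k ℕ.* k) * (fromℕ k + fromℕ k) ≤ fromℕ (3 ℕ.* (n ℕ.* k))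
  exponent = subst (_≤ fromℕ (3 ℕ.* (n ℕ.* k)))
    (trans (fromℕ-+ n ((k ℕ.* k) ℕ.* (k ℕ.+ k)))
      (cong₂ _+_ (sym (fromℕ-÷ n (k ℕ.* k) 1≤kk))
        (trans (fromℕ-* (k ℕ.* k) (k ℕ.+ k)) (cong (fromℕ (k ℕ.* k) *_) (fromℕ-+ k k)))))
    (fromℕ-mono-≤ bound)

-- The product of (j+1)/j = 1 + 1/j over k < j ≤ k + c telescopes.
recipSum-gain : ∀ c k → suc (c ℕ.+ k) ≼ suc k exp recipSum c k
recipSum-gain zero    k = ≤⇒≼ ℕₚ.≤-refl
recipSum-gain (suc c) k = ≼-≡ (ℚₚ.+-comm (recipSum c (suc k)) (1 ÷ suc k))
  (≼-≤ˡ (ℕₚ.≤-reflexive (cong suc (sym (ℕₚ.+-suc c k)))) (≼-trans (recipSum-gain c (suc k))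
    (≼-≤ˡ (ℕₚ.≤-reflexive (sym (ℕₚ.+-comm (suc k) 1))) (≼-gain (suc k) 1 (s≤s z≤n)))))

-- The product of (j-1)/j = 1 - 1/j over k < j ≤ k + c telescopes.
recipSum-loss : ∀ c k → k ≼ c ℕ.+ k exp (- recipSum c k)
recipSum-loss zero    k = ≼-≡ refl (≤⇒≼ ℕₚ.≤-refl)
recipSum-loss (suc c) k = ≼-≡ (sym (ℚₚ.neg-distrib-+ (1 ÷ suc k) (recipSum c (suc k))))
  (≼-≤ʳ (≼-trans (≼-loss k (suc k) 1 (s≤s z≤n) (ℕₚ.+-comm k 1)) (recipSum-loss c (suc k))) (ℕₚ.≤-reflexive (ℕₚ.+-suc c k)))

-- Among the terms A/j with k < j ≤ k + c, at most A ∸ k have j ≤ A, and these are at most A; all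
-- others are at most 1. So a harmonic sum grows more slowly than any positive multiple of its
-- length.
recipSum-sublinear : ∀ A c k → fromℕ A * recipSum c k ≤ fromℕ (A ℕ.* (A ℕ.∸ k) ℕ.+ c)
recipSum-sublinear A zero    k = subst (_≤ fromℕ (A ℕ.* (A ℕ.∸ k) ℕ.+ 0)) (sym (ℚₚ.*-zeroʳ (fromℕ A))) (0≤fromℕ (A ℕ.* (A ℕ.∸ k) ℕ.+ 0))
recipSum-sublinear A (suc c) k = ℚₚ.≤-trans
  (ℚₚ.≤-reflexive (ℚₚ.*-distribˡ-+ (fromℕ A) (1 ÷ suc k) (recipSum c (suc k))))
  (ℚₚ.≤-trans (ℚₚ.+-monoʳ-≤ (fromℕ A * (1 ÷ suc k)) (recipSum-sublinear A c (suc k))) (step (ℕₚ.≤-<-connex A k)))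
  where
  term : ∀ B → A ≤ℕ B ℕ.* suc k → fromℕ A * (1 ÷ suc k) ≤ fromℕ B
  term B A≤ = *-cancelˡ-≤ (fromℕ (suc k)) (0<fromℕ {suc k} (s≤s z≤n)) (subst₂ _≤_
    (sym (trans (solve 3 (λ s a q → s :* (a :* q) := a :* (s :* q)) refl (fromℕ (suc k)) (fromℕ A) (1 ÷ suc k))
      (trans (cong (fromℕ A *_) (fromℕ-÷ 1 (suc k) (s≤s z≤n))) (ℚₚ.*-identityʳ (fromℕ A)))))
    (trans (fromℕ-* B (suc k)) (ℚₚ.*-comm (fromℕ B) (fromℕ (suc k))))
    (fromℕ-mono-≤ A≤))
  finish : ∀ B → A ≤ℕ B ℕ.* suc k → B ℕ.+ (A ℕ.* (A ℕ.∸ suc k) ℕ.+ c) ≤ℕ A ℕ.* (A ℕ.∸ k) ℕ.+ suc c →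
    fromℕ A * (1 ÷ suc k) + fromℕ (A ℕ.* (A ℕ.∸ suc k) ℕ.+ c) ≤ fromℕ (A ℕ.* (A ℕ.∸ k) ℕ.+ suc c)
  finish B h₁ h₂ = ℚₚ.≤-trans (ℚₚ.+-monoˡ-≤ (fromℕ (A ℕ.* (A ℕ.∸ suc k) ℕ.+ c)) (term B h₁))
    (subst (_≤ fromℕ (A ℕ.* (A ℕ.∸ k) ℕ.+ suc c)) (fromℕ-+ B (A ℕ.* (A ℕ.∸ suc k) ℕ.+ c)) (fromℕ-mono-≤ h₂))
  step : A ≤ℕ k ⊎ k <ℕ A → fromℕ A * (1 ÷ suc k) + fromℕ (A ℕ.* (A ℕ.∸ suc k) ℕ.+ c) ≤ fromℕ (A ℕ.* (A ℕ.∸ k) ℕ.+ suc c)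
  step (inj₁ A≤k) = finish 1 (ℕₚ.≤-trans A≤k (ℕₚ.≤-trans (ℕₚ.n≤1+n k) (ℕₚ.m≤m+n (suc k) 0)))
    (ℕₚ.≤-trans (ℕₚ.≤-reflexive (sym (ℕₚ.+-suc (A ℕ.* (A ℕ.∸ suc k)) c)))
      (ℕₚ.+-monoˡ-≤ (suc c) (ℕₚ.*-monoʳ-≤ A (ℕₚ.∸-monoʳ-≤ A (ℕₚ.n≤1+n k)))))
  step (inj₂ k<A) = finish A (ℕₚ.m≤m*n A (suc k)) (begin
    A ℕ.+ (A ℕ.* (A ℕ.∸ suc k) ℕ.+ c)    ≡⟨ ℕₚ.+-assoc A _ c ⟨
    A ℕ.+ A ℕ.* (A ℕ.∸ suc k) ℕ.+ c      ≡⟨ cong (ℕ._+ c) (ℕₚ.*-suc A (A ℕ.∸ suc k)) ⟨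
    A ℕ.* suc (A ℕ.∸ suc k) ℕ.+ c        ≡⟨ cong (λ z → A ℕ.* z ℕ.+ c) (ℕₚ.+-∸-assoc 1 k<A) ⟨
    A ℕ.* (A ℕ.∸ k) ℕ.+ c                ≤⟨ ℕₚ.+-monoʳ-≤ (A ℕ.* (A ℕ.∸ k)) (ℕₚ.n≤1+n c) ⟩
    A ℕ.* (A ℕ.∸ k) ℕ.+ suc c            ∎)
    where open ℕₚ.≤-Reasoning

m*m≤n*n⇒m≤n : ∀ {a b} → a ℕ.* a ≤ℕ b ℕ.* b → a ≤ℕ b
m*m≤n*n⇒m≤n {a} {b} le = ^≤^⇒≤ {a} {b} 2 (s≤s z≤n)
  (subst₂ _≤ℕ_ (cong (a ℕ.*_) (sym (ℕₚ.*-identityʳ a))) (cong (b ℕ.*_) (sym (ℕₚ.*-identityʳ b))) le)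

-- The exponent k/n is cleared by raising to the power 2n: with X = C(n,k) k! D (1+κ)^k and
-- Y = k! T the claim follows from X^{2n} ≤ Y^{2n}.
module CutEstimate {n k l D T S κ : ℕ} {s h : ℚ} (1≤k : 1 ≤ℕ k) (k≤l : k ≤ℕ l) (k+l≡n : k ℕ.+ l ≡ n)
  (cut : (D ℕ.* D) ℕ.* (n ℕ.* n) ^ S ≤ℕ (T ℕ.* T) ℕ.* (k ℕ.* k ℕ.+ l ℕ.* l) ^ S)
  (ns≡S : fromℕ n * s ≡ fromℕ S) (n≼1 : n ≼ 1 exp (1ℚ + h))
  (gap : 1ℚ + h + fromℕ (6 ℕ.+ 2 ℕ.* κ) ≤ s) where

  private
    1≤n : 1 ≤ℕ n
    1≤n = ℕₚ.≤-trans 1≤k (ℕₚ.≤-trans (ℕₚ.m≤m+n k l) (ℕₚ.≤-reflexive k+l≡n))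
    1≤nn : 1 ≤ℕ n ℕ.* n
    1≤nn = ℕₚ.*-mono-≤ 1≤n 1≤n
    w = (2 ℕ.* (k ℕ.* l)) ÷ (n ℕ.* n)

    -- Since (k² + l²)/n² = 1 - w, the squared probability of no crossing is at most (1 - w)^S ≤
    -- e^(-wS).
    DD≼TT : D ℕ.* D ≼ T ℕ.* T exp (fromℕ S * (- w))
    DD≼TT = ≼-cancelʳ ((n ℕ.* n) ^ S) (ℕₚ.m^n>0 (n ℕ.* n) {{ℕ.>-nonZero 1≤nn}} S)
      (≼-≡ (ℚₚ.+-identityˡ (fromℕ S * (- w))) (≼-≤ˡ cut (≼-* (≤⇒≼ {T ℕ.* T} ℕₚ.≤-refl) (≼-^ S
        (≼-loss (k ℕ.* k ℕ.+ l ℕ.* l) (n ℕ.* n) (2 ℕ.* (k ℕ.* l)) 1≤nn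
          (trans (lem k l) (cong₂ ℕ._*_ k+l≡n k+l≡n)))))))
      where
      lem : ∀ k l → k ℕ.* k ℕ.+ l ℕ.* l ℕ.+ 2 ℕ.* (k ℕ.* l) ≡ (k ℕ.+ l) ℕ.* (k ℕ.+ l)
      lem = solve-∀

    a = n ^ (k ℕ.* k)
    b = n ^ (k ℕ.* l)
    P = suc κ ^ k
    c = n choose k
    qa = fromℕ (3 ℕ.* (n ℕ.* k))
    qb = fromℕ (k ℕ.* l) * (1ℚ + h)
    qP = fromℕ k * fromℕ κ

    a≼ : a ≼ (k !) ^ n exp qa
    a≼ = power≼factorial 1≤k (ℕₚ.≤-trans (ℕₚ.+-monoʳ-≤ k k≤l) (ℕₚ.≤-reflexive k+l≡n))
    b≼ : b ≼ 1 exp qb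
    b≼ = ≼-1^ (k ℕ.* l) n≼1
    P≼ : P ≼ 1 exp qP
    P≼ = ≼-1^ k (suc≼1 κ)

    -- The two powers are paid for differently: `a` by k! through `power≼factorial`, and `b`,
    -- bounded through n ≤ e^(1+h), by the loss in `DD≼TT`.
    n^kn : (n ^ k) ^ n ≡ a ℕ.* b
    n^kn = trans (ℕₚ.^-*-assoc n k n) (trans (cong (n ^_) (trans (cong (k ℕ.*_) (sym k+l≡n)) (ℕₚ.*-distribˡ-+ k k l)))
      (ℕₚ.^-distribˡ-+-* n (k ℕ.* k) (k ℕ.* l)))

    X Y : ℕ
    X = c ℕ.* k ! ℕ.* (D ℕ.* P)
    Y = k ! ℕ.* T

    ck!≤ : (c ℕ.* k !) ^ n ≤ℕ a ℕ.* b
    ck!≤ = ℕₚ.≤-trans (ℕₚ.^-monoˡ-≤ n (ℕₚ.≤-trans (ℕₚ.≤-reflexive (nCk*k!≡falling n k)) (falling≤^ n k))) (ℕₚ.≤-reflexive n^kn)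

    square^ : ∀ z → (z ^ n) ℕ.* (z ^ n) ≡ (z ℕ.* z) ^ n
    square^ z = sym (^-distribʳ-* n z z)

    XX : (X ℕ.* X) ^ n ≤ℕ ((a ℕ.* b) ℕ.* (a ℕ.* b)) ℕ.* ((D ℕ.* D) ^ n ℕ.* (P ^ n ℕ.* P ^ n))
    XX = begin
      (X ℕ.* X) ^ n                                            ≡⟨ square^ X ⟨
      X ^ n ℕ.* X ^ n                                          ≡⟨ cong (λ z → z ℕ.* z) (trans (^-distribʳ-* n (c ℕ.* k !) (D ℕ.* P))
                                                                    (cong ((c ℕ.* k !) ^ n ℕ.*_) (^-distribʳ-* n D P))) ⟩
      (E ℕ.* (D ^ n ℕ.* P ^ n)) ℕ.* (E ℕ.* (D ^ n ℕ.* P ^ n))  ≡⟨ lem E (D ^ n) (P ^ n) ⟩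
      (E ℕ.* E) ℕ.* ((D ^ n ℕ.* D ^ n) ℕ.* (P ^ n ℕ.* P ^ n))  ≤⟨ ℕₚ.*-monoˡ-≤ ((D ^ n ℕ.* D ^ n) ℕ.* (P ^ n ℕ.* P ^ n)) (ℕₚ.*-mono-≤ ck!≤ ck!≤) ⟩
      ((a ℕ.* b) ℕ.* (a ℕ.* b)) ℕ.* ((D ^ n ℕ.* D ^ n) ℕ.* (P ^ n ℕ.* P ^ n)) ≡⟨ cong (λ z → ((a ℕ.* b) ℕ.* (a ℕ.* b)) ℕ.* (z ℕ.* (P ^ n ℕ.* P ^ n))) (square^ D) ⟩
      ((a ℕ.* b) ℕ.* (a ℕ.* b)) ℕ.* ((D ℕ.* D) ^ n ℕ.* (P ^ n ℕ.* P ^ n)) ∎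
      where
      open ℕₚ.≤-Reasoning
      E = (c ℕ.* k !) ^ n
      lem : ∀ c d p → (c ℕ.* (d ℕ.* p)) ℕ.* (c ℕ.* (d ℕ.* p)) ≡ (c ℕ.* c) ℕ.* ((d ℕ.* d) ℕ.* (p ℕ.* p))
      lem = solve-∀

    YY : (((k !) ^ n ℕ.* 1) ℕ.* ((k !) ^ n ℕ.* 1)) ℕ.* ((T ℕ.* T) ^ n ℕ.* (1 ℕ.* 1)) ≡ (Y ℕ.* Y) ^ n
    YY = trans (lem ((k !) ^ n) ((T ℕ.* T) ^ n)) (trans (cong₂ ℕ._*_ (square^ (k !)) refl)
      (trans (sym (^-distribʳ-* n (k ! ℕ.* k !) (T ℕ.* T))) (cong (_^ n) (lem₂ (k !) T))))
      where
      lem : ∀ u t → ((u ℕ.* 1) ℕ.* (u ℕ.* 1)) ℕ.* (t ℕ.* (1 ℕ.* 1)) ≡ (u ℕ.* u) ℕ.* t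
      lem = solve-∀
      lem₂ : ∀ u t → (u ℕ.* u) ℕ.* (t ℕ.* t) ≡ (u ℕ.* t) ℕ.* (u ℕ.* t)
      lem₂ = solve-∀

    q = ((qa + qb) + (qa + qb)) + (fromℕ n * (fromℕ S * (- w)) + (fromℕ n * qP + fromℕ n * qP))

    -- With g = 6 + 2κ the exponent is g n k + 2kl(1 + h - s). The 6 is the 3 of `power≼factorial`
    -- and the 2κ is the κ of (1+κ)^k, both doubled by squaring. Since s ≥ 1 + h + g, the exponent
    -- is at most g k (n - 2l) = -g k (l - k), and k ≤ l.
    q≤0 : q ≤ 0ℚ
    q≤0 = ≤-by identity (0≤+
      (0≤* (0≤* (0≤fromℕ (6 ℕ.+ 2 ℕ.* κ)) (0≤fromℕ k)) 0≤e)
      (0≤* (0≤* (0≤fromℕ (2 ℕ.* k)) (0≤fromℕ l)) 0≤d))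
      where
      e = fromℕ l - fromℕ k
      d = s - (1ℚ + h + fromℕ (6 ℕ.+ 2 ℕ.* κ))
      0≤e : 0ℚ ≤ e
      0≤e = ≤⇒0≤- (fromℕ-mono-≤ k≤l)
      0≤d : 0ℚ ≤ d
      0≤d = ≤⇒0≤- gap
      nℚ≡ : fromℕ n ≡ fromℕ k + fromℕ l
      nℚ≡ = trans (cong fromℕ (sym k+l≡n)) (fromℕ-+ k l)
      loss : fromℕ n * (fromℕ S * (- w)) ≡ - (s * (fromℕ 2 * (fromℕ k * fromℕ l)))
      loss = begin
        fromℕ n * (fromℕ S * (- w))                 ≡⟨ cong (λ z → fromℕ n * (z * (- w))) (sym ns≡S) ⟩
        fromℕ n * (fromℕ n * s * (- w))             ≡⟨ solve 3 (λ n s w → n :* (n :* s :* (:- w)) := :- (s :* ((n :* n) :* w))) refl (fromℕ n) s w ⟩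
        - (s * (fromℕ n * fromℕ n * w))             ≡⟨ cong (λ z → - (s * (z * w))) (sym (fromℕ-* n n)) ⟩
        - (s * (fromℕ (n ℕ.* n) * w))               ≡⟨ cong (λ z → - (s * z)) (fromℕ-÷ (2 ℕ.* (k ℕ.* l)) (n ℕ.* n) 1≤nn) ⟩
        - (s * fromℕ (2 ℕ.* (k ℕ.* l)))             ≡⟨ cong (λ z → - (s * z)) (trans (fromℕ-* 2 (k ℕ.* l)) (cong (fromℕ 2 *_) (fromℕ-* k l))) ⟩
        - (s * (fromℕ 2 * (fromℕ k * fromℕ l)))     ∎
        where open ≡-Reasoning
      qa≡ : qa ≡ fromℕ 3 * ((fromℕ k + fromℕ l) * fromℕ k)
      qa≡ = trans (fromℕ-* 3 (n ℕ.* k)) (cong (fromℕ 3 *_) (trans (fromℕ-* n k) (cong (_* fromℕ k) nℚ≡)))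
      qb≡ : qb ≡ fromℕ k * fromℕ l * (1ℚ + h)
      qb≡ = cong (_* (1ℚ + h)) (fromℕ-* k l)
      κ≡ : fromℕ (6 ℕ.+ 2 ℕ.* κ) ≡ fromℕ 6 + fromℕ 2 * fromℕ κ
      κ≡ = trans (fromℕ-+ 6 (2 ℕ.* κ)) (cong (fromℕ 6 +_) (fromℕ-* 2 κ))
      identity : 0ℚ ≡ q + (fromℕ (6 ℕ.+ 2 ℕ.* κ) * fromℕ k * e + fromℕ (2 ℕ.* k) * fromℕ l * d)
      identity = sym (begin
        q + (fromℕ (6 ℕ.+ 2 ℕ.* κ) * fromℕ k * e + fromℕ (2 ℕ.* k) * fromℕ l * d)
          ≡⟨ cong₂ _+_ (cong₂ _+_ (cong₂ (λ x y → (x + y) + (x + y)) qa≡ qb≡) (cong₂ _+_ loss (cong (λ z → z * qP + z * qP) nℚ≡)))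
               (cong₂ (λ x y → x * fromℕ k * e + y * fromℕ l * (s - (1ℚ + h + x))) κ≡ (fromℕ-* 2 k)) ⟩
        _ ≡⟨ solve 5 (λ k l κ s h →
               let t = con (fromℕ 3) :* ((k :+ l) :* k)
                   b = k :* l :* (con 1ℚ :+ h)
                   g = con (fromℕ 6) :+ con (fromℕ 2) :* κ
               in ((t :+ b) :+ (t :+ b)) :+ (:- (s :* (con (fromℕ 2) :* (k :* l))) :+ ((k :+ l) :* (k :* κ) :+ (k :+ l) :* (k :* κ)))
                   :+ (g :* k :* (l :- k) :+ con (fromℕ 2) :* k :* l :* (s :- (con 1ℚ :+ h :+ g)))
                   := con 0ℚ)
               refl (fromℕ k) (fromℕ l) (fromℕ κ) s h ⟩
        0ℚ ∎)
        where open ≡-Reasoning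

    powers : (X ℕ.* X) ^ n ≤ℕ (Y ℕ.* Y) ^ n
    powers = ≼⇒≤ q≤0 (≼-≤ʳ (≼-≤ˡ XX
      (≼-* (≼-* (≼-* a≼ b≼) (≼-* a≼ b≼)) (≼-* (≼-^ n DD≼TT) (≼-* (≼-1^ n P≼) (≼-1^ n P≼))))) (ℕₚ.≤-reflexive YY))

  cut-bound : (n choose k) ℕ.* D ℕ.* suc κ ^ k ≤ℕ T
  cut-bound = *-cancelʳ-≤′ (k !) (1≤k! k) (subst₂ _≤ℕ_ (lem c (k !) D P) (ℕₚ.*-comm (k !) T)
    (m*m≤n*n⇒m≤n (^≤^⇒≤ n 1≤n powers)))
    where
    lem : ∀ c f d p → c ℕ.* f ℕ.* (d ℕ.* p) ≡ c ℕ.* d ℕ.* p ℕ.* f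
    lem = solve-∀

-- Chebyshev's inequality

𝟙≤1 : ∀ {P : Set} (d : Dec P) → 𝟙 d ≤ℕ 1
𝟙≤1 (yes _) = ℕₚ.≤-refl
𝟙≤1 (no _)  = z≤n

∑-mono : ∀ {n} (f g : Fin n → ℕ) → (∀ x → f x ≤ℕ g x) → ∑ f ≤ℕ ∑ g
∑-mono {zero}  f g le = z≤n
∑-mono {suc n} f g le = ℕₚ.+-mono-≤ (le zero) (∑-mono (f ∘ suc) (g ∘ suc) (le ∘ suc))

∑-*ˡ : ∀ {n} c (f : Fin n → ℕ) → ∑ (λ x → c ℕ.* f x) ≡ c ℕ.* ∑ f
∑-*ˡ c f = sym (∑.*-distribˡ-sum c f)

∑-const : ∀ n c → ∑ {n} (λ _ → c) ≡ n ℕ.* c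
∑-const zero    c = refl
∑-const (suc n) c = cong (c ℕ.+_) (∑-const n c)

∑-0 : ∀ {n} (f : Fin n → ℕ) → (∀ x → f x ≡ 0) → ∑ f ≡ 0
∑-0 {n} f eq = trans (∑.sum-cong-≗ {n} eq) (trans (∑-const n 0) (ℕₚ.*-zeroʳ n))

-- Second-moment method in counts. With T = length xs and E = n a, the number X of indices i with
-- `I i h` has mean E/T. By `second` the covariances off the diagonal are nonpositive and each
-- indicator has variance at most a/T, so X has variance at most its mean. Objects satisfying `Z`
-- have X = 0, which has probability at most T/E.
module Chebyshev {A : Set} (xs : List A) {n : ℕ} {I : Fin n → A → Set} (I? : ∀ i → Decidable (I i))
  {Z : A → Set} (Z? : Decidable Z) (Z⇒¬I : ∀ {h} → Z h → ∀ i → ¬ I i h)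
  (a : ℕ) (first : ∀ i → sumBy (λ h → 𝟙 (I? i h)) xs ≡ a)
  (second : ∀ i j → length xs ℕ.* sumBy (λ h → 𝟙 (I? i h) ℕ.* 𝟙 (I? j h)) xs ≤ℕ 𝟙 (i Finₚ.≟ j) ℕ.* (length xs ℕ.* a) ℕ.+ a ℕ.* a)
  where

  private
    T = length xs
    E = n ℕ.* a
    X : A → ℕ
    X h = ∑ (λ i → 𝟙 (I? i h))
    z = sumBy (λ h → 𝟙 (Z? h)) xs

    ∑X : sumBy X xs ≡ E
    ∑X = trans (sym (∑-sumBy-swap (λ i h → 𝟙 (I? i h)) xs)) (trans (∑.sum-cong-≗ {n} first) (∑-const n a))

    X² : ∀ h → X h ℕ.* X h ≡ ∑ (λ i → ∑ (λ j → 𝟙 (I? i h) ℕ.* 𝟙 (I? j h)))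
    X² h = trans (sym (∑-*ˡ (X h) (λ i → 𝟙 (I? i h)))) (∑.sum-cong-≗ {n} (λ i → trans (ℕₚ.*-comm (X h) (𝟙 (I? i h)))
      (sym (∑-*ˡ (𝟙 (I? i h)) (λ j → 𝟙 (I? j h))))))

    ∑X² : T ℕ.* sumBy (λ h → X h ℕ.* X h) xs ≤ℕ T ℕ.* E ℕ.+ E ℕ.* E
    ∑X² = begin
      T ℕ.* sumBy (λ h → X h ℕ.* X h) xs
        ≡⟨ cong (T ℕ.*_) (trans (sumBy-cong X² xs)
             (trans (sym (∑-sumBy-swap (λ i h → ∑ (λ j → 𝟙 (I? i h) ℕ.* 𝟙 (I? j h))) xs))
               (∑.sum-cong-≗ {n} (λ i → sym (∑-sumBy-swap (λ j h → 𝟙 (I? i h) ℕ.* 𝟙 (I? j h)) xs))))) ⟩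
      T ℕ.* ∑ (λ i → ∑ (λ j → pair i j))
        ≡⟨ trans (sym (∑-*ˡ T (λ i → ∑ (pair i)))) (∑.sum-cong-≗ {n} (λ i → sym (∑-*ˡ T (pair i)))) ⟩
      ∑ (λ i → ∑ (λ j → T ℕ.* pair i j))
        ≤⟨ ∑-mono {n} (λ i → ∑ {n} (λ j → T ℕ.* pair i j)) (λ i → ∑ {n} (λ j → 𝟙 (i Finₚ.≟ j) ℕ.* (T ℕ.* a) ℕ.+ a ℕ.* a))
             (λ i → ∑-mono {n} (λ j → T ℕ.* pair i j) (λ j → 𝟙 (i Finₚ.≟ j) ℕ.* (T ℕ.* a) ℕ.+ a ℕ.* a) (second i)) ⟩
      ∑ {n} (λ i → ∑ {n} (λ j → 𝟙 (i Finₚ.≟ j) ℕ.* (T ℕ.* a) ℕ.+ a ℕ.* a))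
        ≡⟨ ∑.sum-cong-≗ {n} row ⟩
      ∑ {n} (λ i → T ℕ.* a ℕ.+ n ℕ.* (a ℕ.* a))
        ≡⟨ ∑-const n (T ℕ.* a ℕ.+ n ℕ.* (a ℕ.* a)) ⟩
      n ℕ.* (T ℕ.* a ℕ.+ n ℕ.* (a ℕ.* a))
        ≡⟨ lem n T a ⟩
      T ℕ.* E ℕ.+ E ℕ.* E ∎
      where
      open ℕₚ.≤-Reasoning
      pair : Fin n → Fin n → ℕ
      pair i j = sumBy (λ h → 𝟙 (I? i h) ℕ.* 𝟙 (I? j h)) xs
      lem : ∀ n T a → n ℕ.* (T ℕ.* a ℕ.+ n ℕ.* (a ℕ.* a)) ≡ T ℕ.* (n ℕ.* a) ℕ.+ (n ℕ.* a) ℕ.* (n ℕ.* a)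
      lem = solve-∀
      row : ∀ i → ∑ (λ j → 𝟙 (i Finₚ.≟ j) ℕ.* (T ℕ.* a) ℕ.+ a ℕ.* a) ≡ T ℕ.* a ℕ.+ n ℕ.* (a ℕ.* a)
      row i = trans (∑.∑-distrib-+ (λ j → 𝟙 (i Finₚ.≟ j) ℕ.* (T ℕ.* a)) (λ _ → a ℕ.* a)) (cong₂ ℕ._+_
        (trans (∑.sum-cong-≗ {n} (λ j → ℕₚ.*-comm (𝟙 (i Finₚ.≟ j)) (T ℕ.* a)))
          (trans (∑-*ˡ (T ℕ.* a) (λ j → 𝟙 (i Finₚ.≟ j))) (trans (cong (T ℕ.* a ℕ.*_) (∑-𝟙≡ i)) (ℕₚ.*-identityʳ (T ℕ.* a)))))
        (∑-const n (a ℕ.* a)))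

    -- (T X - E)² ≥ 0, improved to ≥ E² where X vanishes, with both sides moved so that no
    -- subtraction occurs.
    pointwise : ∀ h → 2 ℕ.* T ℕ.* E ℕ.* X h ℕ.+ E ℕ.* E ℕ.* 𝟙 (Z? h) ≤ℕ T ℕ.* T ℕ.* (X h ℕ.* X h) ℕ.+ E ℕ.* E ℕ.* 1
    pointwise h = case (Z? h)
      where
      open ℕₚ.≤-Reasoning
      lem : ∀ T E X → 2 ℕ.* ((T ℕ.* X) ℕ.* E) ≡ 2 ℕ.* T ℕ.* E ℕ.* X
      lem = solve-∀
      lem₂ : ∀ T E X → (T ℕ.* X) ℕ.* (T ℕ.* X) ℕ.+ E ℕ.* E ≡ T ℕ.* T ℕ.* (X ℕ.* X) ℕ.+ E ℕ.* E ℕ.* 1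
      lem₂ = solve-∀
      case : Dec (Z h) → 2 ℕ.* T ℕ.* E ℕ.* X h ℕ.+ E ℕ.* E ℕ.* 𝟙 (Z? h) ≤ℕ T ℕ.* T ℕ.* (X h ℕ.* X h) ℕ.+ E ℕ.* E ℕ.* 1
      case (yes zh) = begin
        2 ℕ.* T ℕ.* E ℕ.* X h ℕ.+ E ℕ.* E ℕ.* 𝟙 (Z? h)   ≡⟨ cong (λ w → 2 ℕ.* T ℕ.* E ℕ.* w ℕ.+ E ℕ.* E ℕ.* 𝟙 (Z? h))
                                                           (∑-0 (λ i → 𝟙 (I? i h)) (λ i → 𝟙-false (I? i h) (Z⇒¬I zh i))) ⟩
        2 ℕ.* T ℕ.* E ℕ.* 0 ℕ.+ E ℕ.* E ℕ.* 𝟙 (Z? h)     ≡⟨ cong (ℕ._+ E ℕ.* E ℕ.* 𝟙 (Z? h)) (ℕₚ.*-zeroʳ (2 ℕ.* T ℕ.* E)) ⟩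
        E ℕ.* E ℕ.* 𝟙 (Z? h)                             ≤⟨ ℕₚ.*-monoʳ-≤ (E ℕ.* E) (𝟙≤1 (Z? h)) ⟩
        E ℕ.* E ℕ.* 1                                    ≤⟨ ℕₚ.m≤n+m _ _ ⟩
        T ℕ.* T ℕ.* (X h ℕ.* X h) ℕ.+ E ℕ.* E ℕ.* 1      ∎
      case (no ¬zh) = begin
        2 ℕ.* T ℕ.* E ℕ.* X h ℕ.+ E ℕ.* E ℕ.* 𝟙 (Z? h)   ≡⟨ cong (λ w → 2 ℕ.* T ℕ.* E ℕ.* X h ℕ.+ E ℕ.* E ℕ.* w) (𝟙-false (Z? h) ¬zh) ⟩
        2 ℕ.* T ℕ.* E ℕ.* X h ℕ.+ E ℕ.* E ℕ.* 0          ≡⟨ trans (cong (2 ℕ.* T ℕ.* E ℕ.* X h ℕ.+_) (ℕₚ.*-zeroʳ (E ℕ.* E))) (ℕₚ.+-identityʳ _) ⟩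
        2 ℕ.* T ℕ.* E ℕ.* X h                            ≡⟨ lem T E (X h) ⟨
        2 ℕ.* ((T ℕ.* X h) ℕ.* E)                        ≤⟨ 2ab≤a²+b² (T ℕ.* X h) E ⟩
        (T ℕ.* X h) ℕ.* (T ℕ.* X h) ℕ.+ E ℕ.* E          ≡⟨ lem₂ T E (X h) ⟩
        T ℕ.* T ℕ.* (X h ℕ.* X h) ℕ.+ E ℕ.* E ℕ.* 1      ∎

    sum-linear : ∀ b c (v w : A → ℕ) → sumBy (λ h → b ℕ.* v h ℕ.+ c ℕ.* w h) xs ≡ b ℕ.* sumBy v xs ℕ.+ c ℕ.* sumBy w xs
    sum-linear b c v w = trans (sumBy-+ (λ h → b ℕ.* v h) (λ h → c ℕ.* w h) xs) (cong₂ ℕ._+_ (sumBy-*ˡ b v xs) (sumBy-*ˡ c w xs))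

    summed : 2 ℕ.* T ℕ.* E ℕ.* E ℕ.+ E ℕ.* E ℕ.* z ≤ℕ T ℕ.* (T ℕ.* E ℕ.+ E ℕ.* E) ℕ.+ E ℕ.* E ℕ.* T
    summed = begin
      2 ℕ.* T ℕ.* E ℕ.* E ℕ.+ E ℕ.* E ℕ.* z
        ≡⟨ cong (λ w → 2 ℕ.* T ℕ.* E ℕ.* w ℕ.+ E ℕ.* E ℕ.* z) ∑X ⟨
      2 ℕ.* T ℕ.* E ℕ.* sumBy X xs ℕ.+ E ℕ.* E ℕ.* z
        ≡⟨ sum-linear (2 ℕ.* T ℕ.* E) (E ℕ.* E) X (λ h → 𝟙 (Z? h)) ⟨
      sumBy (λ h → 2 ℕ.* T ℕ.* E ℕ.* X h ℕ.+ E ℕ.* E ℕ.* 𝟙 (Z? h)) xs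
        ≤⟨ sumBy-mono pointwise xs ⟩
      sumBy (λ h → T ℕ.* T ℕ.* (X h ℕ.* X h) ℕ.+ E ℕ.* E ℕ.* 1) xs
        ≡⟨ sum-linear (T ℕ.* T) (E ℕ.* E) (λ h → X h ℕ.* X h) (λ _ → 1) ⟩
      T ℕ.* T ℕ.* sumBy (λ h → X h ℕ.* X h) xs ℕ.+ E ℕ.* E ℕ.* sumBy (λ _ → 1) xs
        ≡⟨ cong₂ ℕ._+_ (ℕₚ.*-assoc T T _) (cong (E ℕ.* E ℕ.*_) (sym (length≡sumBy xs))) ⟩
      T ℕ.* (T ℕ.* sumBy (λ h → X h ℕ.* X h) xs) ℕ.+ E ℕ.* E ℕ.* T
        ≤⟨ ℕₚ.+-monoˡ-≤ (E ℕ.* E ℕ.* T) (ℕₚ.*-monoʳ-≤ T ∑X²) ⟩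
      T ℕ.* (T ℕ.* E ℕ.+ E ℕ.* E) ℕ.+ E ℕ.* E ℕ.* T ∎
      where open ℕₚ.≤-Reasoning

  chebyshev : 1 ≤ℕ n ℕ.* a → z ℕ.* (n ℕ.* a) ≤ℕ T ℕ.* T
  chebyshev 1≤E = *-cancelʳ-≤′ E 1≤E (ℕₚ.+-cancelˡ-≤ (2 ℕ.* T ℕ.* E ℕ.* E) _ _
    (subst₂ _≤ℕ_ (lem T E z) (lem₂ T E) summed))
    where
    lem : ∀ T E z → 2 ℕ.* T ℕ.* E ℕ.* E ℕ.+ E ℕ.* E ℕ.* z ≡ 2 ℕ.* T ℕ.* E ℕ.* E ℕ.+ z ℕ.* E ℕ.* E
    lem = solve-∀
    lem₂ : ∀ T E → T ℕ.* (T ℕ.* E ℕ.+ E ℕ.* E) ℕ.+ E ℕ.* E ℕ.* T ≡ 2 ℕ.* T ℕ.* E ℕ.* E ℕ.+ T ℕ.* T ℕ.* E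
    lem₂ = solve-∀

-- The series of (1+κ)^(-k) over k ≥ 1 sums to 1/κ. Multiplying the tail by 1 + κ restores the
-- hypothesis with one index less.
geometric : ∀ {n} κ T (G : Fin n → ℕ) → (∀ x → G x ℕ.* suc κ ^ size x ≤ℕ T) → κ ℕ.* ∑ G ≤ℕ T
geometric {zero}  κ T G h = subst (_≤ℕ T) (sym (ℕₚ.*-zeroʳ κ)) z≤n
geometric {suc n} κ T G h = ℕₚ.*-cancelˡ-≤ (suc κ) (begin
  suc κ ℕ.* (κ ℕ.* (G zero ℕ.+ ∑ (G ∘ suc)))                 ≡⟨ lem κ (G zero) (∑ (G ∘ suc)) ⟩
  κ ℕ.* (G zero ℕ.* (suc κ ℕ.* 1)) ℕ.+ κ ℕ.* (suc κ ℕ.* ∑ (G ∘ suc))   ≤⟨ ℕₚ.+-mono-≤ (ℕₚ.*-monoʳ-≤ κ (h zero)) tail ⟩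
  κ ℕ.* T ℕ.+ T                                              ≡⟨ ℕₚ.+-comm (κ ℕ.* T) T ⟩
  suc κ ℕ.* T                                                ∎)
  where
  open ℕₚ.≤-Reasoning
  lem : ∀ κ g s → suc κ ℕ.* (κ ℕ.* (g ℕ.+ s)) ≡ κ ℕ.* (g ℕ.* (suc κ ℕ.* 1)) ℕ.+ κ ℕ.* (suc κ ℕ.* s)
  lem = solve-∀
  lem₂ : ∀ k g p → k ℕ.* g ℕ.* p ≡ g ℕ.* (k ℕ.* p)
  lem₂ = solve-∀
  tail : κ ℕ.* (suc κ ℕ.* ∑ (G ∘ suc)) ≤ℕ T
  tail = subst (λ s → κ ℕ.* s ≤ℕ T) (∑-*ˡ (suc κ) (G ∘ suc))
    (geometric κ T (λ x → suc κ ℕ.* G (suc x)) (λ x → ℕₚ.≤-trans (ℕₚ.≤-reflexive (lem₂ (suc κ) (G (suc x)) (suc κ ^ size x))) (h (suc x))))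

1≤falling : ∀ {n} k → k ≤ℕ n → 1 ≤ℕ falling n k
1≤falling zero    _   = ℕₚ.≤-refl
1≤falling (suc k) k<n = ℕₚ.*-mono-≤ (1≤falling k (ℕₚ.<⇒≤ k<n)) (ℕₚ.m<n⇒0<n∸m k<n)

1≤C : ∀ {n} k → k ≤ℕ n → 1 ≤ℕ n choose k
1≤C {n} k k≤n = pos (n choose k) (subst (1 ≤ℕ_) (sym (nCk*k!≡falling n k)) (1≤falling k k≤n))
  where
  pos : ∀ c → 1 ≤ℕ c ℕ.* k ! → 1 ≤ℕ c
  pos (suc c) _ = s≤s z≤n

∑-size≡ : ∀ {n} k → 1 ≤ℕ k → k ≤ℕ n → ∑ {n} (λ x → 𝟙 (k ℕ.≟ size x)) ≡ 1
∑-size≡ {n} (suc k) _ k<n = trans (∑.sum-cong-≗ {n} (λ x → 𝟙-cong (suc k ℕ.≟ size x) (fromℕ< k<n Finₚ.≟ x)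
    (λ eq → Finₚ.toℕ-injective (trans (Finₚ.toℕ-fromℕ< k<n) (ℕₚ.suc-injective eq)))
    (λ { refl → cong suc (sym (Finₚ.toℕ-fromℕ< k<n)) })))
  (∑-𝟙≡ (fromℕ< k<n))

count-ofSize : ∀ n k → sumBy (λ V → 𝟙 (∣ V ∣ ℕ.≟ k)) (subsets n) ≡ n choose k
count-ofSize n k = trans (sumBy-cong (λ V → trans (sym (ℕₚ.+-identityʳ _)) (cong (ℕ._* 𝟙 (∣ V ∣ ℕ.≟ k)) (sym (𝟙-true (V Subₚ.⊆? ⊤) Subₚ.⊆⊤)))) (subsets n))
  (trans (count-subsets (⊤ {n}) k) (cong (_choose k) (Subₚ.∣⊤∣≡n n)))

-- The C(n,k) subsets of size k together contribute at most T (1+κ)^(-k), and `geometric` adds up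
-- the sizes. `supp` discards the empty set, whose size 0 is not `size x` for any x.
sum-subsets : ∀ n κ T (g : Subset n → ℕ) → (∀ V → 1 ≤ℕ g V → 1 ≤ℕ ∣ V ∣) →
  (∀ V → (n choose ∣ V ∣) ℕ.* g V ℕ.* suc κ ^ ∣ V ∣ ≤ℕ T) → κ ℕ.* sumBy g (subsets n) ≤ℕ T
sum-subsets n κ T g supp bound = subst (λ s → κ ℕ.* s ≤ℕ T) (sym grouped) (geometric κ T G layer)
  where
  w : Fin n → Subset n → ℕ
  w x V = 𝟙 (∣ V ∣ ℕ.≟ size x) ℕ.* g V
  G : Fin n → ℕ
  G x = sumBy (w x) (subsets n)
  spread : ∀ V → g V ≡ ∑ {n} (λ x → w x V)
  spread V = sym (trans (∑.sum-cong-≗ {n} (λ x → ℕₚ.*-comm (𝟙 (∣ V ∣ ℕ.≟ size x)) (g V)))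
    (trans (∑-*ˡ {n} (g V) (λ x → 𝟙 (∣ V ∣ ℕ.≟ size x))) (go (g V) (supp V))))
    where
    go : ∀ c → (1 ≤ℕ c → 1 ≤ℕ ∣ V ∣) → c ℕ.* ∑ {n} (λ x → 𝟙 (∣ V ∣ ℕ.≟ size x)) ≡ c
    go zero    _ = refl
    go (suc c) h = trans (cong (suc c ℕ.*_) (∑-size≡ ∣ V ∣ (h (s≤s z≤n)) (Subₚ.∣p∣≤n V))) (ℕₚ.*-identityʳ (suc c))
  grouped : sumBy g (subsets n) ≡ ∑ G
  grouped = trans (sumBy-cong spread (subsets n)) (sym (∑-sumBy-swap w (subsets n)))
  layer : ∀ x → G x ℕ.* suc κ ^ size x ≤ℕ T
  layer x = *-cancelʳ-≤′ (n choose k) (1≤C k (Finₚ.toℕ<n x)) (begin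
    G x ℕ.* suc κ ^ k ℕ.* (n choose k)                            ≡⟨ lem (G x) (suc κ ^ k) (n choose k) ⟩
    ((n choose k) ℕ.* suc κ ^ k) ℕ.* G x                          ≡⟨ sumBy-*ˡ ((n choose k) ℕ.* suc κ ^ k) (w x) (subsets n) ⟨
    sumBy (λ V → ((n choose k) ℕ.* suc κ ^ k) ℕ.* w x V) (subsets n)   ≤⟨ sumBy-mono each (subsets n) ⟩
    sumBy (λ V → T ℕ.* 𝟙 (∣ V ∣ ℕ.≟ k)) (subsets n)          ≡⟨ sumBy-*ˡ T (λ V → 𝟙 (∣ V ∣ ℕ.≟ k)) (subsets n) ⟩
    T ℕ.* sumBy (λ V → 𝟙 (∣ V ∣ ℕ.≟ k)) (subsets n)          ≡⟨ cong (T ℕ.*_) (count-ofSize n k) ⟩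
    T ℕ.* (n choose k)                                            ∎)
    where
    open ℕₚ.≤-Reasoning
    k = size x
    lem : ∀ g p c → g ℕ.* p ℕ.* c ≡ (c ℕ.* p) ℕ.* g
    lem = solve-∀
    lem₂ : ∀ c p g → (c ℕ.* p) ℕ.* (1 ℕ.* g) ≡ c ℕ.* g ℕ.* p
    lem₂ = solve-∀
    each : ∀ V → ((n choose k) ℕ.* suc κ ^ k) ℕ.* w x V ≤ℕ T ℕ.* 𝟙 (∣ V ∣ ℕ.≟ k)
    each V = case (∣ V ∣ ℕ.≟ k)
      where
      case : Dec (∣ V ∣ ≡ k) → ((n choose k) ℕ.* suc κ ^ k) ℕ.* w x V ≤ℕ T ℕ.* 𝟙 (∣ V ∣ ℕ.≟ k)
      case (yes eq) = begin
        ((n choose k) ℕ.* suc κ ^ k) ℕ.* (𝟙 (∣ V ∣ ℕ.≟ k) ℕ.* g V)    ≡⟨ cong (λ i → ((n choose k) ℕ.* suc κ ^ k) ℕ.* (i ℕ.* g V)) (𝟙-true (∣ V ∣ ℕ.≟ k) eq) ⟩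
        ((n choose k) ℕ.* suc κ ^ k) ℕ.* (1 ℕ.* g V)                  ≡⟨ lem₂ (n choose k) (suc κ ^ k) (g V) ⟩
        (n choose k) ℕ.* g V ℕ.* suc κ ^ k                            ≡⟨ cong (λ j → (n choose j) ℕ.* g V ℕ.* suc κ ^ j) (sym eq) ⟩
        (n choose ∣ V ∣) ℕ.* g V ℕ.* suc κ ^ ∣ V ∣                    ≤⟨ bound V ⟩
        T                                                        ≡⟨ ℕₚ.*-identityʳ T ⟨
        T ℕ.* 1                                                  ≡⟨ cong (T ℕ.*_) (𝟙-true (∣ V ∣ ℕ.≟ k) eq) ⟨
        T ℕ.* 𝟙 (∣ V ∣ ℕ.≟ k)                                    ∎
      case (no ¬eq) = begin
        ((n choose k) ℕ.* suc κ ^ k) ℕ.* (𝟙 (∣ V ∣ ℕ.≟ k) ℕ.* g V)    ≡⟨ cong (λ i → ((n choose k) ℕ.* suc κ ^ k) ℕ.* (i ℕ.* g V)) (𝟙-false (∣ V ∣ ℕ.≟ k) ¬eq) ⟩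
        ((n choose k) ℕ.* suc κ ^ k) ℕ.* 0                            ≡⟨ ℕₚ.*-zeroʳ ((n choose k) ℕ.* suc κ ^ k) ⟩
        0                                                        ≤⟨ z≤n ⟩
        T ℕ.* 𝟙 (∣ V ∣ ℕ.≟ k)                                    ∎

∏-* : ∀ {n} (f g : Fin n → ℕ) → ∏ (λ x → f x ℕ.* g x) ≡ ∏ f ℕ.* ∏ g
∏-* f g = ∏.∑-distrib-+ f g

∏-^ : ∀ {n} c (e : Fin n → ℕ) → ∏ (λ x → c ^ e x) ≡ c ^ ∑ e
∏-^ {zero}  c e = refl
∏-^ {suc n} c e = trans (cong (c ^ e zero ℕ.*_) (∏-^ c (e ∘ suc))) (sym (ℕₚ.^-distribˡ-+-* c (e zero) (∑ (e ∘ suc))))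

Any⇒1≤sumBy : ∀ {A : Set} {R : A → Set} (R? : Decidable R) {xs} → Any R xs → 1 ≤ℕ sumBy (λ x → 𝟙 (R? x)) xs
Any⇒1≤sumBy R? {x ∷ xs} (here r)  = ℕₚ.≤-trans (ℕₚ.≤-reflexive (sym (𝟙-true (R? x) r))) (ℕₚ.m≤m+n _ _)
Any⇒1≤sumBy R? {x ∷ xs} (there a) = ℕₚ.≤-trans (Any⇒1≤sumBy R? a) (ℕₚ.m≤n+m _ (𝟙 (R? x)))

-- Cuts and isolated nodes of a hypergraph.

Within : ∀ {n} → Subset n → Subset n → Set
Within V e = e ⊆ₛ V ⊎ e ⊆ₛ ∁ V

within? : ∀ {n} (V : Subset n) → Decidable (Within V)
within? V e = (e Subₚ.⊆? V) ⊎-dec (e Subₚ.⊆? ∁ V)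

Light : ∀ {n} → Subset n → Set
Light {n} V = 1 ≤ℕ ∣ V ∣ × ∣ V ∣ ℕ.+ ∣ V ∣ ≤ℕ n

light? : ∀ {n} → Decidable (Light {n})
light? {n} V = (1 ℕ.≤? ∣ V ∣) ×-dec (∣ V ∣ ℕ.+ ∣ V ∣ ℕ.≤? n)

∣p∣+∣∁p∣≡n : ∀ {n} (p : Subset n) → ∣ p ∣ ℕ.+ ∣ ∁ p ∣ ≡ n
∣p∣+∣∁p∣≡n {n} p = trans (cong (∣ p ∣ ℕ.+_) (Subₚ.∣∁p∣≡n∸∣p∣ p)) (ℕₚ.m+[n∸m]≡n (Subₚ.∣p∣≤n p))

-- The smaller side of a separating partition is a light set.
separated : ∀ {n} (h : Hypergraph n) → ¬ Connected h → Any (λ V → Light V × All (Within V) (edges h)) (subsets n)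
separated {n} h ¬conn with any? (λ V → light? V ×-dec all? (within? V) (edges h)) (subsets n)
... | yes found = found
... | no none = contradiction conn ¬conn
  where
  absent : ∀ V → Light V → ¬ All (Within V) (edges h)
  absent V light all = none (lose (∈-subsets V) (light , all))
  conn : Connected h
  conn V₁ V₂ (ne₁ , ne₂ , disjoint , cover)
    with any? (λ e → Subₚ.nonempty? (e ∩ V₁) ×-dec Subₚ.nonempty? (e ∩ V₂)) (edges h)
  ... | yes crossing = crossing
  ... | no ¬crossing = ⊥-elim impossible
    where
    either : ∀ {x} → x ∈ₛ V₁ ⊎ x ∈ₛ V₂
    either {x} = Subₚ.x∈p∪q⁻ V₁ V₂ (subst (x ∈ₛ_) (sym cover) Subₚ.∈⊤)
    sides : ∀ e → ¬ (Nonempty (e ∩ V₁) × Nonempty (e ∩ V₂)) → e ⊆ₛ V₁ ⊎ e ⊆ₛ V₂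
    sides e ¬both with Subₚ.nonempty? (e ∩ V₁)
    ... | no ¬e₁ = inj₂ λ x∈e → [ (λ x∈V₁ → contradiction (_ , Subₚ.x∈p∩q⁺ (x∈e , x∈V₁)) ¬e₁) , (λ x∈V₂ → x∈V₂) ]′ either
    ... | yes e₁ = inj₁ λ x∈e → [ (λ x∈V₁ → x∈V₁) , (λ x∈V₂ → contradiction (e₁ , (_ , Subₚ.x∈p∩q⁺ (x∈e , x∈V₂))) ¬both) ]′ either
    V₁⊆ : V₁ ⊆ₛ ∁ V₂
    V₁⊆ x∈V₁ = Subₚ.x∉p⇒x∈∁p λ x∈V₂ → disjoint (_ , Subₚ.x∈p∩q⁺ (x∈V₁ , x∈V₂))
    V₂⊆ : V₂ ⊆ₛ ∁ V₁
    V₂⊆ x∈V₂ = Subₚ.x∉p⇒x∈∁p λ x∈V₁ → disjoint (_ , Subₚ.x∈p∩q⁺ (x∈V₁ , x∈V₂))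
    all-sides : All (λ e → e ⊆ₛ V₁ ⊎ e ⊆ₛ V₂) (edges h)
    all-sides = All.map (λ {e} → sides e) (Allₚ.¬Any⇒All¬ (edges h) ¬crossing)
    within₁ : ∀ e → e ⊆ₛ V₁ ⊎ e ⊆ₛ V₂ → Within V₁ e
    within₁ e (inj₁ sub) = inj₁ sub
    within₁ e (inj₂ sub) = inj₂ λ x∈e → V₂⊆ (sub x∈e)
    within₂ : ∀ e → e ⊆ₛ V₁ ⊎ e ⊆ₛ V₂ → Within V₂ e
    within₂ e (inj₁ sub) = inj₂ λ x∈e → V₁⊆ (sub x∈e)
    within₂ e (inj₂ sub) = inj₁ sub
    sum≤n : ∣ V₁ ∣ ℕ.+ ∣ V₂ ∣ ≤ℕ n
    sum≤n = ℕₚ.≤-trans (ℕₚ.+-monoʳ-≤ ∣ V₁ ∣ (Subₚ.p⊆q⇒∣p∣≤∣q∣ V₂⊆)) (ℕₚ.≤-reflexive (∣p∣+∣∁p∣≡n V₁))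
    impossible : ⊥
    impossible with ℕₚ.≤-total ∣ V₁ ∣ ∣ V₂ ∣
    ... | inj₁ le = absent V₁ (nonempty⇒0<∣∣ ne₁ , ℕₚ.≤-trans (ℕₚ.+-monoʳ-≤ ∣ V₁ ∣ le) sum≤n)
      (All.map (λ {e} → within₁ e) all-sides)
    ... | inj₂ ge = absent V₂ (nonempty⇒0<∣∣ ne₂ , ℕₚ.≤-trans (ℕₚ.+-monoˡ-≤ ∣ V₂ ∣ ge) sum≤n)
      (All.map (λ {e} → within₂ e) all-sides)

-- i is isolated in h iff All (Lone i) (edges h).
Lone : ∀ {n} → Fin n → Subset n → Set
Lone i e = ∣ e ∣ ≡ 1 ⊎ i ∉ₛ e

lone? : ∀ {n} (i : Fin n) → Decidable (Lone i)
lone? i e = (∣ e ∣ ℕ.≟ 1) ⊎-dec ¬? (i Subₚ.∈? e)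

-- The partition of {i} against the rest, which is nonempty as n ≥ 2, needs an edge through i and
-- another node. Such an edge has at least two elements and contains i, contrary to `Lone`.
connected⇒¬lone : ∀ {n} → 2 ≤ℕ n → {h : Hypergraph n} → Connected h → ∀ i → ¬ All (Lone i) (edges h)
connected⇒¬lone {n} 2≤n {h} conn i lone with conn ⁅ i ⁆ (∁ ⁅ i ⁆)
    ((i , Subₚ.x∈⁅x⁆ i) , 0<∣∣⇒nonempty others , disjoint , Subₚ.p∪∁p≡⊤ ⁅ i ⁆)
  where
  others : 1 ≤ℕ ∣ ∁ ⁅ i ⁆ ∣
  others = subst (1 ≤ℕ_) (sym (trans (Subₚ.∣∁p∣≡n∸∣p∣ ⁅ i ⁆) (cong (n ℕ.∸_) (Subₚ.∣⁅x⁆∣≡1 i)))) (ℕₚ.m<n⇒0<n∸m 2≤n)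
  disjoint : Empty (⁅ i ⁆ ∩ ∁ ⁅ i ⁆)
  disjoint (x , x∈) = Subₚ.x∈p⇒x∉∁p (proj₁ (Subₚ.x∈p∩q⁻ _ _ x∈)) (proj₂ (Subₚ.x∈p∩q⁻ _ _ x∈))
... | crossing with All.lookupAny lone crossing
... | lone-e , (j , j∈) , (k , k∈) = absurd lone-e
  where
  e = Any.lookup crossing
  i∈e : i ∈ₛ e
  i∈e = subst (_∈ₛ e) (Subₚ.x∈⁅y⁆⇒x≡y i (proj₂ (Subₚ.x∈p∩q⁻ e ⁅ i ⁆ j∈))) (proj₁ (Subₚ.x∈p∩q⁻ e ⁅ i ⁆ j∈))
  k∈e∖i : k ∈ₛ e ∖ i
  k∈e∖i = Subₚ.x∈p∧x≢y⇒x∈p-y (proj₁ (Subₚ.x∈p∩q⁻ e (∁ ⁅ i ⁆) k∈))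
    (Subₚ.x∉⁅y⁆⇒x≢y (Subₚ.x∈∁p⇒x∉p (proj₂ (Subₚ.x∈p∩q⁻ e (∁ ⁅ i ⁆) k∈))))
  absurd : ¬ Lone i e
  absurd (inj₁ ∣e∣≡1) = ℕₚ.<⇒≱ (ℕₚ.≤-<-trans (nonempty⇒0<∣∣ (k , k∈e∖i)) (Subₚ.x∈p⇒∣p-x∣<∣p∣ i∈e)) (ℕₚ.≤-reflexive ∣e∣≡1)
  absurd (inj₂ i∉e)   = i∉e i∈e

-- Edges of size 1 cross no cut and are left out of (f)_1, so the total over all sizes is m (f)_1 =
-- n s.
incidences : ∀ {n} → (Fin n → ℕ) → Fin n → ℕ
incidences μ zero      = 0
incidences μ x@(suc _) = size x ℕ.* μ x

-- The number of ways to choose the edges of one size so that a given node stays isolated: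
-- singletons are unrestricted, larger edges must avoid the node. By symmetry it does not depend on
-- the node.
avoiding : ∀ {n} → (Fin n → ℕ) → Fin n → ℕ
avoiding {n} μ x@zero    = (n choose size x) choose μ x
avoiding {n} μ x@(suc _) = (pred n choose size x) choose μ x

-- Carries the two defining clauses as equations, so that a proof over a fixed `n` can branch on the
-- size without matching on `x`.
data SizeView {n} (μ : Fin n → ℕ) (x : Fin n) : Set where
  one   : size x ≡ 1 → incidences μ x ≡ 0 → avoiding μ x ≡ (n choose size x) choose μ x → SizeView μ x
  above : 2 ≤ℕ size x → incidences μ x ≡ size x ℕ.* μ x →
          avoiding μ x ≡ (pred n choose size x) choose μ x → SizeView μ x

sizeView : ∀ {n} (μ : Fin n → ℕ) x → SizeView μ x
sizeView μ zero    = one refl refl refl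
sizeView μ (suc y) = above (s≤s (s≤s z≤n)) refl refl

choose-logConcaveˡ : ∀ {n} → 2 ≤ℕ n → ∀ x → (pred (pred n) choose x) ℕ.* (n choose x) ≤ℕ (pred n choose x) ℕ.* (pred n choose x)
choose-logConcaveˡ {suc (suc p)} _ x = C-logConcaveˡ p x
choose-logConcaveˡ {suc zero} (s≤s ())

choose-convexˡ : ∀ {n} → 2 ≤ℕ n → ∀ y → (pred n choose suc y) ℕ.+ (pred n choose suc y) ≤ℕ (pred (pred n) choose suc y) ℕ.+ (n choose suc y)
choose-convexˡ {suc (suc p)} _ y = C-convex p y
choose-convexˡ {suc zero} (s≤s ())

-- Counting the members of `𝓗` with a given property.

module PerSize {n : ℕ} (2≤n : 2 ≤ℕ n) (m : ℕ) (f : Fin n → ℚ) (μ : Fin n → ℕ)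
  (1≤m : 1 ≤ℕ m) (mf≡μ : ∀ x → fromℕ m * f x ≡ fromℕ (μ x)) (∑μ≡m : ∑ μ ≡ m)
  (μ≤ : ∀ x → μ x ≤ℕ n choose size x) where

  1≤n : 1 ≤ℕ n
  1≤n = ℕₚ.<⇒≤ 2≤n

  open Counts 1≤n m f μ 1≤m mf≡μ ∑μ≡m

  #𝓗 : ℕ
  #𝓗 = length (𝓗 n m f)

  all-edges : Fin n → ℕ
  all-edges x = (n choose size x) choose μ x

  avail-mono : ∀ {R S : Subset n → Set} (R? : Decidable R) (S? : Decidable S) x →
    (∀ e → ∣ e ∣ ≡ size x → R e → S e) → avail R? x ≤ℕ avail S? x
  avail-mono R? S? x f = sumBy-mono (λ e → step e (∣ e ∣ ℕ.≟ size x)) (subsets n)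
    where
    step : ∀ e (d : Dec (∣ e ∣ ≡ size x)) → 𝟙 (R? e) ℕ.* 𝟙 d ≤ℕ 𝟙 (S? e) ℕ.* 𝟙 d
    step e (yes eq) = ℕₚ.*-monoˡ-≤ 1 (𝟙-mono (R? e) (S? e) (f e eq))
    step e (no _)   = ℕₚ.≤-reflexive (trans (ℕₚ.*-zeroʳ (𝟙 (R? e))) (sym (ℕₚ.*-zeroʳ (𝟙 (S? e)))))

  avail-⊆ : ∀ V x → avail (Subₚ._⊆? V) x ≡ ∣ V ∣ choose size x
  avail-⊆ V x = count-subsets V (size x)

  avail-⊤ : ∀ x → avail (Subₚ._⊆? ⊤) x ≡ n choose size x
  avail-⊤ x = trans (avail-⊆ ⊤ x) (cong (_choose size x) (Subₚ.∣⊤∣≡n n))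

  avail≤ : ∀ {R : Subset n → Set} (R? : Decidable R) x → avail R? x ≤ℕ n choose size x
  avail≤ R? x = ℕₚ.≤-trans (avail-mono R? (Subₚ._⊆? ⊤) x (λ _ _ _ → Subₚ.⊆⊤)) (ℕₚ.≤-reflexive (avail-⊤ x))

  -- Every edge satisfies e ⊆ ⊤, so `count≡∏` for this condition counts all of `𝓗`.
  #𝓗≡∏ : #𝓗 ≡ ∏ all-edges
  #𝓗≡∏ = trans (trans (length≡sumBy (𝓗 n m f))
      (sumBy-cong (λ h → sym (𝟙-true (all? (Subₚ._⊆? ⊤) (edges h)) (All.universal {P = _⊆ₛ ⊤} (λ e → Subₚ.⊆⊤) (edges h)))) (𝓗 n m f)))
    (trans (count≡∏ (Subₚ._⊆? ⊤)) (∏.sum-cong-≗ {n} (λ x → cong (_choose μ x) (avail-⊤ x))))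

  1≤#𝓗 : 1 ≤ℕ #𝓗
  1≤#𝓗 = subst (1 ≤ℕ_) (sym #𝓗≡∏) (subst (_≤ℕ ∏ all-edges) (∏-one {n} (λ x → 1) (λ x → refl))
    (∏-mono {n} (λ _ → 1) all-edges (λ x → 1≤C (μ x) (μ≤ x))))

  -- Cuts above the threshold

  -- `noncrossing-choices` multiplied over the sizes; size 1 has exponent 0 and is handled by
  -- monotonicity. With t = |V|/n, the square of the probability that no edge crosses is at most (t²
  -- + (1-t)²)^(ns).
  within-bound : ∀ V → let D = count (within? V) in
    (D ℕ.* D) ℕ.* (n ℕ.* n) ^ ∑ (incidences μ) ≤ℕ (#𝓗 ℕ.* #𝓗) ℕ.* (∣ V ∣ ℕ.* ∣ V ∣ ℕ.+ ∣ ∁ V ∣ ℕ.* ∣ ∁ V ∣) ^ ∑ (incidences μ)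
  within-bound V = begin
    (count (within? V) ℕ.* count (within? V)) ℕ.* (n ℕ.* n) ^ ∑ (incidences μ)
      ≡⟨ cong₂ (λ D P → (D ℕ.* D) ℕ.* P) (count≡∏ (within? V)) (sym (∏-^ (n ℕ.* n) (incidences μ))) ⟩
    (∏ d ℕ.* ∏ d) ℕ.* ∏ (λ x → (n ℕ.* n) ^ incidences μ x)
      ≡⟨ merge∏ d (n ℕ.* n) ⟨
    ∏ (λ x → (d x ℕ.* d x) ℕ.* (n ℕ.* n) ^ incidences μ x)
      ≤⟨ ∏-mono (λ x → (d x ℕ.* d x) ℕ.* (n ℕ.* n) ^ incidences μ x) (λ x → (all-edges x ℕ.* all-edges x) ℕ.* K ^ incidences μ x) factor ⟩
    ∏ (λ x → (all-edges x ℕ.* all-edges x) ℕ.* K ^ incidences μ x)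
      ≡⟨ merge∏ all-edges K ⟩
    (∏ all-edges ℕ.* ∏ all-edges) ℕ.* ∏ (λ x → K ^ incidences μ x)
      ≡⟨ cong₂ (λ D P → (D ℕ.* D) ℕ.* P) (sym #𝓗≡∏) (∏-^ K (incidences μ)) ⟩
    (#𝓗 ℕ.* #𝓗) ℕ.* K ^ ∑ (incidences μ) ∎
    where
    open ℕₚ.≤-Reasoning
    K = ∣ V ∣ ℕ.* ∣ V ∣ ℕ.+ ∣ ∁ V ∣ ℕ.* ∣ ∁ V ∣
    d : Fin n → ℕ
    d x = avail (within? V) x choose μ x
    merge∏ : ∀ (g : Fin n → ℕ) c → ∏ (λ x → (g x ℕ.* g x) ℕ.* c ^ incidences μ x) ≡ (∏ g ℕ.* ∏ g) ℕ.* ∏ (λ x → c ^ incidences μ x)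
    merge∏ g c = trans (∏-* (λ x → g x ℕ.* g x) (λ x → c ^ incidences μ x)) (cong (ℕ._* ∏ (λ x → c ^ incidences μ x)) (∏-* g g))
    avail-sum : ∀ x → avail (within? V) x ≤ℕ ∣ V ∣ choose size x ℕ.+ ∣ ∁ V ∣ choose size x
    avail-sum x = ℕₚ.≤-trans (sumBy-mono (λ e → either e) (subsets n))
      (ℕₚ.≤-reflexive (trans (sumBy-+ (λ e → 𝟙 (e Subₚ.⊆? V) ℕ.* 𝟙 (∣ e ∣ ℕ.≟ size x)) (λ e → 𝟙 (e Subₚ.⊆? ∁ V) ℕ.* 𝟙 (∣ e ∣ ℕ.≟ size x)) (subsets n))
        (cong₂ ℕ._+_ (avail-⊆ V x) (avail-⊆ (∁ V) x))))
      where
      either : ∀ e → 𝟙 (within? V e) ℕ.* 𝟙 (∣ e ∣ ℕ.≟ size x) ≤ℕ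
        𝟙 (e Subₚ.⊆? V) ℕ.* 𝟙 (∣ e ∣ ℕ.≟ size x) ℕ.+ 𝟙 (e Subₚ.⊆? ∁ V) ℕ.* 𝟙 (∣ e ∣ ℕ.≟ size x)
      either e = ℕₚ.≤-trans (ℕₚ.*-monoˡ-≤ (𝟙 (∣ e ∣ ℕ.≟ size x)) (union (e Subₚ.⊆? V) (e Subₚ.⊆? ∁ V)))
        (ℕₚ.≤-reflexive (ℕₚ.*-distribʳ-+ (𝟙 (∣ e ∣ ℕ.≟ size x)) (𝟙 (e Subₚ.⊆? V)) (𝟙 (e Subₚ.⊆? ∁ V))))
        where
        union : ∀ {P Q : Set} (a : Dec P) (b : Dec Q) → 𝟙 (a ⊎-dec b) ≤ℕ 𝟙 a ℕ.+ 𝟙 b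
        union (yes _) b = s≤s z≤n
        union (no _)  b = ℕₚ.≤-refl
    factor : ∀ x → (d x ℕ.* d x) ℕ.* (n ℕ.* n) ^ incidences μ x ≤ℕ (all-edges x ℕ.* all-edges x) ℕ.* K ^ incidences μ x
    factor x with sizeView μ x
    ... | one _ e≡ _ rewrite e≡ = ℕₚ.*-monoˡ-≤ 1 (ℕₚ.*-mono-≤ le le)
      where
      le : d x ≤ℕ all-edges x
      le = C-monoˡ (μ x) (avail≤ (within? V) x)
    ... | above 2≤x e≡ _ rewrite e≡ = noncrossing-choices (μ x) 2≤x (avail≤ (within? V) x) (avail-sum x)
      (Subₚ.∣p∣≤n V) (Subₚ.∣p∣≤n (∁ V)) (μ≤ x)

  #disconnected : ℕ
  #disconnected = sumBy (λ h → 𝟙 (¬? (connected? h))) (𝓗 n m f)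

  #connected : ℕ
  #connected = sumBy (λ h → 𝟙 (connected? h)) (𝓗 n m f)

  disconnected-bound : ∀ {κ s h} → fromℕ n * s ≡ fromℕ (∑ (incidences μ)) → n ≼ 1 exp (1ℚ + h) →
    1ℚ + h + fromℕ (6 ℕ.+ 2 ℕ.* κ) ≤ s → κ ℕ.* #disconnected ≤ℕ #𝓗
  disconnected-bound {κ} {s} {h₀} ns≡ n≼1 gap = ℕₚ.≤-trans (ℕₚ.*-monoʳ-≤ κ union)
    (sum-subsets n κ #𝓗 g supported bounded)
    where
    -- Restricting to light sets selects the smaller side of each cut, as the hypothesis k ≤ l of
    -- `CutEstimate` demands, and makes `g` vanish at the empty set.
    g : Subset n → ℕ
    g V = 𝟙 (light? V) ℕ.* count (within? V)
    union : #disconnected ≤ℕ sumBy g (subsets n)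
    union = begin
      sumBy (λ h → 𝟙 (¬? (connected? h))) (𝓗 n m f)
        ≤⟨ sumBy-mono (λ h → cover h (¬? (connected? h))) (𝓗 n m f) ⟩
      sumBy (λ h → sumBy (λ V → 𝟙 (light? V) ℕ.* 𝟙 (all? (within? V) (edges h))) (subsets n)) (𝓗 n m f)
        ≡⟨ sumBy-swap (λ h V → 𝟙 (light? V) ℕ.* 𝟙 (all? (within? V) (edges h))) (𝓗 n m f) (subsets n) ⟩
      sumBy (λ V → sumBy (λ h → 𝟙 (light? V) ℕ.* 𝟙 (all? (within? V) (edges h))) (𝓗 n m f)) (subsets n)
        ≡⟨ sumBy-cong (λ V → sumBy-*ˡ (𝟙 (light? V)) (λ h → 𝟙 (all? (within? V) (edges h))) (𝓗 n m f)) (subsets n) ⟩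
      sumBy g (subsets n) ∎
      where
      open ℕₚ.≤-Reasoning
      cover : ∀ h (d : Dec (¬ Connected h)) → 𝟙 d ≤ℕ sumBy (λ V → 𝟙 (light? V) ℕ.* 𝟙 (all? (within? V) (edges h))) (subsets n)
      cover h (no _)      = z≤n
      cover h (yes ¬conn) = ℕₚ.≤-trans (Any⇒1≤sumBy (λ V → light? V ×-dec all? (within? V) (edges h)) (separated h ¬conn))
        (ℕₚ.≤-reflexive (sumBy-cong (λ V → 𝟙-× (light? V) (all? (within? V) (edges h))) (subsets n)))
    supported : ∀ V → 1 ≤ℕ g V → 1 ≤ℕ ∣ V ∣
    supported V = go (light? V)
      where
      go : ∀ (d : Dec (Light V)) → 1 ≤ℕ 𝟙 d ℕ.* count (within? V) → 1 ≤ℕ ∣ V ∣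
      go (yes light) _ = proj₁ light
    bounded : ∀ V → (n choose ∣ V ∣) ℕ.* g V ℕ.* suc κ ^ ∣ V ∣ ≤ℕ #𝓗
    bounded V = go (light? V)
      where
      D = count (within? V)
      go : ∀ (d : Dec (Light V)) → (n choose ∣ V ∣) ℕ.* (𝟙 d ℕ.* D) ℕ.* suc κ ^ ∣ V ∣ ≤ℕ #𝓗
      go (no _) = subst (_≤ℕ #𝓗) (sym (cong (ℕ._* suc κ ^ ∣ V ∣) (ℕₚ.*-zeroʳ (n choose ∣ V ∣)))) z≤n
      go (yes (1≤k , 2k≤n)) = subst (λ z → (n choose ∣ V ∣) ℕ.* z ℕ.* suc κ ^ ∣ V ∣ ≤ℕ #𝓗) (sym (ℕₚ.+-identityʳ D))
        (CutEstimate.cut-bound {n} {∣ V ∣} {∣ ∁ V ∣} {D} {#𝓗} {∑ (incidences μ)} {κ} {s} {h₀} 1≤k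
          (ℕₚ.+-cancelˡ-≤ (∣ V ∣) (∣ V ∣) (∣ ∁ V ∣) (ℕₚ.≤-trans 2k≤n (ℕₚ.≤-reflexive (sym (∣p∣+∣∁p∣≡n V)))))
          (∣p∣+∣∁p∣≡n V) (within-bound V) ns≡ n≼1 gap)

  -- Isolated nodes below the threshold

  ∣∁⁅i⁆∣ : ∀ (i : Fin n) → ∣ ∁ ⁅ i ⁆ ∣ ≡ pred n
  ∣∁⁅i⁆∣ i = trans (Subₚ.∣∁p∣≡n∸∣p∣ ⁅ i ⁆) (cong (n ℕ.∸_) (Subₚ.∣⁅x⁆∣≡1 i))

  count-lone : ∀ i → count (lone? i) ≡ ∏ (avoiding μ)
  count-lone i = trans (count≡∏ (lone? i)) (∏.sum-cong-≗ {n} factor)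
    where
    factor : ∀ x → avail (lone? i) x choose μ x ≡ avoiding μ x
    factor x with sizeView μ x
    ... | one s≡ _ a≡ = trans (cong (_choose μ x) (ℕₚ.≤-antisym (avail≤ (lone? i) x)
      (ℕₚ.≤-trans (ℕₚ.≤-reflexive (sym (avail-⊤ x))) (avail-mono (Subₚ._⊆? ⊤) (lone? i) x (λ _ eq _ → inj₁ (trans eq s≡)))))) (sym a≡)
    ... | above 2≤x _ a≡ = trans (cong (_choose μ x) (trans (ℕₚ.≤-antisym
        (avail-mono (lone? i) (Subₚ._⊆? ∁ ⁅ i ⁆) x (λ e eq lone → outside-i e eq lone))
        (avail-mono (Subₚ._⊆? ∁ ⁅ i ⁆) (lone? i) x (λ e _ sub → inj₂ λ i∈e → Subₚ.x∈∁p⇒x∉p (sub i∈e) (Subₚ.x∈⁅x⁆ i))))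
        (trans (avail-⊆ (∁ ⁅ i ⁆) x) (cong (_choose size x) (∣∁⁅i⁆∣ i))))) (sym a≡)
      where
      outside-i : ∀ e → ∣ e ∣ ≡ size x → Lone i e → e ⊆ₛ ∁ ⁅ i ⁆
      outside-i e eq (inj₁ eq₁) _ = contradiction (trans (sym eq) eq₁) (ℕₚ.>⇒≢ 2≤x)
      outside-i e eq (inj₂ i∉e) {z} z∈e = Subₚ.x∉p⇒x∈∁p λ z∈ → i∉e (subst (_∈ₛ e) (Subₚ.x∈⁅y⁆⇒x≡y i z∈) z∈e)

  both? : ∀ i j → Decidable (λ e → Lone {n} i e × Lone j e)
  both? i j e = lone? i e ×-dec lone? j e

  avail-both : ∀ i j → i ≢ j → ∀ x → 2 ≤ℕ size x → avail (both? i j) x ≤ℕ pred (pred n) choose size x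
  avail-both i j i≢j x 2≤x = ℕₚ.≤-trans (avail-mono (both? i j) (Subₚ._⊆? (∁ ⁅ i ⁆ ∖ j)) x outside-ij)
    (ℕₚ.≤-trans (ℕₚ.≤-reflexive (avail-⊆ (∁ ⁅ i ⁆ ∖ j) x)) (C-monoˡ (size x) smaller))
    where
    j∈ : j ∈ₛ ∁ ⁅ i ⁆
    j∈ = Subₚ.x∉p⇒x∈∁p λ j∈⁅i⁆ → i≢j (sym (Subₚ.x∈⁅y⁆⇒x≡y i j∈⁅i⁆))
    smaller : ∣ ∁ ⁅ i ⁆ ∖ j ∣ ≤ℕ pred (pred n)
    smaller = ℕₚ.pred-mono-≤ (subst (∣ ∁ ⁅ i ⁆ ∖ j ∣ <ℕ_) (∣∁⁅i⁆∣ i) (Subₚ.x∈p⇒∣p-x∣<∣p∣ j∈))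
    missing : ∀ {i e} → ∣ e ∣ ≡ size x → Lone i e → i ∉ₛ e
    missing eq (inj₁ eq₁) = contradiction (trans (sym eq) eq₁) (ℕₚ.>⇒≢ 2≤x)
    missing eq (inj₂ i∉e) = i∉e
    outside-ij : ∀ e → ∣ e ∣ ≡ size x → Lone i e × Lone j e → e ⊆ₛ ∁ ⁅ i ⁆ ∖ j
    outside-ij e eq (li , lj) {z} z∈e = Subₚ.x∈p∧x≢y⇒x∈p-y
      (Subₚ.x∉p⇒x∈∁p λ z∈ → missing {i} {e} eq li (subst (_∈ₛ e) (Subₚ.x∈⁅y⁆⇒x≡y i z∈) z∈e))
      (λ { refl → missing {j} {e} eq lj z∈e })

  -- For sizes at least 2, log-concavity is used at two levels: C(n-2,x), C(n-1,x), C(n,x) are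
  -- log-concave and convex in the upper argument, and `C-logConcave` passes this on to the numbers
  -- of ways to choose μ x edges from them.
  negatively-correlated : ∀ i j → i ≢ j → #𝓗 ℕ.* count (both? i j) ≤ℕ ∏ (avoiding μ) ℕ.* ∏ (avoiding μ)
  negatively-correlated i j i≢j = begin
    #𝓗 ℕ.* count (both? i j)                     ≡⟨ cong₂ ℕ._*_ #𝓗≡∏ (count≡∏ (both? i j)) ⟩
    ∏ all-edges ℕ.* ∏ b                          ≡⟨ ∏-* all-edges b ⟨
    ∏ (λ x → all-edges x ℕ.* b x)                ≤⟨ ∏-mono (λ x → all-edges x ℕ.* b x) (λ x → avoiding μ x ℕ.* avoiding μ x) factor ⟩
    ∏ (λ x → avoiding μ x ℕ.* avoiding μ x)          ≡⟨ ∏-* (avoiding μ) (avoiding μ) ⟩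
    ∏ (avoiding μ) ℕ.* ∏ (avoiding μ)                    ∎
    where
    open ℕₚ.≤-Reasoning
    b : Fin n → ℕ
    b x = avail (both? i j) x choose μ x
    factor : ∀ x → all-edges x ℕ.* b x ≤ℕ avoiding μ x ℕ.* avoiding μ x
    factor x with sizeView μ x
    ... | one _ _ a≡ rewrite a≡ = ℕₚ.*-monoʳ-≤ (all-edges x) (C-monoˡ (μ x) (avail≤ (both? i j) x))
    ... | above 2≤x _ a≡ rewrite a≡ = begin
      all-edges x ℕ.* b x                                      ≤⟨ ℕₚ.*-monoʳ-≤ (all-edges x) (C-monoˡ (μ x) (avail-both i j i≢j x 2≤x)) ⟩
      all-edges x ℕ.* ((pred (pred n) choose size x) choose μ x)   ≡⟨ ℕₚ.*-comm (all-edges x) _ ⟩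
      ((pred (pred n) choose size x) choose μ x) ℕ.* all-edges x   ≤⟨ C-logConcave (μ x) (C-monoˡ (size x) (ℕₚ.pred[n]≤n {pred n})) (C-monoˡ (size x) ℕₚ.pred[n]≤n)
                                                                   (choose-logConcaveˡ 2≤n (size x)) (choose-convexˡ 2≤n (toℕ x)) ⟩
      ((pred n choose size x) choose μ x) ℕ.* ((pred n choose size x) choose μ x)  ∎

  connected-bound : 1 ≤ℕ n ℕ.* ∏ (avoiding μ) → #connected ℕ.* (n ℕ.* ∏ (avoiding μ)) ≤ℕ #𝓗 ℕ.* #𝓗
  connected-bound = Chebyshev.chebyshev (𝓗 n m f) (λ i h → all? (lone? i) (edges h)) connected?
    (λ {h} conn i → connected⇒¬lone 2≤n {h = h} conn i) (∏ (avoiding μ)) count-lone second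
    where
    second : ∀ i j → #𝓗 ℕ.* sumBy (λ h → 𝟙 (all? (lone? i) (edges h)) ℕ.* 𝟙 (all? (lone? j) (edges h))) (𝓗 n m f) ≤ℕ
      𝟙 (i Finₚ.≟ j) ℕ.* (#𝓗 ℕ.* ∏ (avoiding μ)) ℕ.+ ∏ (avoiding μ) ℕ.* ∏ (avoiding μ)
    second i j = go (i Finₚ.≟ j)
      where
      pair : ℕ
      pair = sumBy (λ h → 𝟙 (all? (lone? i) (edges h)) ℕ.* 𝟙 (all? (lone? j) (edges h))) (𝓗 n m f)
      go : ∀ (d : Dec (i ≡ j)) → #𝓗 ℕ.* pair ≤ℕ 𝟙 d ℕ.* (#𝓗 ℕ.* ∏ (avoiding μ)) ℕ.+ ∏ (avoiding μ) ℕ.* ∏ (avoiding μ)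
      go (yes _) = ℕₚ.≤-trans (ℕₚ.*-monoʳ-≤ #𝓗 (ℕₚ.≤-trans
          (sumBy-mono (λ h → ℕₚ.≤-trans (ℕₚ.*-monoʳ-≤ (𝟙 (all? (lone? i) (edges h))) (𝟙≤1 (all? (lone? j) (edges h))))
            (ℕₚ.≤-reflexive (ℕₚ.*-identityʳ (𝟙 (all? (lone? i) (edges h)))))) (𝓗 n m f))
          (ℕₚ.≤-reflexive (count-lone i))))
        (ℕₚ.≤-trans (ℕₚ.m≤m+n (#𝓗 ℕ.* ∏ (avoiding μ)) 0) (ℕₚ.m≤m+n _ (∏ (avoiding μ) ℕ.* ∏ (avoiding μ))))
      go (no i≢j) = ℕₚ.≤-trans (ℕₚ.≤-reflexive (cong (#𝓗 ℕ.*_) (sumBy-cong (λ h → trans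
          (sym (𝟙-× (all? (lone? i) (edges h)) (all? (lone? j) (edges h))))
          (𝟙-cong (all? (lone? i) (edges h) ×-dec all? (lone? j) (edges h)) (all? (both? i j) (edges h)) All.zip All.unzip)) (𝓗 n m f))))
        (negatively-correlated i j i≢j)

-- Rational sums and moments.

sum-mono : ∀ {n} (f g : Fin n → ℚ) → (∀ x → f x ≤ g x) → sum f ≤ sum g
sum-mono {zero}  f g le = ℚₚ.≤-refl
sum-mono {suc n} f g le = ℚₚ.+-mono-≤ {f zero} {g zero} {sum (f ∘ suc)} {sum (g ∘ suc)} (le zero) (sum-mono (f ∘ suc) (g ∘ suc) (le ∘ suc))

module ℚ∑ = SemiringSum (CommutativeRing.semiring ℚₚ.+-*-commutativeRing)

sum-cong : ∀ {n} (f g : Fin n → ℚ) → (∀ x → f x ≡ g x) → sum f ≡ sum g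
sum-cong {n} f g eq = ℚ∑.sum-cong-≗ {n} eq

sum-*ˡ : ∀ {n} c (f : Fin n → ℚ) → sum (λ x → c * f x) ≡ c * sum f
sum-*ˡ c f = sym (ℚ∑.*-distribˡ-sum c f)

sum-+ : ∀ {n} (f g : Fin n → ℚ) → sum (λ x → f x + g x) ≡ sum f + sum g
sum-+ f g = ℚ∑.∑-distrib-+ f g

0≤sum : ∀ {n} (f : Fin n → ℚ) → (∀ x → 0ℚ ≤ f x) → 0ℚ ≤ sum f
0≤sum {zero}  f h = ℚₚ.≤-refl
0≤sum {suc n} f h = 0≤+ (h zero) (0≤sum (f ∘ suc) (h ∘ suc))

term≤sum : ∀ {n} (f : Fin n → ℚ) → (∀ x → 0ℚ ≤ f x) → ∀ x → f x ≤ sum f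
term≤sum f h zero    = ≤-by refl (0≤sum (f ∘ suc) (h ∘ suc))
term≤sum f h (suc x) = ℚₚ.≤-trans (term≤sum (f ∘ suc) (h ∘ suc) x) (≤-by (ℚₚ.+-comm (f zero) (sum (f ∘ suc))) (h zero))

fromℕ-∑ : ∀ {n} (f : Fin n → ℕ) → fromℕ (∑ f) ≡ sum (λ x → fromℕ (f x))
fromℕ-∑ {zero}  f = refl
fromℕ-∑ {suc n} f = trans (fromℕ-+ (f zero) (∑ (f ∘ suc))) (cong (λ z → fromℕ (f zero) + z) (fromℕ-∑ (f ∘ suc)))

-- Deletes the entry of size 1, as `moment` does, but keeps the index set `Fin n`, so that moments
-- and sums over all sizes can be combined termwise.
later : ∀ {n} → (Fin n → ℚ) → Fin n → ℚ
later g zero      = 0ℚ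
later g x@(suc _) = g x

later-mono : ∀ {n} (f g : Fin n → ℚ) → (∀ x → f x ≤ g x) → ∀ x → later f x ≤ later g x
later-mono f g le zero    = ℚₚ.≤-refl
later-mono f g le (suc x) = le (suc x)

0≤later : ∀ {n} (f : Fin n → ℚ) → (∀ x → 0ℚ ≤ f x) → ∀ x → 0ℚ ≤ later f x
0≤later f h zero    = ℚₚ.≤-refl
0≤later f h (suc x) = h (suc x)

moment≡sum : ∀ {n} r (f : Fin n → ℚ) → moment r f ≡ sum (later (λ x → fromℕ (size x ^ r) * f x))
moment≡sum {zero}  r f = refl
moment≡sum {suc n} r f = sym (ℚₚ.+-identityˡ (moment r f))

-- For j ≤ μ the factor (N - j)/(a - j) is at most 1 + p/(1 - p - t), and 1/(1 - u) ≤ 1 + 2u for u =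
-- p + t ≤ 1/2; hence `rate`. In the application N = C(n,x), a = C(n-1,x), p = x/n and t = μ/N.
module FallingRatio {N a μ : ℕ} {p t : ℚ} (0≤p : 0ℚ ≤ p) (0≤t : 0ℚ ≤ t) (small : (p + t) + (p + t) ≤ 1ℚ)
  (a≡ : fromℕ a ≡ fromℕ N * (1ℚ - p)) (μ≡ : fromℕ μ ≡ fromℕ N * t) (μ≤N : μ ≤ℕ N) where

  rate : ℚ
  rate = p * (1ℚ + ((p + t) + (p + t)))

  private
    u = p + t
    0≤u : 0ℚ ≤ u
    0≤u = 0≤+ 0≤p 0≤t
    0≤rate : 0ℚ ≤ rate
    0≤rate = 0≤* 0≤p (0≤+ 0≤1ℚ (0≤+ 0≤u 0≤u))

    fromℕ-∸ : ∀ {b c} → c ≤ℕ b → fromℕ (b ℕ.∸ c) ≡ fromℕ b - fromℕ c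
    fromℕ-∸ {b} {c} c≤b = begin
      fromℕ (b ℕ.∸ c)                            ≡⟨ solve 2 (λ x c → x := (x :+ c) :- c) refl (fromℕ (b ℕ.∸ c)) (fromℕ c) ⟩
      (fromℕ (b ℕ.∸ c) + fromℕ c) - fromℕ c      ≡⟨ cong (_- fromℕ c) (sym (fromℕ-+ (b ℕ.∸ c) c)) ⟩
      fromℕ (b ℕ.∸ c ℕ.+ c) - fromℕ c            ≡⟨ cong (λ z → fromℕ z - fromℕ c) (ℕₚ.m∸n+n≡m c≤b) ⟩
      fromℕ b - fromℕ c                          ∎
      where open ≡-Reasoning

    fromℕ-∸-≥ : ∀ b c → fromℕ b - fromℕ c ≤ fromℕ (b ℕ.∸ c)
    fromℕ-∸-≥ b c = ℚₚ.≤-trans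
      (ℚₚ.+-monoˡ-≤ (- fromℕ c) (ℚₚ.≤-trans (fromℕ-mono-≤ (ℕₚ.m≤n+m∸n b c)) (ℚₚ.≤-reflexive (fromℕ-+ c (b ℕ.∸ c)))))
      (ℚₚ.≤-reflexive (solve 2 (λ c x → (c :+ x) :- c := x) refl (fromℕ c) (fromℕ (b ℕ.∸ c))))

    factor : ∀ j → j ≤ℕ μ → N ℕ.∸ j ≼ a ℕ.∸ j exp rate
    factor j j≤μ = ≼-lin (0≤⇒≥-1 0≤rate) (ℚₚ.≤-trans (ℚₚ.≤-reflexive (fromℕ-∸ (ℕₚ.≤-trans j≤μ μ≤N)))
      (ℚₚ.≤-trans (≤-by identity gain) (*-monoʳ (1ℚ + rate) (0≤+ 0≤1ℚ 0≤rate) (fromℕ-∸-≥ a j))))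
      where
      r = fromℕ μ - fromℕ j
      gain : 0ℚ ≤ p * (fromℕ N * u * (1ℚ - (u + u)) + r * (1ℚ + (u + u)))
      gain = 0≤* 0≤p (0≤+ (0≤* (0≤* (0≤fromℕ N) 0≤u) (≤⇒0≤- small)) (0≤* (≤⇒0≤- (fromℕ-mono-≤ j≤μ)) (0≤+ 0≤1ℚ (0≤+ 0≤u 0≤u))))
      identity : (fromℕ a - fromℕ j) * (1ℚ + rate) ≡
        (fromℕ N - fromℕ j) + p * (fromℕ N * u * (1ℚ - (u + u)) + r * (1ℚ + (u + u)))
      identity = trans (cong (λ z → (z - fromℕ j) * (1ℚ + rate)) a≡)
        (trans (solve 4 (λ N p t j →
            let u = p :+ t ; rt = p :* (con 1ℚ :+ (u :+ u)) in
            (N :* (con 1ℚ :- p) :- j) :* (con 1ℚ :+ rt) :=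
            (N :- j) :+ p :* (N :* u :* (con 1ℚ :- (u :+ u)) :+ (N :* t :- j) :* (con 1ℚ :+ (u :+ u))))
            refl (fromℕ N) p t (fromℕ j))
          (cong (λ z → (fromℕ N - fromℕ j) + p * (fromℕ N * u * (1ℚ - (u + u)) + (z - fromℕ j) * (1ℚ + (u + u)))) (sym μ≡)))

    falling-ratio : ∀ k → k ≤ℕ μ → falling N k ≼ falling a k exp (fromℕ k * rate)
    falling-ratio zero    _   = ≼-≡ (sym (ℚₚ.*-zeroˡ rate)) (≤⇒≼ ℕₚ.≤-refl)
    falling-ratio (suc k) k<μ = ≼-≡ exponent (≼-* (falling-ratio k (ℕₚ.<⇒≤ k<μ)) (factor k (ℕₚ.<⇒≤ k<μ)))
      where
      exponent : fromℕ k * rate + rate ≡ fromℕ (suc k) * rate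
      exponent = trans (solve 2 (λ k r → k :* r :+ r := (con 1ℚ :+ k) :* r) refl (fromℕ k) rate) (cong (_* rate) (sym (fromℕ-+ 1 k)))

  choose-ratio : N choose μ ≼ a choose μ exp (fromℕ μ * rate)
  choose-ratio = ≼-cancelʳ (μ !) (1≤k! μ) (≼-≤ˡ (ℕₚ.≤-reflexive (nCk*k!≡falling N μ))
    (≼-≤ʳ (falling-ratio μ ℕₚ.≤-refl) (ℕₚ.≤-reflexive (sym (nCk*k!≡falling a μ)))))

module Isolated {n : ℕ} (2≤n : 2 ≤ℕ n) (m : ℕ) (f : Fin n → ℚ) (μ : Fin n → ℕ)
  (1≤m : 1 ≤ℕ m) (mf≡μ : ∀ x → fromℕ m * f x ≡ fromℕ (μ x)) (∑μ≡m : ∑ μ ≡ m)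
  (μ≤ : ∀ x → μ x ≤ℕ n choose size x) where

  open PerSize 2≤n m f μ 1≤m mf≡μ ∑μ≡m μ≤ public

  ι : ℚ
  ι = 1 ÷ n

  nι≡1 : fromℕ n * ι ≡ 1ℚ
  nι≡1 = fromℕ-÷ 1 n 1≤n

  0≤ι : 0ℚ ≤ ι
  0≤ι = 0≤÷ 1 n

  ν : Fin n → ℚ
  ν x = 1 ÷ (n choose size x)

  scaledMoment : ℕ → ℚ
  scaledMoment r = sum (later (λ x → fromℕ (size x ^ r) * fromℕ (μ x)))

  -- An upper bound for the expected number of coinciding pairs if the edges of each size were drawn
  -- with replacement. It equals m² times the sum in the sparsity hypothesis.
  collisions : ℚ
  collisions = sum (λ x → ν x * (fromℕ (μ x) * fromℕ (μ x)))

  scaledMoment≡ : ∀ r → fromℕ m * moment r f ≡ scaledMoment r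
  scaledMoment≡ r = trans (cong (fromℕ m *_) (moment≡sum r f)) (trans (sym (sum-*ˡ (fromℕ m) (later (λ x → fromℕ (size x ^ r) * f x))))
    (sum-cong (λ x → fromℕ m * later (λ x → fromℕ (size x ^ r) * f x) x) (later (λ x → fromℕ (size x ^ r) * fromℕ (μ x)))
      (pointwise f μ mf≡μ)))
    where
    pointwise : ∀ {k} (f : Fin k → ℚ) (μ : Fin k → ℕ) → (∀ x → fromℕ m * f x ≡ fromℕ (μ x)) → ∀ x →
      fromℕ m * later (λ x → fromℕ (size x ^ r) * f x) x ≡ later (λ x → fromℕ (size x ^ r) * fromℕ (μ x)) x
    pointwise f μ eq zero    = ℚₚ.*-zeroʳ (fromℕ m)
    pointwise f μ eq (suc x) = trans
      (solve 3 (λ m s f → m :* (s :* f) := s :* (m :* f)) refl (fromℕ m) (fromℕ (size (suc x) ^ r)) (f (suc x)))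
      (cong (fromℕ (size (suc x) ^ r) *_) (eq (suc x)))

  incidences≡ : fromℕ (∑ (incidences μ)) ≡ scaledMoment 1
  incidences≡ = trans (fromℕ-∑ (incidences μ)) (sum-cong (λ x → fromℕ (incidences μ x)) _ (pointwise μ))
    where
    pointwise : ∀ {k} (μ : Fin k → ℕ) x → fromℕ (incidences μ x) ≡ later (λ x → fromℕ (size x ^ 1) * fromℕ (μ x)) x
    pointwise μ zero    = refl
    pointwise μ (suc x) = trans (cong (λ z → fromℕ (z ℕ.* μ (suc x))) (sym (ℕₚ.*-identityʳ (size (suc x)))))
      (fromℕ-* (size (suc x) ^ 1) (μ (suc x)))

  0≤weight : ∀ r x → 0ℚ ≤ fromℕ (size x ^ r) * fromℕ (μ x)
  0≤weight r x = 0≤* (0≤fromℕ (size x ^ r)) (0≤fromℕ (μ x))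

  0≤collisions-term : ∀ x → 0ℚ ≤ ν x * (fromℕ (μ x) * fromℕ (μ x))
  0≤collisions-term x = 0≤* (0≤÷ 1 (n choose size x)) (0≤* (0≤fromℕ (μ x)) (0≤fromℕ (μ x)))

  scaledMoment-mono : ∀ r → scaledMoment r ≤ scaledMoment (suc r)
  scaledMoment-mono r = sum-mono (later (w r)) (later (w (suc r))) (later-mono (w r) (w (suc r))
    (λ x → *-monoʳ (fromℕ (μ x)) (0≤fromℕ (μ x)) (fromℕ-mono-≤ (ℕₚ.m≤n*m (size x ^ r) (size x)))))
    where
    w : ℕ → Fin n → ℚ
    w r x = fromℕ (size x ^ r) * fromℕ (μ x)

  module _ {c : ℕ} {s : ℚ} (1≤c : 1 ≤ℕ c) (ns≡ : fromℕ n * s ≡ scaledMoment 1)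
    (collisions≤ : fromℕ 4 * collisions ≤ 1ℚ)
    (moments : scaledMoment 2 ≤ fromℕ c * scaledMoment 1)
    (sparse : fromℕ 16 * (fromℕ c * s) ≤ fromℕ n) where

    private
      -- A size that occurs satisfies x² ≤ m (f)_2 ≤ c n s ≤ n²/16. The 16 in `sparse` is there to
      -- give x/n ≤ 1/4.
      smallSize : ∀ x → 1 ≤ℕ μ x → fromℕ (size x ^ 2) * fromℕ (μ x) ≤ scaledMoment 2 →
        4 ℕ.* size x ≤ℕ n
      smallSize x 1≤μ term≤ = m*m≤n*n⇒m≤n (fromℕ-cancel-≤ (begin
        fromℕ (4 ℕ.* size x ℕ.* (4 ℕ.* size x))         ≡⟨ trans (cong fromℕ (lem (size x))) (fromℕ-* 16 (size x ^ 2)) ⟩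
        fromℕ 16 * fromℕ (size x ^ 2)                   ≤⟨ *-monoˡ (fromℕ 16) (0≤fromℕ 16) size²≤ ⟩
        fromℕ 16 * (fromℕ c * scaledMoment 1)           ≡⟨ cong (λ z → fromℕ 16 * (fromℕ c * z)) (sym ns≡) ⟩
        fromℕ 16 * (fromℕ c * (fromℕ n * s))            ≡⟨ solve 4 (λ a c n s → a :* (c :* (n :* s)) := n :* (a :* (c :* s))) refl (fromℕ 16) (fromℕ c) (fromℕ n) s ⟩
        fromℕ n * (fromℕ 16 * (fromℕ c * s))            ≤⟨ *-monoˡ (fromℕ n) (0≤fromℕ n) sparse ⟩
        fromℕ n * fromℕ n                               ≡⟨ fromℕ-* n n ⟨
        fromℕ (n ℕ.* n)                                 ∎))
        where
        open ℚₚ.≤-Reasoning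
        lem : ∀ x → 4 ℕ.* x ℕ.* (4 ℕ.* x) ≡ 16 ℕ.* (x ℕ.* (x ℕ.* 1))
        lem = solve-∀
        size²≤ : fromℕ (size x ^ 2) ≤ fromℕ c * scaledMoment 1
        size²≤ = begin
          fromℕ (size x ^ 2)                    ≡⟨ ℚₚ.*-identityʳ (fromℕ (size x ^ 2)) ⟨
          fromℕ (size x ^ 2) * 1ℚ               ≤⟨ *-monoˡ (fromℕ (size x ^ 2)) (0≤fromℕ (size x ^ 2)) (fromℕ-mono-≤ 1≤μ) ⟩
          fromℕ (size x ^ 2) * fromℕ (μ x)      ≤⟨ term≤ ⟩
          scaledMoment 2                        ≤⟨ moments ⟩
          fromℕ c * scaledMoment 1              ∎

      -- With p = x/n and t = μ/N one has μ · rate = xμ/n + 2x²μ/n² + 2p μ²/N, and `E` replaces p by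
      -- 1 in the last term. Summed over the sizes the three parts are s, a second-moment correction
      -- and twice `collisions`.
      A₁ A₂ B E : Fin n → ℚ
      A₁ = later (λ x → fromℕ (size x ^ 1) * fromℕ (μ x))
      A₂ = later (λ x → fromℕ (size x ^ 2) * fromℕ (μ x))
      B x = ν x * (fromℕ (μ x) * fromℕ (μ x))
      2ιι = (ι + ι) * ι
      E x = (ι * A₁ x + 2ιι * A₂ x) + fromℕ 2 * B x

      0≤E : ∀ x → 0ℚ ≤ E x
      0≤E x = 0≤+ (0≤+ (0≤* 0≤ι (0≤later _ (0≤weight 1) x)) (0≤* (0≤* (0≤+ 0≤ι 0≤ι) 0≤ι) (0≤later _ (0≤weight 2) x)))
        (0≤* (0≤fromℕ 2) (0≤collisions-term x))

      large : ∀ x → 2 ≤ℕ size x → A₁ x ≡ fromℕ (size x) * fromℕ (μ x) → A₂ x ≡ fromℕ (size x ^ 2) * fromℕ (μ x) →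
        1 ≤ℕ μ x → 4 ℕ.* size x ≤ℕ n →
        (n choose size x) choose μ x ≼ (pred n choose size x) choose μ x exp E x
      large x 2≤x A₁≡ A₂≡ 1≤μ 4x≤n = ≼-weaken exponent choose-ratio
        where
        N = n choose size x
        a = pred n choose size x
        p = fromℕ (size x) * ι
        t = fromℕ (μ x) * ν x
        μq = fromℕ (μ x)
        1≤N : 1 ≤ℕ N
        1≤N = ℕₚ.≤-trans 1≤μ (μ≤ x)
        Nν≡1 : fromℕ N * ν x ≡ 1ℚ
        Nν≡1 = fromℕ-÷ 1 N 1≤N
        0≤p : 0ℚ ≤ p
        0≤p = 0≤* (0≤fromℕ (size x)) 0≤ι
        0≤t : 0ℚ ≤ t
        0≤t = 0≤* (0≤fromℕ (μ x)) (0≤÷ 1 N)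
        -- The condition p + t ≤ 1/2 is split evenly: p ≤ 1/4 by `smallSize`, and t ≤ 1/4 because t
        -- ≤ μ t ≤ `collisions` when μ ≥ 1.
        4p≤1 : fromℕ 4 * p ≤ 1ℚ
        4p≤1 = subst₂ _≤_ (trans (cong (_* ι) (fromℕ-* 4 (size x))) (ℚₚ.*-assoc (fromℕ 4) (fromℕ (size x)) ι)) nι≡1
          (*-monoʳ ι 0≤ι (fromℕ-mono-≤ 4x≤n))
        4t≤1 : fromℕ 4 * t ≤ 1ℚ
        4t≤1 = ℚₚ.≤-trans (*-monoˡ (fromℕ 4) (0≤fromℕ 4) (ℚₚ.≤-trans t≤B (term≤sum B 0≤collisions-term x))) collisions≤
          where
          t≤B : t ≤ B x
          t≤B = subst₂ _≤_ (solve 2 (λ μ v → con 1ℚ :* (μ :* v) := μ :* v) refl μq (ν x))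
            (solve 2 (λ μ v → μ :* (μ :* v) := v :* (μ :* μ)) refl μq (ν x))
            (*-monoʳ t 0≤t (fromℕ-mono-≤ 1≤μ))
        small : (p + t) + (p + t) ≤ 1ℚ
        small = *-cancelˡ-≤ (fromℕ 2) (0<fromℕ {2} (s≤s z≤n)) (subst₂ _≤_
          (solve 2 (λ p t → con (fromℕ 4) :* p :+ con (fromℕ 4) :* t := con (fromℕ 2) :* ((p :+ t) :+ (p :+ t))) refl p t)
          refl
          (ℚₚ.+-mono-≤ {fromℕ 4 * p} {1ℚ} {fromℕ 4 * t} {1ℚ} 4p≤1 4t≤1))
        x≤n : size x ≤ℕ n
        x≤n = Finₚ.toℕ<n x
        a≡ : fromℕ a ≡ fromℕ N * (1ℚ - p)
        a≡ = *-cancelˡ-≡ (fromℕ n) (0<fromℕ 1≤n) (begin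
          fromℕ n * fromℕ a                                    ≡⟨ fromℕ-* n a ⟨
          fromℕ (n ℕ.* a)                                      ≡⟨ cong fromℕ (pred-absorption 1≤n (size x)) ⟨
          fromℕ ((n ℕ.∸ size x) ℕ.* N)                         ≡⟨ fromℕ-* (n ℕ.∸ size x) N ⟩
          fromℕ (n ℕ.∸ size x) * fromℕ N                       ≡⟨ solve 3 (λ d x N → d :* N := ((d :+ x) :- x) :* N) refl (fromℕ (n ℕ.∸ size x)) (fromℕ (size x)) (fromℕ N) ⟩
          ((fromℕ (n ℕ.∸ size x) + fromℕ (size x)) - fromℕ (size x)) * fromℕ N
                                                               ≡⟨ cong (λ z → (z - fromℕ (size x)) * fromℕ N) (trans (sym (fromℕ-+ (n ℕ.∸ size x) (size x))) (cong fromℕ (ℕₚ.m∸n+n≡m x≤n))) ⟩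
          (fromℕ n - fromℕ (size x)) * fromℕ N                 ≡⟨ solve 3 (λ n x N → (n :- x) :* N := (n :- con 1ℚ :* x) :* N) refl (fromℕ n) (fromℕ (size x)) (fromℕ N) ⟩
          (fromℕ n - 1ℚ * fromℕ (size x)) * fromℕ N            ≡⟨ cong (λ z → (fromℕ n - z * fromℕ (size x)) * fromℕ N) (sym nι≡1) ⟩
          (fromℕ n - fromℕ n * ι * fromℕ (size x)) * fromℕ N   ≡⟨ solve 4 (λ n i x N → (n :- n :* i :* x) :* N := n :* (N :* (con 1ℚ :- x :* i))) refl (fromℕ n) ι (fromℕ (size x)) (fromℕ N) ⟩
          fromℕ n * (fromℕ N * (1ℚ - p))                       ∎)
          where
          open ≡-Reasoning
          pred-absorption : ∀ {n} → 1 ≤ℕ n → ∀ x → (n ℕ.∸ x) ℕ.* (n choose x) ≡ n ℕ.* (pred n choose x)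
          pred-absorption {suc n} _ x = co-absorption n x
        μ≡ : fromℕ (μ x) ≡ fromℕ N * t
        μ≡ = sym (trans (solve 3 (λ N μ v → N :* (μ :* v) := μ :* (N :* v)) refl (fromℕ N) μq (ν x))
          (trans (cong (μq *_) Nν≡1) (ℚₚ.*-identityʳ μq)))
        open FallingRatio {N} {a} {μ x} {p} {t} 0≤p 0≤t small a≡ μ≡ (μ≤ x)
        exponent : fromℕ (μ x) * rate ≤ E x
        exponent = ≤-by identity (0≤* (0≤* (0≤fromℕ 2) (≤⇒0≤- p≤1)) (0≤collisions-term x))
          where
          p≤1 : p ≤ 1ℚ
          p≤1 = ℚₚ.≤-trans (≤-by (solve 1 (λ p → con (fromℕ 4) :* p := p :+ con (fromℕ 3) :* p) refl p) (0≤* (0≤fromℕ 3) 0≤p)) 4p≤1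
          size² : fromℕ (size x ^ 2) ≡ fromℕ (size x) * fromℕ (size x)
          size² = trans (cong (λ z → fromℕ (size x ℕ.* z)) (ℕₚ.*-identityʳ (size x))) (fromℕ-* (size x) (size x))
          identity : E x ≡ fromℕ (μ x) * rate + fromℕ 2 * (1ℚ - p) * B x
          identity = trans (cong₂ (λ y z → (ι * y + 2ιι * z) + fromℕ 2 * B x) A₁≡ (trans A₂≡ (cong (_* μq) size²)))
            (solve 4 (λ x i μ v →
              let p = x :* i ; t = μ :* v ; b = v :* (μ :* μ) in
              (i :* (x :* μ) :+ ((i :+ i) :* i) :* (x :* x :* μ)) :+ con (fromℕ 2) :* b :=
              μ :* (p :* (con 1ℚ :+ ((p :+ t) :+ (p :+ t)))) :+ con (fromℕ 2) :* (con 1ℚ :- p) :* b)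
              refl (fromℕ (size x)) ι μq (ν x))

      A-above : ∀ {k} (g : Fin k → ℚ) x → 2 ≤ℕ size x → later g x ≡ g x
      A-above g zero    (s≤s ())
      A-above g (suc x) _ = refl

      each : ∀ x → all-edges x ≼ avoiding μ x exp E x
      each x with sizeView μ x
      ... | one _ _ a≡ = ≼-weaken (0≤E x) (≤⇒≼ (ℕₚ.≤-reflexive (sym a≡)))
      ... | above 2≤x _ a≡ = ≼-≤ʳ (go (μ x) refl) (ℕₚ.≤-reflexive (sym a≡))
        where
        size^1 : ∀ k → fromℕ (k ^ 1) ≡ fromℕ k
        size^1 k = cong fromℕ (ℕₚ.*-identityʳ k)
        go : ∀ v → μ x ≡ v → (n choose size x) choose μ x ≼ (pred n choose size x) choose μ x exp E x
        -- A size that does not occur may exceed n/4, but then both sides are C(·,0) = 1.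
        go zero    eq = ≼-weaken (0≤E x) (≤⇒≼ (ℕₚ.≤-reflexive (trans (cong ((n choose size x) choose_) eq)
          (trans (nC0≡1 (n choose size x)) (sym (trans (cong ((pred n choose size x) choose_) eq) (nC0≡1 (pred n choose size x))))))))
        go (suc v) eq = large x 2≤x
          (trans (A-above (λ x → fromℕ (size x ^ 1) * fromℕ (μ x)) x 2≤x) (cong (_* fromℕ (μ x)) (size^1 (size x))))
          A₂≡ 1≤μ (smallSize x 1≤μ (subst (_≤ scaledMoment 2) A₂≡ (term≤sum A₂ (0≤later _ (0≤weight 2)) x)))
          where
          1≤μ : 1 ≤ℕ μ x
          1≤μ = subst (1 ≤ℕ_) (sym eq) (s≤s z≤n)
          A₂≡ : A₂ x ≡ fromℕ (size x ^ 2) * fromℕ (μ x)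
          A₂≡ = A-above (λ x → fromℕ (size x ^ 2) * fromℕ (μ x)) x 2≤x

      ∑E : sum E ≡ (ι * scaledMoment 1 + 2ιι * scaledMoment 2) + fromℕ 2 * collisions
      ∑E = trans (sum-+ (λ x → ι * A₁ x + 2ιι * A₂ x) (λ x → fromℕ 2 * B x)) (cong₂ _+_
        (trans (sum-+ (λ x → ι * A₁ x) (λ x → 2ιι * A₂ x)) (cong₂ _+_ (sum-*ˡ ι A₁) (sum-*ˡ 2ιι A₂)))
        (sum-*ˡ (fromℕ 2) B))

      0≤s : 0ℚ ≤ s
      0≤s = *-cancelˡ-≤ (fromℕ n) (0<fromℕ 1≤n) (subst₂ _≤_ (sym (ℚₚ.*-zeroʳ (fromℕ n))) (sym ns≡) (0≤sum A₁ (0≤later _ (0≤weight 1))))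

      -- The 3 is 2 + 1: the second-moment term is at most 2cs/n ≤ 2, and twice `collisions` is at
      -- most 1.
      ∑E≤ : sum E ≤ s + fromℕ 3
      ∑E≤ = ℚₚ.≤-trans (ℚₚ.≤-reflexive ∑E) (begin
        (ι * scaledMoment 1 + 2ιι * scaledMoment 2) + fromℕ 2 * collisions
          ≤⟨ ℚₚ.+-mono-≤ (ℚₚ.+-monoʳ-≤ (ι * scaledMoment 1) second) third ⟩
        (ι * scaledMoment 1 + fromℕ 2) + 1ℚ
          ≡⟨ cong (λ z → (z + fromℕ 2) + 1ℚ) first ⟩
        (s + fromℕ 2) + 1ℚ
          ≡⟨ ℚₚ.+-assoc s (fromℕ 2) 1ℚ ⟩
        s + fromℕ 3 ∎)
        where
        open ℚₚ.≤-Reasoning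
        first : ι * scaledMoment 1 ≡ s
        first = trans (cong (ι *_) (sym ns≡)) (trans (solve 3 (λ i n s → i :* (n :* s) := (n :* i) :* s) refl ι (fromℕ n) s)
          (trans (cong (_* s) nι≡1) (ℚₚ.*-identityˡ s)))
        cs≤n : fromℕ c * s ≤ fromℕ n
        cs≤n = ℚₚ.≤-trans (≤-by (solve 1 (λ z → con (fromℕ 16) :* z := z :+ con (fromℕ 15) :* z) refl (fromℕ c * s))
          (0≤* (0≤fromℕ 15) (0≤* (0≤fromℕ c) 0≤s))) sparse
        second : 2ιι * scaledMoment 2 ≤ fromℕ 2
        second = begin
          2ιι * scaledMoment 2                     ≤⟨ *-monoˡ 2ιι (0≤* (0≤+ 0≤ι 0≤ι) 0≤ι) moments ⟩
          2ιι * (fromℕ c * scaledMoment 1)         ≡⟨ solve 3 (λ i c M → ((i :+ i) :* i) :* (c :* M) := (i :+ i) :* (c :* (i :* M))) refl ι (fromℕ c) (scaledMoment 1) ⟩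
          (ι + ι) * (fromℕ c * (ι * scaledMoment 1))   ≡⟨ cong (λ z → (ι + ι) * (fromℕ c * z)) first ⟩
          (ι + ι) * (fromℕ c * s)                  ≤⟨ *-monoˡ (ι + ι) (0≤+ 0≤ι 0≤ι) cs≤n ⟩
          (ι + ι) * fromℕ n                        ≡⟨ solve 2 (λ i n → (i :+ i) :* n := con (fromℕ 2) :* (n :* i)) refl ι (fromℕ n) ⟩
          fromℕ 2 * (fromℕ n * ι)                  ≡⟨ cong (fromℕ 2 *_) nι≡1 ⟩
          fromℕ 2 * 1ℚ                             ≡⟨ ℚₚ.*-identityʳ (fromℕ 2) ⟩
          fromℕ 2                                  ∎
        third : fromℕ 2 * collisions ≤ 1ℚ
        third = ℚₚ.≤-trans (≤-by (solve 1 (λ z → con (fromℕ 4) :* z := con (fromℕ 2) :* z :+ con (fromℕ 2) :* z) refl collisions)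
          (0≤* (0≤fromℕ 2) (0≤sum B 0≤collisions-term))) collisions≤

    -- Read through `count-lone`: a given node is isolated with probability at least e^(-s-3).
    #𝓗≼ : #𝓗 ≼ ∏ (avoiding μ) exp (s + fromℕ 3)
    #𝓗≼ = ≼-weaken ∑E≤ (≼-≤ˡ (ℕₚ.≤-reflexive #𝓗≡∏) (≼-∏ all-edges (avoiding μ) E each))

    -- The expected number of isolated nodes is at least κ, because n ≥ e^h, κ ≤ e^κ, and h exceeds
    -- the loss s + 3 of `#𝓗≼` by at least κ. Chebyshev's inequality then bounds the probability of
    -- connectedness by 1/κ.
    few-connected : ∀ {κ h} → 1 ≤ℕ κ → 1 ≼ n exp (- h) → s + fromℕ 3 + fromℕ κ ≤ h → #connected ℕ.* κ ≤ℕ #𝓗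
    few-connected {κ} {h} 1≤κ 1≼n gap = *-cancelʳ-≤′ #𝓗 1≤#𝓗 (begin
      #connected ℕ.* κ ℕ.* #𝓗                  ≡⟨ ℕₚ.*-assoc #connected κ #𝓗 ⟩
      #connected ℕ.* (κ ℕ.* #𝓗)                ≤⟨ ℕₚ.*-monoʳ-≤ #connected κT≤ ⟩
      #connected ℕ.* (n ℕ.* ∏ (avoiding μ))    ≤⟨ connected-bound (ℕₚ.≤-trans (ℕₚ.*-mono-≤ 1≤κ 1≤#𝓗) κT≤) ⟩
      #𝓗 ℕ.* #𝓗                                ∎)
      where
      open ℕₚ.≤-Reasoning
      κT≤ : κ ℕ.* #𝓗 ≤ℕ n ℕ.* ∏ (avoiding μ)
      κT≤ = ≼⇒≤ exponent (≼-≤ˡ (ℕₚ.≤-reflexive (cong (ℕ._* #𝓗) (sym (ℕₚ.*-identityʳ κ))))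
        (≼-≤ʳ (≼-* (≼-* (≼-≤ˡ (ℕₚ.n≤1+n κ) (suc≼1 κ)) 1≼n) #𝓗≼) (ℕₚ.≤-reflexive (cong (ℕ._* ∏ (avoiding μ)) (ℕₚ.*-identityˡ n)))))
        where
        exponent : (fromℕ κ + (- h)) + (s + fromℕ 3) ≤ 0ℚ
        exponent = ≤-by (solve 3 (λ k h s → con 0ℚ := ((k :+ (:- h)) :+ (s :+ con (fromℕ 3))) :+ (h :- (s :+ con (fromℕ 3) :+ k))) refl (fromℕ κ) h s)
          (≤⇒0≤- gap)

-- From integer bounds to limits of probabilities.

ℚ≤ℕ : ∀ q → ∃[ c ] (1 ≤ℕ c × q ≤ fromℕ c)
ℚ≤ℕ q@(mkℚ (ℤ.+ a) d _) = suc a , s≤s z≤n , subst (_≤ fromℕ (suc a)) (ℚₚ.↥p/↧p≡p q)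
  (*-cancelˡ-≤ (fromℕ (suc d)) (0<fromℕ {suc d} (s≤s z≤n)) (subst₂ _≤_ (sym (fromℕ-÷ a (suc d) (s≤s z≤n))) (fromℕ-* (suc d) (suc a))
    (fromℕ-mono-≤ (ℕₚ.≤-trans (ℕₚ.n≤1+n a) (ℕₚ.m≤n*m (suc a) (suc d))))))
ℚ≤ℕ q@(mkℚ ℤ.-[1+ a ] d _) = 1 , s≤s z≤n , ℚₚ.≤-trans (ℚₚ.<⇒≤ (ℚₚ.negative⁻¹ q)) (0≤fromℕ 1)

1<ε*κ : ∀ ε → 0ℚ < ε → ∃[ κ ] (1 ≤ℕ κ × 1ℚ < ε * fromℕ κ)
1<ε*κ ε@(mkℚ (ℤ.+ zero) d _) 0<ε = contradiction 0<ε (ℚₚ.<-irrefl (sym (ℚₚ.↥p≡0⇒p≡0 ε refl)))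
-- For ε = (a+1)/(d+1) the choice κ = 2(d+1) gives εκ = 2(a+1); the factor 2 makes the inequality
-- strict.
1<ε*κ ε@(mkℚ (ℤ.+ suc a) d _) 0<ε = 2 ℕ.* suc d , s≤s z≤n , ℚₚ.<-≤-trans {1ℚ} {fromℕ 2} 1<2 (subst (fromℕ 2 ≤_) (sym eq) (fromℕ-mono-≤ (ℕₚ.m≤m*n 2 (suc a))))
  where
  1<2 : 1ℚ < fromℕ 2
  1<2 = subst (1ℚ <_) refl (ℚₚ.+-monoʳ-< 1ℚ (ℚₚ.positive⁻¹ 1ℚ))
  eq : ε * fromℕ (2 ℕ.* suc d) ≡ fromℕ (2 ℕ.* suc a)
  eq = begin
    ε * fromℕ (2 ℕ.* suc d)                           ≡⟨ cong₂ _*_ (sym (ℚₚ.↥p/↧p≡p ε)) (fromℕ-* 2 (suc d)) ⟩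
    (suc a ÷ suc d) * (fromℕ 2 * fromℕ (suc d))       ≡⟨ solve 3 (λ x y z → x :* (y :* z) := y :* (z :* x)) refl (suc a ÷ suc d) (fromℕ 2) (fromℕ (suc d)) ⟩
    fromℕ 2 * (fromℕ (suc d) * (suc a ÷ suc d))       ≡⟨ cong (fromℕ 2 *_) (fromℕ-÷ (suc a) (suc d) (s≤s z≤n)) ⟩
    fromℕ 2 * fromℕ (suc a)                           ≡⟨ fromℕ-* 2 (suc a) ⟨
    fromℕ (2 ℕ.* suc a)                               ∎
    where open ≡-Reasoning
1<ε*κ ε@(mkℚ ℤ.-[1+ a ] d _) 0<ε = contradiction (ℚₚ.<-trans 0<ε (ℚₚ.negative⁻¹ ε)) (ℚₚ.<-irrefl refl)

÷-small : ∀ {z T κ ε} → 1 ≤ℕ T → 1ℚ < ε * fromℕ κ → z ℕ.* κ ≤ℕ T → z ÷ T < ε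
÷-small {z} {T} {κ} {ε} 1≤T 1<εκ zκ≤T = ℚₚ.*-cancelˡ-<-nonNeg (fromℕ κ * fromℕ T)
  {{nonNegative (0≤* (0≤fromℕ κ) (0≤fromℕ T))}} (ℚₚ.≤-<-trans below beyond)
  where
  below : fromℕ κ * fromℕ T * (z ÷ T) ≤ fromℕ T * 1ℚ
  below = subst₂ _≤_
    (sym (trans (ℚₚ.*-assoc (fromℕ κ) (fromℕ T) (z ÷ T)) (trans (cong (fromℕ κ *_) (fromℕ-÷ z T 1≤T)) (trans (ℚₚ.*-comm (fromℕ κ) (fromℕ z)) (sym (fromℕ-* z κ))))))
    (sym (ℚₚ.*-identityʳ (fromℕ T))) (fromℕ-mono-≤ zκ≤T)
  beyond : fromℕ T * 1ℚ < fromℕ κ * fromℕ T * ε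
  beyond = subst (fromℕ T * 1ℚ <_) (solve 3 (λ T e k → T :* (e :* k) := k :* T :* e) refl (fromℕ T) ε (fromℕ κ))
    (ℚₚ.*-monoʳ-<-pos (fromℕ T) {{positive (0<fromℕ 1≤T)}} 1<εκ)

module _ {A : Set} {R : A → Set} (xs : List A) (R? : Decidable R) where

  private
    T = length xs

  ℙ-near-0 : ∀ {κ ε} → 1 ≤ℕ T → 1ℚ < ε * fromℕ κ → sumBy (λ x → 𝟙 (R? x)) xs ℕ.* κ ≤ℕ T → abs (ℙ xs R? - 0ℚ) < ε
  ℙ-near-0 {κ} {ε} 1≤T 1<εκ le = subst (_< ε)
    (trans (sym (ℚₚ.0≤p⇒∣p∣≡p (0≤÷ z T))) (cong abs (trans (sym (ℚₚ.+-identityʳ (z ÷ T))) (cong (λ w → w ÷ T - 0ℚ) (sym (length-filter R? xs))))))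
    (÷-small {z} {T} {κ} 1≤T 1<εκ le)
    where z = sumBy (λ x → 𝟙 (R? x)) xs

  ℙ-near-1 : ∀ {κ ε} → 1 ≤ℕ T → 1ℚ < ε * fromℕ κ → sumBy (λ x → 𝟙 (¬? (R? x))) xs ℕ.* κ ≤ℕ T → abs (ℙ xs R? - 1ℚ) < ε
  ℙ-near-1 {κ} {ε} 1≤T 1<εκ le = subst (_< ε)
    (trans (sym (ℚₚ.0≤p⇒∣p∣≡p (0≤÷ y T))) (trans (sym (ℚₚ.∣-p∣≡∣p∣ (y ÷ T))) (cong abs (trans complement (cong (λ w → w ÷ T - 1ℚ) (sym (length-filter R? xs)))))))
    (÷-small {y} {T} {κ} 1≤T 1<εκ le)
    where
    z y : ℕ
    z = sumBy (λ x → 𝟙 (R? x)) xs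
    y = sumBy (λ x → 𝟙 (¬? (R? x))) xs
    z+y≡T : z ℕ.+ y ≡ T
    z+y≡T = trans (sym (sumBy-+ (λ x → 𝟙 (R? x)) (λ x → 𝟙 (¬? (R? x))) xs))
      (trans (sumBy-cong (λ x → one-of (R? x)) xs) (sym (length≡sumBy xs)))
      where
      one-of : ∀ {P : Set} (d : Dec P) → 𝟙 d ℕ.+ 𝟙 (¬? d) ≡ 1
      one-of (yes _) = refl
      one-of (no _)  = refl
    complement : - (y ÷ T) ≡ z ÷ T - 1ℚ
    complement = *-cancelˡ-≡ (fromℕ T) (0<fromℕ 1≤T) (begin
      fromℕ T * (- (y ÷ T))                      ≡⟨ sym (ℚₚ.neg-distribʳ-* (fromℕ T) (y ÷ T)) ⟩
      - (fromℕ T * (y ÷ T))                      ≡⟨ cong -_ (fromℕ-÷ y T 1≤T) ⟩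
      - fromℕ y                                  ≡⟨ solve 2 (λ z y → :- y := z :- (z :+ y)) refl (fromℕ z) (fromℕ y) ⟩
      fromℕ z - (fromℕ z + fromℕ y)              ≡⟨ cong₂ _-_ (sym (fromℕ-÷ z T 1≤T)) (trans (sym (fromℕ-+ z y)) (cong fromℕ z+y≡T)) ⟩
      fromℕ T * (z ÷ T) - fromℕ T                ≡⟨ solve 2 (λ T r → T :* r :- T := T :* (r :- con 1ℚ)) refl (fromℕ T) (z ÷ T) ⟩
      fromℕ T * (z ÷ T - 1ℚ)                     ∎)
      where open ≡-Reasoning

nonNegativeInteger : ∀ k → 0ℚ ≤ k / 1 → ∃[ a ] k ≡ ℤ.+ a
nonNegativeInteger (ℤ.+ a)    _ = a , refl
nonNegativeInteger ℤ.-[1+ a ] 0≤ = contradiction (ℚₚ.<-≤-trans (ℚₚ.neg-antimono-< (0<fromℕ {suc a} (s≤s z≤n))) 0≤)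
  (ℚₚ.<-irrefl refl)

record Multiplicities {n} (m : ℕ) (f : Fin n → ℚ) : Set where
  field
    μ     : Fin n → ℕ
    mf≡μ  : ∀ x → fromℕ m * f x ≡ fromℕ (μ x)
    ∑μ≡m  : ∑ μ ≡ m
    μ≤    : ∀ x → μ x ≤ℕ n choose size x

-- Nonnegativity of f makes the integers m f(x) natural numbers, and Σ f(x) = 1 makes them add up to
-- m.
multiplicities : ∀ {n} m (f : Fin n → ℚ) → IsDistribution f →
  ((x : Fin n) → ∃[ k ] (fromℕ m * f x ≡ k / 1 × k ℤ.≤ ℤ.+ (n C size x))) → Multiplicities m f
multiplicities {n} m f dist integral = record
  { μ = μ ; mf≡μ = mf≡μ ; ∑μ≡m = fromℕ-injective total≡ ; μ≤ = μ≤ }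
  where
  integer : ∀ x → ∃[ a ] proj₁ (integral x) ≡ ℤ.+ a
  integer x = nonNegativeInteger (proj₁ (integral x))
    (subst (0ℚ ≤_) (proj₁ (proj₂ (integral x))) (0≤* (0≤fromℕ m) (IsDistribution.nonNegative dist x)))
  μ : Fin n → ℕ
  μ x = proj₁ (integer x)
  mf≡μ : ∀ x → fromℕ m * f x ≡ fromℕ (μ x)
  mf≡μ x = trans (proj₁ (proj₂ (integral x))) (cong (_/ 1) (proj₂ (integer x)))
  μ≤ : ∀ x → μ x ≤ℕ n choose size x
  μ≤ x = subst (μ x ≤ℕ_) (sym (choose≡C n (size x)))
    (ℤₚ.drop‿+≤+ (subst (ℤ._≤ ℤ.+ (n C size x)) (proj₂ (integer x)) (proj₂ (proj₂ (integral x)))))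
  total≡ : fromℕ (∑ μ) ≡ fromℕ m
  total≡ = trans (fromℕ-∑ μ) (trans (sum-cong (λ x → fromℕ (μ x)) (λ x → fromℕ m * f x) (λ x → sym (mf≡μ x)))
    (trans (sum-*ˡ (fromℕ m) f) (trans (cong (fromℕ m *_) (IsDistribution.total dist)) (ℚₚ.*-identityʳ (fromℕ m)))))

-- lowerSum n 1 = 1/2 + ⋯ + 1/n

lowerSum-gain : ∀ {n} → 1 ≤ℕ n → n ≼ 1 exp (1ℚ + lowerSum n 1)
lowerSum-gain {suc n} _ = ≼-≡ (ℚₚ.+-comm (lowerSum (suc n) 1) 1ℚ)
  (≼-≤ˡ (ℕₚ.≤-trans (ℕₚ.≤-reflexive (ℕₚ.+-comm 1 n)) (ℕₚ.≤-trans (ℕₚ.+-monoˡ-≤ 1 (ℕₚ.m≤m+n n 0)) (ℕₚ.n≤1+n (n ℕ.+ 0 ℕ.+ 1))))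
    -- The product telescopes down to 2 rather than 1; 2 ≤ e supplies the 1 in the exponent.
    (≼-trans (recipSum-gain (1 ℕ.* n) 1) (suc≼1 1)))

lowerSum-loss : ∀ {n} → 1 ≤ℕ n → 1 ≼ n exp (- lowerSum n 1)
lowerSum-loss {suc n} _ = ≼-≤ʳ (recipSum-loss (1 ℕ.* n) 1)
  (ℕₚ.≤-reflexive (trans (cong (ℕ._+ 1) (ℕₚ.+-identityʳ n)) (ℕₚ.+-comm n 1)))

-- With A = 32c, `recipSum-sublinear` gives A h ≤ A² + n ≤ 2n, and halving leaves 16 c h ≤ n.
lowerSum-small : ∀ {n c} → 1 ≤ℕ c → (32 ℕ.* c) ℕ.* (32 ℕ.* c) ≤ℕ n → fromℕ 16 * (fromℕ c * lowerSum n 1) ≤ fromℕ n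
lowerSum-small {n} {c} 1≤c A²≤n = *-cancelˡ-≤ (fromℕ 2) (0<fromℕ {2} (s≤s z≤n)) (begin
  fromℕ 2 * (fromℕ 16 * (fromℕ c * h))           ≡⟨ solve 2 (λ c h → con (fromℕ 2) :* (con (fromℕ 16) :* (c :* h)) := con (fromℕ 32) :* c :* h) refl (fromℕ c) h ⟩
  fromℕ 32 * fromℕ c * h                         ≡⟨ cong (_* h) (sym (fromℕ-* 32 c)) ⟩
  fromℕ A * h                                    ≤⟨ recipSum-sublinear A (1 ℕ.* (n ℕ.∸ 1)) 1 ⟩
  fromℕ (A ℕ.* (A ℕ.∸ 1) ℕ.+ 1 ℕ.* (n ℕ.∸ 1))    ≤⟨ fromℕ-mono-≤ bound ⟩
  fromℕ (2 ℕ.* n)                                ≡⟨ fromℕ-* 2 n ⟩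
  fromℕ 2 * fromℕ n                              ∎)
  where
  open ℚₚ.≤-Reasoning
  h = lowerSum n 1
  A = 32 ℕ.* c
  bound : A ℕ.* (A ℕ.∸ 1) ℕ.+ 1 ℕ.* (n ℕ.∸ 1) ≤ℕ 2 ℕ.* n
  bound = ℕₚ.+-mono-≤ (ℕₚ.≤-trans (ℕₚ.*-monoʳ-≤ A (ℕₚ.m∸n≤m A 1)) A²≤n) (ℕₚ.+-monoˡ-≤ 0 (ℕₚ.m∸n≤m n 1))

_∧ᵉ_ : ∀ {P Q : ℕ → Set} → Eventually P → Eventually Q → Eventually (λ n → P n × Q n)
(N , p) ∧ᵉ (M , q) = N ⊔ M , λ n le → p n (ℕₚ.≤-trans (ℕₚ.m≤m⊔n N M) le) , q n (ℕₚ.≤-trans (ℕₚ.m≤n⊔m N M) le)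

-- The two sides of the threshold.

module Threshold {n : ℕ} (2≤n : 2 ≤ℕ n) (m : ℕ) (f : Fin n → ℚ) (1≤m : 1 ≤ℕ m) (mult : Multiplicities m f) where

  open Multiplicities mult
  open Isolated 2≤n m f μ 1≤m mf≡μ ∑μ≡m μ≤

  s : ℚ
  s = (m ÷ n) * moment 1 f

  ns≡ : fromℕ n * s ≡ scaledMoment 1
  ns≡ = trans (sym (ℚₚ.*-assoc (fromℕ n) (m ÷ n) (moment 1 f))) (trans (cong (_* moment 1 f) (fromℕ-÷ m n 1≤n)) (scaledMoment≡ 1))

  -- The approximation of log n at index 0 is h, with error 1, so the hypothesis gives h - s - 1 ≤
  -- -(8 + 2κ). The 8 is 6 + 1 + 1: the 6 of `CutEstimate`, the 1 in n ≤ e^(1+h), and this error.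
  connected-likely : ∀ {κ ε} → 1ℚ < ε * fromℕ κ → log n -ℚ s ℝ≤ - fromℕ (8 ℕ.+ 2 ℕ.* κ) → abs (ℙ (𝓗 n m f) connected? - 1ℚ) < ε
  connected-likely {κ} {ε} 1<εκ small = ℙ-near-1 (𝓗 n m f) connected? {κ} {ε} 1≤#𝓗 1<εκ
    (subst (_≤ℕ #𝓗) (ℕₚ.*-comm κ #disconnected)
      (disconnected-bound {κ} {s} {lowerSum n 1} (trans ns≡ (sym incidences≡)) (lowerSum-gain 1≤n) gap))
    where
    h = lowerSum n 1
    gap : 1ℚ + h + fromℕ (6 ℕ.+ 2 ℕ.* κ) ≤ s
    gap = ≤-by (trans (solve 3 (λ h s k → s := ((con 1ℚ :+ h) :+ (con (fromℕ 6) :+ k)) :+ (:- (con (fromℕ 8) :+ k) :- ((h :- s) :- con 1ℚ))) refl h s (fromℕ (2 ℕ.* κ)))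
        (cong₂ (λ a b → ((1ℚ + h) + a) + (- b - ((h - s) - 1ℚ))) (sym (fromℕ-+ 6 (2 ℕ.* κ))) (sym (fromℕ-+ 8 (2 ℕ.* κ)))))
      (≤⇒0≤- (small 0))

  module _ {c} (1≤c : 1 ≤ℕ c)
    (sparse : abs (∑[ x < n ] (1 ÷ (n C size x) * (f x * f x))) ≤ (1 ÷ 4) * abs (1 ÷ (m ^ 2)))
    (moments : moment 2 f ≤ fromℕ c * moment 0 f)
    (n-large : (32 ℕ.* c) ℕ.* (32 ℕ.* c) ≤ℕ n) where

    private
      M = fromℕ m
      1≤m² : 1 ≤ℕ m ^ 2
      1≤m² = ℕₚ.m^n>0 m {{ℕ.>-nonZero 1≤m}} 2
      m²≡ : fromℕ (m ^ 2) ≡ M * M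
      m²≡ = trans (cong (λ z → fromℕ (m ℕ.* z)) (ℕₚ.*-identityʳ m)) (fromℕ-* m m)

      collisions≡ : collisions ≡ M * M * (∑[ x < n ] (1 ÷ (n C size x) * (f x * f x)))
      collisions≡ = trans (sum-cong _ _ pointwise) (sum-*ˡ (M * M) (λ x → 1 ÷ (n C size x) * (f x * f x)))
        where
        pointwise : ∀ x → ν x * (fromℕ (μ x) * fromℕ (μ x)) ≡ M * M * (1 ÷ (n C size x) * (f x * f x))
        pointwise x = trans (cong₂ (λ N y → 1 ÷ N * (y * y)) (choose≡C n (size x)) (sym (mf≡μ x)))
          (solve 3 (λ v m f → v :* ((m :* f) :* (m :* f)) := m :* m :* (v :* (f :* f))) refl (1 ÷ (n C size x)) M (f x))

      collisions≤ : fromℕ 4 * collisions ≤ 1ℚ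
      collisions≤ = begin
        fromℕ 4 * collisions                                ≡⟨ cong (fromℕ 4 *_) collisions≡ ⟩
        fromℕ 4 * (M * M * a)                               ≤⟨ *-monoˡ (fromℕ 4) (0≤fromℕ 4) (*-monoˡ (M * M) (0≤* (0≤fromℕ m) (0≤fromℕ m)) (ℚₚ.≤-trans a≤∣a∣ sparse)) ⟩
        fromℕ 4 * (M * M * ((1 ÷ 4) * abs (1 ÷ (m ^ 2))))   ≡⟨ cong₂ (λ y z → fromℕ 4 * (y * ((1 ÷ 4) * z))) (sym m²≡) (ℚₚ.0≤p⇒∣p∣≡p (0≤÷ 1 (m ^ 2))) ⟩
        fromℕ 4 * (fromℕ (m ^ 2) * ((1 ÷ 4) * (1 ÷ (m ^ 2))))   ≡⟨ solve 4 (λ a b c d → a :* (b :* (c :* d)) := (a :* c) :* (b :* d)) refl (fromℕ 4) (fromℕ (m ^ 2)) (1 ÷ 4) (1 ÷ (m ^ 2)) ⟩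
        fromℕ 4 * (1 ÷ 4) * (fromℕ (m ^ 2) * (1 ÷ (m ^ 2))) ≡⟨ cong (fromℕ 4 * (1 ÷ 4) *_) (fromℕ-÷ 1 (m ^ 2) 1≤m²) ⟩
        1ℚ                                                  ∎
        where
        open ℚₚ.≤-Reasoning
        a = ∑[ x < n ] (1 ÷ (n C size x) * (f x * f x))
        a≤∣a∣ : a ≤ abs a
        a≤∣a∣ with ℚₚ.≤-total 0ℚ a
        ... | inj₁ 0≤a = ℚₚ.≤-reflexive (sym (ℚₚ.0≤p⇒∣p∣≡p 0≤a))
        ... | inj₂ a≤0 = ℚₚ.≤-trans a≤0 (ℚₚ.0≤∣p∣ a)

      -- Sizes are at least 1, so (f)_0 ≤ (f)_1; this trades the moment in the hypothesis for (f)_1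
      -- and bounds the second moment by a multiple of n s.
      moments≤ : scaledMoment 2 ≤ fromℕ c * scaledMoment 1
      moments≤ = begin
        scaledMoment 2                     ≡⟨ scaledMoment≡ 2 ⟨
        M * moment 2 f                     ≤⟨ *-monoˡ M (0≤fromℕ m) moments ⟩
        M * (fromℕ c * moment 0 f)         ≡⟨ solve 3 (λ m c x → m :* (c :* x) := c :* (m :* x)) refl M (fromℕ c) (moment 0 f) ⟩
        fromℕ c * (M * moment 0 f)         ≡⟨ cong (fromℕ c *_) (scaledMoment≡ 0) ⟩
        fromℕ c * scaledMoment 0           ≤⟨ *-monoˡ (fromℕ c) (0≤fromℕ c) (scaledMoment-mono 0) ⟩
        fromℕ c * scaledMoment 1           ∎
        where open ℚₚ.≤-Reasoning

    -- Reading log n at index 0 again costs 1, so the 4 is the 3 of `#𝓗≼` plus 1. Below the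
    -- threshold s ≤ h, so the sublinearity of h also gives 16 c s ≤ n.
    connected-unlikely : ∀ {κ ε} → 1 ≤ℕ κ → 1ℚ < ε * fromℕ κ → fromℕ (4 ℕ.+ κ) ≤ℝ log n -ℚ s → abs (ℙ (𝓗 n m f) connected? - 0ℚ) < ε
    connected-unlikely {κ} {ε} 1≤κ 1<εκ large = ℙ-near-0 (𝓗 n m f) connected? {κ} {ε} 1≤#𝓗 1<εκ
      (few-connected 1≤c ns≡ collisions≤ moments≤ sparse-s 1≤κ (lowerSum-loss 1≤n) gap)
      where
      h = lowerSum n 1
      gap : s + fromℕ 3 + fromℕ κ ≤ h
      gap = ≤-by (trans (solve 3 (λ s h k → h := ((s :+ con (fromℕ 3)) :+ k) :+ (((h :- s) :+ con 1ℚ) :- (con (fromℕ 4) :+ k))) refl s h (fromℕ κ))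
          (cong (λ z → ((s + fromℕ 3) + fromℕ κ) + (((h - s) + 1ℚ) - z)) (sym (fromℕ-+ 4 κ))))
        (≤⇒0≤- (large 0))
      s≤h : s ≤ h
      s≤h = ℚₚ.≤-trans (≤-by (ℚₚ.+-assoc s (fromℕ 3) (fromℕ κ)) (0≤+ (0≤fromℕ 3) (0≤fromℕ κ))) gap
      sparse-s : fromℕ 16 * (fromℕ c * s) ≤ fromℕ n
      sparse-s = ℚₚ.≤-trans (*-monoˡ (fromℕ 16) (0≤fromℕ 16) (*-monoˡ (fromℕ c) (0≤fromℕ c) s≤h)) (lowerSum-small {n} {c} 1≤c n-large)

open import Data.Integer using (ℤ; +_)

mainTheorem1 : (m : ℕ → ℕ) (f : (n : ℕ) → Fin n → ℚ) →
    (∀ n → 1 ≤ℕ n → 1 ≤ℕ m n) →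
    (∀ n → 1 ≤ℕ n → IsDistribution (f n)) →
    (∀ n → 1 ≤ℕ n → (x : Fin n) → ∃[ k ] (fromℕ (m n) * f n x ≡ k / 1 × k ℤ.≤ + (n C size x))) →
    (λ n → ∑[ x < n ] (1 ÷ (n C size x) * (f n x * f n x))) ≪ (λ n → 1 ÷ (m n ^ 2)) →
    (λ n → moment 2 (f n)) ≲ (λ n → moment 0 (f n)) →
    ((λ n → log n -ℚ (m n ÷ n) * moment 1 (f n)) ⟶+∞ →
    (λ n → ℙ (𝓗 n (m n) (f n)) connected?) ⟶ 0ℚ)
    × ((λ n → log n -ℚ (m n ÷ n) * moment 1 (f n)) ⟶-∞ →
    (λ n → ℙ (𝓗 n (m n) (f n)) connected?) ⟶ 1ℚ)
mainTheorem1 m f 1≤m dist integral sparse (C , moments) = belowThreshold , aboveThreshold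
  where
  from2 : Eventually (2 ≤ℕ_)
  from2 = 2 , λ n le → le
  mult : ∀ n → 2 ≤ℕ n → Multiplicities (m n) (f n)
  mult n 2≤n = multiplicities (m n) (f n) (dist n (ℕₚ.<⇒≤ 2≤n)) (integral n (ℕₚ.<⇒≤ 2≤n))
  aboveThreshold : (λ n → log n -ℚ (m n ÷ n) * moment 1 (f n)) ⟶-∞ → (λ n → ℙ (𝓗 n (m n) (f n)) connected?) ⟶ 1ℚ
  aboveThreshold to-∞ ε 0<ε with 1<ε*κ ε 0<ε
  ... | κ , 1≤κ , 1<εκ with from2 ∧ᵉ to-∞ (- fromℕ (8 ℕ.+ 2 ℕ.* κ))
  ... | N , eventually = N , λ n N≤n → let (2≤n , small) = eventually n N≤n in
    Threshold.connected-likely 2≤n (m n) (f n) (1≤m n (ℕₚ.<⇒≤ 2≤n)) (mult n 2≤n) {κ} {ε} 1<εκ small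
  belowThreshold : (λ n → log n -ℚ (m n ÷ n) * moment 1 (f n)) ⟶+∞ → (λ n → ℙ (𝓗 n (m n) (f n)) connected?) ⟶ 0ℚ
  belowThreshold to+∞ ε 0<ε with 1<ε*κ ε 0<ε | ℚ≤ℕ C
  ... | κ , 1≤κ , 1<εκ | c , 1≤c , C≤c
    -- The 1/4 is the bound on `collisions` behind t ≤ 1/4, and (32c)² is the range of
    -- `lowerSum-small`.
    with (from2 ∧ᵉ to+∞ (fromℕ (4 ℕ.+ κ))) ∧ᵉ ((sparse (1 ÷ 4) (ℚₚ.positive⁻¹ (1 ÷ 4)) ∧ᵉ moments) ∧ᵉ ((32 ℕ.* c) ℕ.* (32 ℕ.* c) , λ n le → le))
  ... | N , eventually = N , λ n N≤n → let ((2≤n , large) , (sparse-n , moments-n) , n-large) = eventually n N≤n in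
    Threshold.connected-unlikely 2≤n (m n) (f n) (1≤m n (ℕₚ.<⇒≤ 2≤n)) (mult n 2≤n) {c} 1≤c sparse-n
      -- (f)_0 ≥ 0 removes the absolute value and allows C to be raised to the natural number c.
      (ℚₚ.≤-trans moments-n (ℚₚ.≤-trans (ℚₚ.≤-reflexive (cong (C *_) (ℚₚ.0≤p⇒∣p∣≡p (0≤moment₀ n (ℕₚ.<⇒≤ 2≤n)))))
        (*-monoʳ (moment 0 (f n)) (0≤moment₀ n (ℕₚ.<⇒≤ 2≤n)) C≤c)))
      n-large {κ} {ε} 1≤κ 1<εκ large
    where
    0≤moment₀ : ∀ n → 1 ≤ℕ n → 0ℚ ≤ moment 0 (f n)
    0≤moment₀ n 1≤n = subst (0ℚ ≤_) (sym (moment≡sum 0 (f n))) (0≤sum _ (0≤later _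
      (λ x → 0≤* (0≤fromℕ (size x ^ 0)) (IsDistribution.nonNegative (dist n 1≤n) x))))
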